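{- The integer group determinants of $GA(1,9)$ are exactly the integers of the form $$D=AB^{8},\qquad A,B\in\mathbb Z,$$ where either $A$ is odd or $2^5\mid A$, and $B\equiv A\pmod 9$.
   Context: For a finite group $G=\{g_1,\dots,g_n\}$ and an element $\sum_{g\in G}a_g g$ of the group ring $\mathbb Z[G]$ (all $a_g\in\mathbb Z$), the group determinant is $D\left(\sum_{g\in G}a_g g\right)=\det\left(a_{g_ig_j^{ -1}}\right)_{i,j=1}^n$. An integer group determinant of $G$ is any integer of this form. The general affine group of degree one over $\mathbb F_9$ is $GA(1,9)=\left\{\begin{pmatrix} a & b\\ 0 & 1\end{pmatrix}: a\in\mathbb F_9^*,\ b\in\mathbb F_9\right\}$ under matrix multiplication (a group of order $72$). -}

module Defs where

open import Algebra.Apartness.Bundles using (HeytingField)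
open import Algebra.Bundles using (CommutativeRing; Group)
import Algebra.Properties.Semiring.Exp as Exp
import Algebra.Properties.Semiring.Sum as Sum
open import Data.Empty using (⊥-elim-irr)
open import Data.Fin.Base using (Fin; zero; suc; toℕ; punchIn; combine; remQuot)
open import Data.Fin.Patterns using (0F; 1F; 2F)
open import Data.Fin.Properties using (all?; combine-remQuot; remQuot-combine) renaming (_≟_ to _≟ᶠ_)
open import Data.Integer.Base using (ℤ)
open import Data.Integer.Properties using (+-*-commutativeRing)
open import Data.Nat.Base as ℕ using (ℕ; zero; suc)
open import Data.Product.Base using (Σ; _×_; _,_; proj₁; proj₂; uncurry)
open import Data.Product.Properties using (≡-dec)
open import Data.Sum.Base using (inj₁; inj₂)
open import Function.Base using (_∘_)
open import Function.Bundles using (Func; Inverse; _⟶ₛ_; _↔_; mk↔ₛ′)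
open import Level using (Level; 0ℓ; _⊔_)
open import Relation.Binary.Definitions using (DecidableEquality)
open import Relation.Binary.PropositionalEquality
  using (_≡_; _≢_; refl; sym; trans; cong; cong₂; setoid; isEquivalence; module ≡-Reasoning)
open import Relation.Binary.PropositionalEquality.Properties using (decSetoid)
import Relation.Binary.Properties.DecSetoid as DecSetoidProperties
open import Relation.Nullary using (Dec)
open import Relation.Nullary.Decidable using (map′; from-yes; _⊎-dec_; ¬?)
open import Relation.Unary using (Decidable)

private
  variable
    c ℓ : Level
    n : ℕ

module Determinant (R : CommutativeRing c ℓ) where
  open CommutativeRing R using (Carrier; _*_; -_; 1#; semiring)
  open Exp semiring using (_^_)
  open Sum semiring using (sum)

  -- Laplace expansion along the first row.
  det : (Fin n → Fin n → Carrier) → Carrier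
  det {zero}  M = 1#
  det {suc n} M =
    sum λ j → (- 1#) ^ toℕ j * (M zero j * det λ i k → M (suc i) (punchIn j k))

module GroupDeterminant (G : Group c ℓ) (g : Inverse (setoid (Fin n)) (Group.setoid G)) where
  open Group G using (_∙_; _⁻¹) renaming (setoid to Gₛ)
  open Determinant +-*-commutativeRing using (det)

  -- As G is finite, an element of ℤ[G] is an arbitrary coefficient function.
  groupDeterminant : Gₛ ⟶ₛ setoid ℤ → ℤ
  groupDeterminant a = det λ i j → Func.to a (Inverse.to g i ∙ Inverse.to g j ⁻¹)

  IsIntegerGroupDeterminant : ℤ → Set (c ⊔ ℓ)
  IsIntegerGroupDeterminant D = Σ (Gₛ ⟶ₛ setoid ℤ) λ a → D ≡ groupDeterminant a

module F₃ where
  infixl 6 _+_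
  infixl 7 _*_
  infix  8 -_

  1+_ : Fin 3 → Fin 3
  1+ 0F = 1F
  1+ 1F = 2F
  1+ 2F = 0F

  _+_ _*_ : Fin 3 → Fin 3 → Fin 3
  0F + y = y
  1F + y = 1+ y
  2F + y = 1+ (1+ y)

  0F * y = 0F
  1F * y = y
  2F * y = y + y

  -_ : Fin 3 → Fin 3
  - x = 2F * x

-- 𝔽₉ = 𝔽₃[i] with i² = -1, the pair (x , y) standing for x + y i;
-- X² + 1 is irreducible over 𝔽₃.
F₉ : Set
F₉ = Fin 3 × Fin 3

infixl 6 _+_
infixl 7 _*_
infix  8 -_
infix  9 _⁻¹

0# 1# : F₉
0# = 0F , 0F
1# = 1F , 0F

_+_ _*_ : F₉ → F₉ → F₉
(x , y) + (z , w) = x F₃.+ z , y F₃.+ w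
(x , y) * (z , w) = x F₃.* z F₃.+ F₃.- (y F₃.* w) , x F₃.* w F₃.+ y F₃.* z

-_ : F₉ → F₉
- (x , y) = F₃.- x , F₃.- y

-- (x + y i)⁻¹ = (x - y i) / N with N = x² + y², and N⁻¹ = N for N ≠ 0 in 𝔽₃;
-- the value at 0 is 0.
_⁻¹ : F₉ → F₉
(x , y) ⁻¹ = N F₃.* x , F₃.- (N F₃.* y)
  where N = x F₃.* x F₃.+ y F₃.* y

_≟_ : DecidableEquality F₉
_≟_ = ≡-dec _≟ᶠ_ _≟ᶠ_

private
  ∀? : ∀ {p} {P : F₉ → Set p} → Decidable P → Dec (∀ x → P x)
  ∀? P? = map′ (λ f (x , y) → f x y) (λ f x y → f (x , y)) (all? λ x → all? λ y → P? (x , y))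

+-assoc : ∀ x y z → (x + y) + z ≡ x + (y + z)
+-assoc = from-yes (∀? λ x → ∀? λ y → ∀? λ z → ((x + y) + z) ≟ (x + (y + z)))

+-comm : ∀ x y → x + y ≡ y + x
+-comm = from-yes (∀? λ x → ∀? λ y → (x + y) ≟ (y + x))

+-identityˡ : ∀ x → 0# + x ≡ x
+-identityˡ = from-yes (∀? λ x → (0# + x) ≟ x)

+-identityʳ : ∀ x → x + 0# ≡ x
+-identityʳ = from-yes (∀? λ x → (x + 0#) ≟ x)

-‿inverseˡ : ∀ x → - x + x ≡ 0#
-‿inverseˡ = from-yes (∀? λ x → (- x + x) ≟ 0#)

-‿inverseʳ : ∀ x → x + - x ≡ 0#
-‿inverseʳ = from-yes (∀? λ x → (x + - x) ≟ 0#)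

*-assoc : ∀ x y z → (x * y) * z ≡ x * (y * z)
*-assoc = from-yes (∀? λ x → ∀? λ y → ∀? λ z → ((x * y) * z) ≟ (x * (y * z)))

*-comm : ∀ x y → x * y ≡ y * x
*-comm = from-yes (∀? λ x → ∀? λ y → (x * y) ≟ (y * x))

*-identityˡ : ∀ x → 1# * x ≡ x
*-identityˡ = from-yes (∀? λ x → (1# * x) ≟ x)

*-identityʳ : ∀ x → x * 1# ≡ x
*-identityʳ = from-yes (∀? λ x → (x * 1#) ≟ x)

*-distribˡ-+ : ∀ x y z → x * (y + z) ≡ x * y + x * z
*-distribˡ-+ = from-yes (∀? λ x → ∀? λ y → ∀? λ z → (x * (y + z)) ≟ (x * y + x * z))

*-distribʳ-+ : ∀ x y z → (y + z) * x ≡ y * x + z * x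
*-distribʳ-+ x y z =
  trans (*-comm (y + z) x) (trans (*-distribˡ-+ x y z) (cong₂ _+_ (*-comm x y) (*-comm x z)))

*-zeroˡ : ∀ x → 0# * x ≡ 0#
*-zeroˡ = from-yes (∀? λ x → (0# * x) ≟ 0#)

*-zeroʳ : ∀ x → x * 0# ≡ 0#
*-zeroʳ = from-yes (∀? λ x → (x * 0#) ≟ 0#)

⁻¹-inverseʳ : ∀ x → .(x ≢ 0#) → x * x ⁻¹ ≡ 1#
⁻¹-inverseʳ x x≢0 with from-yes (∀? λ x → (x ≟ 0#) ⊎-dec ((x * x ⁻¹) ≟ 1#)) x
... | inj₁ x≡0 = ⊥-elim-irr (x≢0 x≡0)
... | inj₂ eq  = eq

⁻¹-inverseˡ : ∀ x → .(x ≢ 0#) → x ⁻¹ * x ≡ 1#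
⁻¹-inverseˡ x x≢0 = trans (*-comm (x ⁻¹) x) (⁻¹-inverseʳ x x≢0)

F₉-commutativeRing : CommutativeRing 0ℓ 0ℓ
F₉-commutativeRing = record
  { Carrier = F₉ ; _≈_ = _≡_ ; _+_ = _+_ ; _*_ = _*_ ; -_ = -_ ; 0# = 0# ; 1# = 1#
  ; isCommutativeRing = record
    { isRing = record
      { +-isAbelianGroup = record
        { isGroup = record
          { isMonoid = record
            { isSemigroup = record
              { isMagma = record { isEquivalence = isEquivalence ; ∙-cong = cong₂ _+_ }
              ; assoc = +-assoc
              }
            ; identity = +-identityˡ , +-identityʳ
            }
          ; inverse = -‿inverseˡ , -‿inverseʳ
          ; ⁻¹-cong = cong -_
          }
        ; comm = +-comm
        }
      ; *-cong = cong₂ _*_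
      ; *-assoc = *-assoc
      ; *-identity = *-identityˡ , *-identityʳ
      ; distrib = *-distribˡ-+ , *-distribʳ-+
      }
    ; *-comm = *-comm
    }
  }

private
  1≢0 : 1# ≢ 0#
  1≢0 ()

  x-y≡0⇒x≡y : ∀ x y → x + - y ≡ 0# → x ≡ y
  x-y≡0⇒x≡y x y eq = begin
    x               ≡⟨ +-identityʳ x ⟨
    x + 0#          ≡⟨ cong (x +_) (-‿inverseˡ y) ⟨
    x + (- y + y)   ≡⟨ +-assoc x (- y) y ⟨
    (x + - y) + y   ≡⟨ cong (_+ y) eq ⟩
    0# + y          ≡⟨ +-identityˡ y ⟩
    y               ∎
    where open ≡-Reasoning

F₉-field : HeytingField 0ℓ 0ℓ 0ℓ
F₉-field = record
  { Carrier = F₉ ; _≈_ = _≡_ ; _#_ = _≢_ ; _+_ = _+_ ; _*_ = _*_ ; -_ = -_ ; 0# = 0# ; 1# = 1#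
  ; isHeytingField = record
    { isHeytingCommutativeRing = record
      { isCommutativeRing = CommutativeRing.isCommutativeRing F₉-commutativeRing
      ; isApartnessRelation = ≉-isApartnessRelation
      ; #⇒invertible = λ {x} {y} x≢y →
          let x-y≢0 = x≢y ∘ x-y≡0⇒x≡y x y in
          (x + - y) ⁻¹ , ⁻¹-inverseˡ _ x-y≢0 , ⁻¹-inverseʳ _ x-y≢0
      ; invertible⇒# = λ { {x} (z , _ , inv) refl →
          1≢0 (trans (sym inv) (trans (cong (_* z) (-‿inverseʳ x)) (*-zeroˡ z))) }
      }
    ; tight = ≉-tight
    }
  }
  where open DecSetoidProperties (decSetoid _≟_) using (≉-isApartnessRelation; ≉-tight)

*-≢0 : ∀ {x y} → x ≢ 0# → y ≢ 0# → x * y ≢ 0#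
*-≢0 {x} {y} x≢0 y≢0 xy≡0 = y≢0 (begin
  y                 ≡⟨ *-identityˡ y ⟨
  1# * y            ≡⟨ cong (_* y) (⁻¹-inverseˡ x x≢0) ⟨
  (x ⁻¹ * x) * y    ≡⟨ *-assoc (x ⁻¹) x y ⟩
  x ⁻¹ * (x * y)    ≡⟨ cong (x ⁻¹ *_) xy≡0 ⟩
  x ⁻¹ * 0#         ≡⟨ *-zeroʳ (x ⁻¹) ⟩
  0#                ∎)
  where open ≡-Reasoning

⁻¹-≢0 : ∀ {x} → x ≢ 0# → x ⁻¹ ≢ 0#
⁻¹-≢0 {x} x≢0 x⁻¹≡0 =
  1≢0 (trans (sym (⁻¹-inverseʳ x x≢0)) (trans (cong (x *_) x⁻¹≡0) (*-zeroʳ x)))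

-- The matrix with rows (a , b) and (0 , 1).  The proof of a ≢ 0# is irrelevant,
-- so propositional equality is equality of matrices.
record GA : Set where
  constructor mat
  field
    a b  : F₉
    .a≢0 : a ≢ 0#

open GA

GA-≡ : {g h : GA} → a g ≡ a h → b g ≡ b h → g ≡ h
GA-≡ refl refl = refl

infixl 7 _∙_

_∙_ : GA → GA → GA
mat a b a≢0 ∙ mat c d c≢0 = mat (a * c) (a * d + b) (*-≢0 a≢0 c≢0)

ε : GA
ε = mat 1# 0# 1≢0

inv : GA → GA
inv (mat a b a≢0) = mat (a ⁻¹) (- (a ⁻¹ * b)) (⁻¹-≢0 a≢0)

private
  ∙-assoc : ∀ g h k → (g ∙ h) ∙ k ≡ g ∙ (h ∙ k)
  ∙-assoc (mat a b _) (mat c d _) (mat e f _) = GA-≡ (*-assoc a c e) (begin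
    a * c * f + (a * d + b)     ≡⟨ +-assoc (a * c * f) (a * d) b ⟨
    a * c * f + a * d + b       ≡⟨ cong (λ t → t + a * d + b) (*-assoc a c f) ⟩
    a * (c * f) + a * d + b     ≡⟨ cong (_+ b) (*-distribˡ-+ a (c * f) d) ⟨
    a * (c * f + d) + b         ∎)
    where open ≡-Reasoning

  ∙-identityˡ : ∀ g → ε ∙ g ≡ g
  ∙-identityˡ (mat a b _) =
    GA-≡ (*-identityˡ a) (trans (+-identityʳ (1# * b)) (*-identityˡ b))

  ∙-identityʳ : ∀ g → g ∙ ε ≡ g
  ∙-identityʳ (mat a b _) =
    GA-≡ (*-identityʳ a) (trans (cong (_+ b) (*-zeroʳ a)) (+-identityˡ b))

  ∙-inverseˡ : ∀ g → inv g ∙ g ≡ ε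
  ∙-inverseˡ (mat a b a≢0) = GA-≡ (⁻¹-inverseˡ a a≢0) (-‿inverseʳ (a ⁻¹ * b))

  *-neg : ∀ x y → x * - y ≡ - (x * y)
  *-neg = from-yes (∀? λ x → ∀? λ y → (x * - y) ≟ (- (x * y)))

  ∙-inverseʳ : ∀ g → g ∙ inv g ≡ ε
  ∙-inverseʳ (mat a b a≢0) = GA-≡ (⁻¹-inverseʳ a a≢0) (begin
    a * - (a ⁻¹ * b) + b      ≡⟨ cong (_+ b) (*-neg a (a ⁻¹ * b)) ⟩
    - (a * (a ⁻¹ * b)) + b    ≡⟨ cong (λ t → - t + b) (*-assoc a (a ⁻¹) b) ⟨
    - (a * a ⁻¹ * b) + b      ≡⟨ cong (λ t → - (t * b) + b) (⁻¹-inverseʳ a a≢0) ⟩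
    - (1# * b) + b            ≡⟨ cong (λ t → - t + b) (*-identityˡ b) ⟩
    - b + b                   ≡⟨ -‿inverseˡ b ⟩
    0#                        ∎)
    where open ≡-Reasoning

GA[1,9] : Group 0ℓ 0ℓ
GA[1,9] = record
  { Carrier = GA ; _≈_ = _≡_ ; _∙_ = _∙_ ; ε = ε ; _⁻¹ = inv
  ; isGroup = record
    { isMonoid = record
      { isSemigroup = record
        { isMagma = record { isEquivalence = isEquivalence ; ∙-cong = cong₂ _∙_ }
        ; assoc = ∙-assoc
        }
      ; identity = ∙-identityˡ , ∙-identityʳ
      }
    ; inverse = ∙-inverseˡ , ∙-inverseʳ
    ; ⁻¹-cong = cong inv
    }
  }

-- Enumerations of GA(1,9) by Fin 72 exist; the units are the nonzero values
-- of remQuot 3 : Fin 9 → F₉.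
enumeration : Fin 72 ↔ GA
enumeration = mk↔ₛ′ to from to∘from from∘to
  where
  unit : Fin 8 → F₉
  unit k = remQuot 3 (suc k)

  index : F₉ → Fin 8
  index x with uncurry combine x
  ... | zero  = zero
  ... | suc k = k

  unit≢0 : ∀ k → unit k ≢ 0#
  unit≢0 = from-yes (all? λ k → ¬? (unit k ≟ 0#))

  index-unit : ∀ k → index (unit k) ≡ k
  index-unit = from-yes (all? λ k → index (unit k) ≟ᶠ k)

  unit-index : ∀ x → .(x ≢ 0#) → unit (index x) ≡ x
  unit-index x x≢0 with from-yes (∀? λ x → (x ≟ 0#) ⊎-dec (unit (index x) ≟ x)) x
  ... | inj₁ x≡0 = ⊥-elim-irr (x≢0 x≡0)
  ... | inj₂ eq  = eq

  to : Fin 72 → GA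
  to i = mat (unit (proj₁ (remQuot 9 i))) (remQuot 3 (proj₂ (remQuot {8} 9 i))) (unit≢0 (proj₁ (remQuot 9 i)))

  from : GA → Fin 72
  from g = combine (index (a g)) (uncurry combine (b g))

  to∘from : ∀ g → to (from g) ≡ g
  to∘from (mat x (y , z) x≢0) = GA-≡
    (trans (cong (unit ∘ proj₁) eq) (unit-index x x≢0))
    (trans (cong (remQuot {3} 3 ∘ proj₂) eq) (remQuot-combine y z))
    where
    eq : remQuot 9 (combine (index x) (combine y z)) ≡ (index x , combine y z)
    eq = remQuot-combine (index x) (combine y z)

  from∘to : ∀ i → from (to i) ≡ i
  from∘to i = trans
    (cong₂ combine (index-unit (proj₁ (remQuot 9 i)))
                   (combine-remQuot {3} 3 (proj₂ (remQuot {8} 9 i))))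
    (combine-remQuot {8} 9 i)

{-# OPTIONS --safe #-}
-- Write N for the translations and H = C₈ for the linear maps, so that G = N ⋊ H. As a right
-- ℤ[N]-module ℤ[G] is free with basis H, and left multiplication by an element F of ℤ[G] becomes
-- an 8 × 8 matrix over the commutative ring ℤ[N]; let Δ be its determinant. Over ℤ[ω] the nine
-- characters ψ (t x) of N diagonalise the action of ℤ[N], so the group determinant is the product
-- of the nine values ψ_t(Δ). The trivial character gives A, the C₈-determinant of the image of F in
-- ℤ[H]; the other eight are permuted by H and give the same value B. Fourier inversion at 0 says
-- A + 8 B = 9 Δ₀, so B is an integer congruent to A mod 9. The condition on A is the description
-- of the integer group determinants of C₈, read off from the factors f(1) f(-1), f(i) f(-i) and
-- the norm of f(ζ₈).
--
-- Conversely take F = f + (1 , 1) (Σ h) (p₀ + p₁ (1 , n)) with f ∈ ℤ[H]. Its matrices at the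
-- characters are rank one perturbations of the circulant of f, so A and B are affine in p₀ and p₁;
-- six choices of f and n reach all admissible pairs.
module Submission where

open import Defs as F₉ using (F₉; GA; mat; GA-≡; _∙_; inv; GA[1,9]; module Determinant; module GroupDeterminant)
open import Algebra.Bundles using (CommutativeRing; Group)
open import Algebra.Morphism.Structures using (IsRingHomomorphism)
import Algebra.Properties.CommutativeSemigroup as CommutativeSemigroupProperties
import Algebra.Properties.Ring as RingProperties
import Algebra.Properties.Semiring.Exp as Exp
import Algebra.Properties.Semiring.Sum as Sum
open import Data.Fin.Base using (Fin; zero; suc; toℕ; punchIn; splitAt; _↑ˡ_; _↑ʳ_; combine; remQuot)
open import Data.Fin.Permutation using (Permutation; Permutation′; permutation; _⟨$⟩ʳ_; _⟨$⟩ˡ_; inverseˡ)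
open import Data.Fin.Properties
  using (all?; _≟_; toℕ-↑ˡ; splitAt-↑ˡ; splitAt-↑ʳ; combine-remQuot; remQuot-combine)
open import Data.Nat.Base as ℕ using (ℕ; zero; suc; s≤s)
open import Data.Product.Base using (_×_; _,_; proj₁; proj₂; ∃-syntax)
open import Data.Sum.Base using (_⊎_; inj₁; inj₂; [_,_])
open import Data.Unit.Polymorphic.Base using (⊤; tt)
import Data.Vec.Functional as Functional
open import Function.Base using (_∘_)
open import Function.Bundles using (_↔_; _⇔_; mk⇔; Func; Inverse)
open import Level using (0ℓ; _⊔_)
import Relation.Binary.PropositionalEquality as ≡
open ≡ using (_≡_; _≢_)
open import Relation.Nullary using (¬_; Dec; yes; no; contradiction)

-- Determinants over a commutative ring

-- The matrix of characters is not invertible over ℤ[ω]: its product with the conjugate characters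
-- is 9 times the identity. So the group matrix is block diagonalised only up to that factor, and
-- the determinants are compared after multiplication by a power of 9, which can be cancelled in
-- ℤ[ω]. For the converse, let d be the circulant determinant of f and κ its part from the
-- nontrivial characters of C₈. The p₀ term moves A by 8 κ and B by - κ, so by itself it ties B to
-- A. The p₁ term moves A by 8 κ too, but B by - κ + 9 e; a choice of n with e = ± 1 frees B within
-- its class mod 9. It remains to write A as d + 8 κ S. With κ = 1 the values d = ± 1, ± 3 represent
-- the odd classes mod 8. For even A the parts of κ from -1, from ± i and from the primitive eighth
-- roots are all even, so 8 divides κ; with κ = 8 the values d = 0 and d = 32 cover the multiples of
-- 32.

module DeterminantTheory {c ℓ} (R : CommutativeRing c ℓ) where
  open CommutativeRing R hiding (zero)
  open Exp semiring using (_^_)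
  open Sum semiring
  open RingProperties ring
  open CommutativeSemigroupProperties *-commutativeSemigroup using (x∙yz≈y∙xz)
  open import Relation.Binary.Reasoning.Setoid setoid
  open Functional using (_∷_; tail; insertAt; removeAt; foldr)

  private
    variable
      k m n : ℕ

  opaque
    -- Opaque, so that conversion checking does not expand 72! terms.
    det : (Fin n → Fin n → Carrier) → Carrier
    det = Determinant.det R

    det-def : (M : Fin n → Fin n → Carrier) → det M ≡ Determinant.det R M
    det-def M = ≡.refl

  Row : ℕ → Set c
  Row m = Fin m → Carrier

  Matrix : ℕ → ℕ → Set c
  Matrix m n = Fin m → Row n

  infix 4 _≋_ _≈ᴹ_

  _≋_ : Row m → Row m → Set ℓ
  u ≋ v = ∀ l → u l ≈ v l

  _≈ᴹ_ : Matrix m n → Matrix m n → Set ℓ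
  M ≈ᴹ N = ∀ i → M i ≋ N i

  _⊕_ : Row m → Row m → Row m
  (u ⊕ v) l = u l + v l

  _⊙_ : Carrier → Row m → Row m
  (r ⊙ v) l = r * v l

  infixl 7 _⊗_

  _⊗_ : Matrix k m → Matrix m n → Matrix k n
  (M ⊗ N) i j = sum λ l → M i l * N l j

  δ : Fin n → Fin n → Carrier
  δ zero    zero    = 1#
  δ zero    (suc _) = 0#
  δ (suc _) zero    = 0#
  δ (suc i) (suc j) = δ i j

  ∑-zero : {f : Row n} → (∀ i → f i ≈ 0#) → sum f ≈ 0#
  ∑-zero {n} f≈0 = trans (sum-cong-≋ f≈0) (sum-replicate-zero n)

  ∑-δˡ : (f : Row n) (j : Fin n) → sum (λ i → δ j i * f i) ≈ f j
  ∑-δˡ {suc n} f zero = begin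
    1# * f zero + sum (λ i → 0# * f (suc i)) ≈⟨ +-cong (*-identityˡ _) (∑-zero {n} λ i → zeroˡ (f (suc i))) ⟩
    f zero + 0#                              ≈⟨ +-identityʳ _ ⟩
    f zero                                   ∎
  ∑-δˡ {suc n} f (suc j) = begin
    0# * f zero + sum (λ i → δ j i * f (suc i)) ≈⟨ +-cong (zeroˡ _) (∑-δˡ (f ∘ suc) j) ⟩
    0# + f (suc j)                              ≈⟨ +-identityˡ _ ⟩
    f (suc j)                                   ∎

  δ-sym : (i j : Fin n) → δ i j ≈ δ j i
  δ-sym zero    zero    = refl
  δ-sym zero    (suc j) = refl
  δ-sym (suc i) zero    = refl
  δ-sym (suc i) (suc j) = δ-sym i j

  ∑-δʳ : (f : Row n) (j : Fin n) → sum (λ i → f i * δ i j) ≈ f j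
  ∑-δʳ f j = trans (sum-cong-≋ λ i → trans (*-comm _ _) (*-congʳ (δ-sym i j))) (∑-δˡ f j)

  ∷-cong : {u v : Row m} {X Y : Matrix n m} → u ≋ v → X ≈ᴹ Y → (u ∷ X) ≈ᴹ (v ∷ Y)
  ∷-cong u≋v X≈Y zero    = u≋v
  ∷-cong u≋v X≈Y (suc i) = X≈Y i

  ∷-η : (X : Matrix (suc n) m) → X ≈ᴹ (X zero ∷ tail X)
  ∷-η X zero    l = refl
  ∷-η X (suc i) l = refl

  opaque
    unfolding det

    det-cong : {M N : Matrix n n} → M ≈ᴹ N → det M ≈ det N
    det-cong {zero}  M≈N = refl
    det-cong {suc n} M≈N = sum-cong-≋ λ j →
      *-congˡ {x = (- 1#) ^ toℕ j} (*-cong (M≈N zero j) (det-cong λ i k → M≈N (suc i) (punchIn j k)))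

  -- Linear and alternating forms in the rows of a matrix

  record IsLinear (L : Row m → Carrier) : Set (c ⊔ ℓ) where
    field
      cong : ∀ {u v} → u ≋ v → L u ≈ L v
      add  : ∀ u v → L (u ⊕ v) ≈ L u + L v
      scal : ∀ r v → L (r ⊙ v) ≈ r * L v

    zero-out : L (λ _ → 0#) ≈ 0#
    zero-out = trans (cong λ l → sym (zeroˡ _)) (trans (scal 0# (λ _ → 0#)) (zeroˡ _))

    combination : ∀ {k} (a : Row k) (us : Matrix k m) →
                  L (λ l → sum λ i → a i * us i l) ≈ sum λ i → a i * L (us i)
    combination {zero}  a us = zero-out
    combination {suc k} a us = trans (add _ _) (+-cong (scal _ _) (combination (a ∘ suc) (us ∘ suc)))

  record IsLinearMap (L : Row m → Row n) : Set (c ⊔ ℓ) where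
    field
      cong : ∀ {u v} → u ≋ v → L u ≋ L v
      add  : ∀ u v → L (u ⊕ v) ≋ (L u ⊕ L v)
      scal : ∀ r v → L (r ⊙ v) ≋ (r ⊙ L v)

  -- Matrices are functions without extensionality, so respecting pointwise equality is a separate
  -- hypothesis on a form.
  Congruent : (Matrix n m → Carrier) → Set (c ⊔ ℓ)
  Congruent g = ∀ {X Y} → X ≈ᴹ Y → g X ≈ g Y

  AdjacentlyAlternating : ∀ n → (Matrix (suc n) m → Carrier) → Set (c ⊔ ℓ)
  AdjacentlyAlternating zero    g = ⊤
  AdjacentlyAlternating (suc n) g = ∀ v X → g (v ∷ v ∷ X) ≈ 0#

  -- Multilinear in the rows and zero when two adjacent rows agree, stated by
  -- recursion on the rows so that fixing the first row gives a form of the same kind.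
  Alternating : ∀ n → (Matrix n m → Carrier) → Set (c ⊔ ℓ)
  Alternating zero    g = ⊤
  Alternating (suc n) g =
    (∀ X → IsLinear λ v → g (v ∷ X)) × AdjacentlyAlternating n g × (∀ v → Alternating n λ X → g (v ∷ X))

  Alternating-resp : ∀ n {g h : Matrix n m → Carrier} → (∀ X → g X ≈ h X) → Alternating n g → Alternating n h
  Alternating-resp zero    g≈h _ = tt
  Alternating-resp (suc n) g≈h (lin , adj , sub) =
      (λ X → let open IsLinear (lin X) in record
        { cong = λ u≋v → trans (sym (g≈h _)) (trans (cong u≋v) (g≈h _))
        ; add  = λ u v → trans (sym (g≈h _)) (trans (add u v) (+-cong (g≈h _) (g≈h _)))
        ; scal = λ r v → trans (sym (g≈h _)) (trans (scal r v) (*-congˡ (g≈h _)))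
        })
    , adj′ n g≈h adj
    , λ v → Alternating-resp n (λ X → g≈h (v ∷ X)) (sub v)
    where
    adj′ : ∀ n {g h : Matrix (suc n) _ → Carrier} → (∀ X → g X ≈ h X) →
           AdjacentlyAlternating n g → AdjacentlyAlternating n h
    adj′ zero    g≈h _   = tt
    adj′ (suc n) g≈h adj v X = trans (sym (g≈h _)) (adj v X)

  Alternating-∘ : ∀ n {g : Matrix n m → Carrier} {L : Row k → Row m} → Congruent g → IsLinearMap L →
                  Alternating n g → Alternating n (λ X → g (L ∘ X))
  Alternating-∘ zero    g-cong L-lin _ = tt
  Alternating-∘ {m} {k} (suc n) {g} {L} g-cong L-lin (lin , adj , sub) =
      (λ X → let open IsLinear (lin (L ∘ X)) in record
        { cong = λ u≋v → g-cong λ { zero → L.cong u≋v ; (suc i) l → refl }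
        ; add  = λ u v → trans (ext _ X) (trans (cong (L.add u v))
                   (trans (add _ _) (+-cong (sym (ext u X)) (sym (ext v X)))))
        ; scal = λ r v → trans (ext _ X) (trans (cong (L.scal r v))
                   (trans (scal _ _) (*-congˡ (sym (ext v X)))))
        })
    , adj′ n g-cong adj
    , λ v → Alternating-resp n (λ X → sym (ext v X))
        (Alternating-∘ n (λ X≈Y → g-cong (∷-cong (λ _ → refl) X≈Y)) L-lin (sub (L v)))
    where
    module L = IsLinearMap L-lin
    ext : ∀ v X → g (L ∘ (v ∷ X)) ≈ g (L v ∷ L ∘ X)
    ext v X = g-cong λ { zero l → refl ; (suc i) l → refl }
    adj′ : ∀ n {g : Matrix (suc n) m → Carrier} → Congruent g →
           AdjacentlyAlternating n g → AdjacentlyAlternating n (λ X → g (L ∘ X))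
    adj′ zero    g-cong _   = tt
    adj′ (suc n) g-cong adj v X =
      trans (g-cong λ { zero l → refl ; (suc zero) l → refl ; (suc (suc i)) l → refl }) (adj (L v) (L ∘ X))

  Alternating-combination : ∀ n (a : Row k) {h : Fin k → Matrix n m → Carrier} →
                            (∀ j → Alternating n (h j)) → Alternating n (λ X → sum λ j → a j * h j X)
  Alternating-combination zero    a _   = tt
  Alternating-combination {k} {m} (suc n) a {h} alt =
      (λ X → record
        { cong = λ u≋v → sum-cong-≋ λ j → *-congˡ (IsLinear.cong (proj₁ (alt j) X) u≋v)
        ; add  = λ u v → trans
            (sum-cong-≋ λ j → trans (*-congˡ (IsLinear.add (proj₁ (alt j) X) u v)) (distribˡ _ _ _))
            (∑-distrib-+ (λ j → a j * h j (u ∷ X)) (λ j → a j * h j (v ∷ X)))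
        ; scal = λ r v → trans
            (sum-cong-≋ λ j → trans (*-congˡ (IsLinear.scal (proj₁ (alt j) X) r v)) (x∙yz≈y∙xz _ _ _))
            (sym (*-distribˡ-sum r (λ j → a j * h j (v ∷ X))))
        })
    , adj′ n (λ j → proj₁ (proj₂ (alt j)))
    , λ v → Alternating-combination n a λ j → proj₂ (proj₂ (alt j)) v
    where
    adj′ : ∀ n {h : Fin k → Matrix (suc n) m → Carrier} → (∀ j → AdjacentlyAlternating n (h j)) →
           AdjacentlyAlternating n (λ X → sum λ j → a j * h j X)
    adj′ zero    _   = tt
    adj′ (suc n) adj v X = ∑-zero λ j → trans (*-congˡ (adj j v X)) (zeroʳ _)

  -- Polarisation: the form vanishes with `u ⊕ v` in both of the first two rows, and so do the two
  -- diagonal terms of its expansion.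
  swap : ∀ n {g : Matrix (suc (suc n)) m → Carrier} → Congruent g → Alternating (suc (suc n)) g →
         ∀ u v X → g (u ∷ v ∷ X) + g (v ∷ u ∷ X) ≈ 0#
  swap n {g} g-cong (lin , adj , sub) u v X = begin
    g (u ∷ v ∷ X) + g (v ∷ u ∷ X)
      ≈⟨ +-cong (+-identityˡ _) (+-identityʳ _) ⟨
    (0# + g (u ∷ v ∷ X)) + (g (v ∷ u ∷ X) + 0#)
      ≈⟨ +-cong (+-congʳ (adj u X)) (+-congˡ (adj v X)) ⟨
    (g (u ∷ u ∷ X) + g (u ∷ v ∷ X)) + (g (v ∷ u ∷ X) + g (v ∷ v ∷ X))
      ≈⟨ +-cong (IsLinear.add (proj₁ (sub u) X) u v) (IsLinear.add (proj₁ (sub v) X) u v) ⟨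
    g (u ∷ (u ⊕ v) ∷ X) + g (v ∷ (u ⊕ v) ∷ X)
      ≈⟨ IsLinear.add (lin ((u ⊕ v) ∷ X)) u v ⟨
    g ((u ⊕ v) ∷ (u ⊕ v) ∷ X)
      ≈⟨ adj (u ⊕ v) X ⟩
    0# ∎

  -- `swap` exchanges `u` with the first row of `X`. With that row fixed, `u` stands one place
  -- closer to its copy, and induction applies.
  alternating-repeat : ∀ n {g : Matrix (suc n) m → Carrier} → Congruent g → Alternating (suc n) g →
                       ∀ u X i → X i ≋ u → g (u ∷ X) ≈ 0#
  alternating-repeat (suc n) {g} g-cong (lin , adj , sub) u X zero Xi≋u =
    trans (g-cong λ { zero l → refl ; (suc zero) l → Xi≋u l ; (suc (suc i)) l → refl }) (adj u (tail X))
  alternating-repeat (suc n) {g} g-cong alt@(lin , adj , sub) u X (suc i) Xi≋u = begin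
    g (u ∷ X)                        ≈⟨ g-cong (∷-cong (λ _ → refl) (∷-η X)) ⟩
    g (u ∷ X zero ∷ tail X)          ≈⟨ +-identityʳ _ ⟨
    g (u ∷ X zero ∷ tail X) + 0#     ≈⟨ +-congˡ (alternating-repeat n (λ Y≈Z → g-cong (∷-cong (λ _ → refl) Y≈Z))
                                          (sub (X zero)) u (tail X) i Xi≋u) ⟨
    g (u ∷ X zero ∷ tail X) + g (X zero ∷ u ∷ tail X)
                                     ≈⟨ swap n g-cong alt u (X zero) (tail X) ⟩
    0#                               ∎

  -- Multiples of `u` are removed one row at a time. The vanishing hypothesis holds for a form whose
  -- preceding row is fixed to be `u`; with `u` a basis row this clears a column.
  alternating-clear : ∀ n {g : Matrix n m → Carrier} → Congruent g → Alternating n g → ∀ u →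
                      (∀ X i → X i ≋ u → g X ≈ 0#) →
                      ∀ X Y (r : Row n) → (∀ i → X i ≋ ((r i ⊙ u) ⊕ Y i)) → g X ≈ g Y
  alternating-clear zero    g-cong alt u g-zero X Y r eq = g-cong λ ()
  alternating-clear (suc n) {g} g-cong (lin , adj , sub) u g-zero X Y r eq = begin
    g X                                       ≈⟨ g-cong (λ { zero l → eq zero l ; (suc i) l → refl }) ⟩
    g (((r zero ⊙ u) ⊕ Y zero) ∷ tail X)      ≈⟨ L.add _ _ ⟩
    g ((r zero ⊙ u) ∷ tail X) + g (Y zero ∷ tail X)
      ≈⟨ +-congʳ (trans (L.scal _ _) (trans (*-congˡ (g-zero (u ∷ tail X) zero λ _ → refl)) (zeroʳ _))) ⟩
    0# + g (Y zero ∷ tail X)                  ≈⟨ +-identityˡ _ ⟩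
    g (Y zero ∷ tail X)                       ≈⟨ alternating-clear n (λ X≈Y → g-cong (∷-cong (λ _ → refl) X≈Y))
                                                   (sub (Y zero)) u (λ X i → g-zero (Y zero ∷ X) (suc i))
                                                   (tail X) (tail Y) (r ∘ suc) (eq ∘ suc) ⟩
    g (Y zero ∷ tail Y)                       ≈⟨ g-cong (∷-η Y) ⟨
    g Y                                       ∎
    where module L = IsLinear (lin (tail X))

  -- Adjoining a zero column at `j` restricts a form on long rows to the size of a minor.
  insertAt-linear : (j : Fin (suc n)) → IsLinearMap (λ v → insertAt v j 0#)
  insertAt-linear j = record { cong = cong j ; add = add j ; scal = scal j }
    where
    cong : ∀ {n} (j : Fin (suc n)) {u v : Row n} → u ≋ v → insertAt u j 0# ≋ insertAt v j 0#
    cong zero u≋v zero    = refl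
    cong zero u≋v (suc l) = u≋v l
    cong {suc n} (suc j) u≋v zero    = u≋v zero
    cong {suc n} (suc j) u≋v (suc l) = cong j (u≋v ∘ suc) l
    add : ∀ {n} (j : Fin (suc n)) (u v : Row n) → insertAt (u ⊕ v) j 0# ≋ (insertAt u j 0# ⊕ insertAt v j 0#)
    add zero u v zero    = sym (+-identityˡ _)
    add zero u v (suc l) = refl
    add {suc n} (suc j) u v zero    = refl
    add {suc n} (suc j) u v (suc l) = add j (u ∘ suc) (v ∘ suc) l
    scal : ∀ {n} (j : Fin (suc n)) r (v : Row n) → insertAt (r ⊙ v) j 0# ≋ (r ⊙ insertAt v j 0#)
    scal zero r v zero    = sym (zeroʳ _)
    scal zero r v (suc l) = refl
    scal {suc n} (suc j) r v zero    = refl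
    scal {suc n} (suc j) r v (suc l) = scal j r (v ∘ suc) l

  insertAt-δ : (j : Fin (suc n)) (i : Fin n) → insertAt (δ i) j 0# ≋ δ (punchIn j i)
  insertAt-δ zero    i       zero    = refl
  insertAt-δ zero    i       (suc l) = refl
  insertAt-δ (suc j) zero    zero    = refl
  insertAt-δ (suc j) (suc i) zero    = refl
  insertAt-δ (suc j) zero    (suc l) = insertAt-0 j l
    where
    insertAt-0 : ∀ {n} (j : Fin (suc n)) (l : Fin (suc n)) → insertAt (λ _ → 0#) j 0# l ≈ 0#
    insertAt-0 zero zero    = refl
    insertAt-0 zero (suc l) = refl
    insertAt-0 {suc n} (suc j) zero    = refl
    insertAt-0 {suc n} (suc j) (suc l) = insertAt-0 j l
  insertAt-δ (suc j) (suc i) (suc l) = insertAt-δ j i l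

  split-row : (v : Row (suc n)) (j : Fin (suc n)) → v ≋ ((v j ⊙ δ j) ⊕ insertAt (removeAt v j) j 0#)
  split-row v zero zero    = sym (trans (+-identityʳ _) (*-identityʳ _))
  split-row v zero (suc l) = sym (trans (+-congʳ (zeroʳ _)) (+-identityˡ _))
  split-row {suc n} v (suc j) zero    = sym (trans (+-congʳ (zeroʳ _)) (+-identityˡ _))
  split-row {suc n} v (suc j) (suc l) = split-row (v ∘ suc) j l

  -- Row `j` passes the `j` rows above it, one `swap` each. This is the origin of the sign in the
  -- Laplace expansion.
  alternating-rotate : ∀ n {g : Matrix (suc n) m → Carrier} → Congruent g → Alternating (suc n) g →
                       ∀ (u : Matrix (suc n) m) j → g (u j ∷ u ∘ punchIn j) ≈ (- 1#) ^ toℕ j * g u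
  alternating-rotate n g-cong alt u zero =
    trans (g-cong λ { zero l → refl ; (suc i) l → refl }) (sym (*-identityˡ _))
  alternating-rotate (suc n) {g} g-cong alt@(lin , adj , sub) u (suc j) = begin
    g (u (suc j) ∷ u ∘ punchIn (suc j))
      ≈⟨ g-cong (λ { zero l → refl ; (suc zero) l → refl ; (suc (suc i)) l → refl }) ⟩
    g (u (suc j) ∷ u zero ∷ (tail u ∘ punchIn j))
      ≈⟨ x+y≈0⇒x≈-y (swap n g-cong alt _ _ _) ⟩
    - g (u zero ∷ tail u j ∷ (tail u ∘ punchIn j))
      ≈⟨ -‿cong (alternating-rotate n (λ X≈Y → g-cong (∷-cong (λ _ → refl) X≈Y)) (sub (u zero)) (tail u) j) ⟩
    - ((- 1#) ^ toℕ j * g (u zero ∷ tail u))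
      ≈⟨ -1*x≈-x _ ⟨
    - 1# * ((- 1#) ^ toℕ j * g (u zero ∷ tail u))
      ≈⟨ *-assoc _ _ _ ⟨
    (- 1#) ^ toℕ (suc j) * g (u zero ∷ tail u)
      ≈⟨ *-congˡ (g-cong (∷-η u)) ⟨
    (- 1#) ^ toℕ (suc j) * g u ∎
    where
    x+y≈0⇒x≈-y : ∀ {x y} → x + y ≈ 0# → x ≈ - y
    x+y≈0⇒x≈-y = +-inverseˡ-unique _ _

  opaque
    unfolding det

    -- Expand the first row in the basis `δ`, clear column `j` below it by `alternating-clear`, and
    -- apply induction to the form in the remaining columns. Its value at the identity is a sign
    -- times `g δ` by `alternating-rotate`, so what appears is the Laplace expansion of `det`.
    alternating-unique : ∀ n {g : Matrix n n → Carrier} → Congruent g → Alternating n g →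
                         ∀ M → g M ≈ det M * g δ
    alternating-unique zero    g-cong alt M = trans (g-cong λ ()) (sym (*-identityˡ _))
    alternating-unique (suc n) {g} g-cong alt@(lin , adj , sub) M = begin
      g M
        ≈⟨ g-cong (λ { zero l → sym (∑-δʳ (M zero) l) ; (suc i) l → refl }) ⟩
      g ((λ l → sum λ j → M zero j * δ j l) ∷ tail M)
        ≈⟨ IsLinear.combination (lin (tail M)) (M zero) δ ⟩
      sum (λ j → M zero j * g (δ j ∷ tail M))
        ≈⟨ sum-cong-≋ (λ j → trans (*-congˡ (minor-term j)) (rearrange-factors (M zero j) _ _ _)) ⟩
      sum (λ j → (- 1#) ^ toℕ j * (M zero j * det (minor j)) * g δ)
        ≈⟨ *-distribʳ-sum (g δ) (λ j → (- 1#) ^ toℕ j * (M zero j * det (minor j))) ⟨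
      det M * g δ ∎
      where
      minor : Fin (suc n) → Matrix n n
      minor j i k = M (suc i) (punchIn j k)

      sub-cong : ∀ v → Congruent (λ X → g (v ∷ X))
      sub-cong v X≈Y = g-cong (∷-cong (λ _ → refl) X≈Y)

      rearrange-factors : ∀ x d s y → x * (d * (s * y)) ≈ s * (x * d) * y
      rearrange-factors x d s y = begin
        x * (d * (s * y))   ≈⟨ *-assoc _ _ _ ⟨
        (x * d) * (s * y)   ≈⟨ x∙yz≈y∙xz _ _ _ ⟩
        s * ((x * d) * y)   ≈⟨ *-assoc _ _ _ ⟨
        s * (x * d) * y     ∎

      minor-term : ∀ j → g (δ j ∷ tail M) ≈ det (minor j) * ((- 1#) ^ toℕ j * g δ)
      minor-term j = begin
        g (δ j ∷ tail M)
          ≈⟨ alternating-clear n (sub-cong (δ j)) (sub (δ j)) (δ j) (alternating-repeat n g-cong alt (δ j))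
               (tail M) (λ i → insertAt (minor j i) j 0#) (λ i → M (suc i) j) (λ i → split-row (M (suc i)) j) ⟩
        g (δ j ∷ λ i → insertAt (minor j i) j 0#)
          ≈⟨ alternating-unique n
               (λ X≈Y → sub-cong (δ j) λ i → IsLinearMap.cong (insertAt-linear j) (X≈Y i))
               (Alternating-∘ n (sub-cong (δ j)) (insertAt-linear j) (sub (δ j))) (minor j) ⟩
        det (minor j) * g (δ j ∷ λ i → insertAt (δ i) j 0#)
          ≈⟨ *-congˡ (sub-cong (δ j) (insertAt-δ j)) ⟩
        det (minor j) * g (δ j ∷ δ ∘ punchIn j)
          ≈⟨ *-congˡ (alternating-rotate n g-cong alt δ j) ⟩
        det (minor j) * ((- 1#) ^ toℕ j * g δ) ∎

  -- Two columns are deleted in succession, `j` first and then the `k`-th of those left. For column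
  -- zero and column `suc k` the two orders have indices `(zero , k)` and `(suc k , zero)`; dropping
  -- column zero leaves an array of the same shape.
  PairsCancel : ∀ n → (Fin (suc n) → Fin n → Carrier) → Set ℓ
  PairsCancel zero    s = ⊤
  PairsCancel (suc n) s = (∀ k → s zero k + s (suc k) zero ≈ 0#) × PairsCancel n (λ j k → s (suc j) (suc k))

  ∑-pairs-cancel : ∀ n s → PairsCancel n s → sum (λ j → sum (s j)) ≈ 0#
  ∑-pairs-cancel zero    s _ = +-identityʳ _
  ∑-pairs-cancel (suc n) s (cancel , rest) = begin
    sum (s zero) + sum (λ j → s (suc j) zero + sum (λ k → s (suc j) (suc k)))
      ≈⟨ +-congˡ (∑-distrib-+ (λ j → s (suc j) zero) (λ j → sum λ k → s (suc j) (suc k))) ⟩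
    sum (s zero) + (sum (λ j → s (suc j) zero) + sum (λ j → sum λ k → s (suc j) (suc k)))
      ≈⟨ +-assoc _ _ _ ⟨
    (sum (s zero) + sum (λ j → s (suc j) zero)) + sum (λ j → sum λ k → s (suc j) (suc k))
      ≈⟨ +-cong (trans (sym (∑-distrib-+ (s zero) (λ j → s (suc j) zero))) (∑-zero cancel))
                (∑-pairs-cancel n (λ j k → s (suc j) (suc k)) rest) ⟩
    0# + 0#
      ≈⟨ +-identityˡ _ ⟩
    0# ∎

  PairsCancel-resp : ∀ n {s t : Fin (suc n) → Fin n → Carrier} → (∀ j k → s j k ≈ t j k) →
                     PairsCancel n s → PairsCancel n t
  PairsCancel-resp zero    s≈t _ = tt
  PairsCancel-resp (suc n) s≈t (cancel , rest) =
      (λ k → trans (+-cong (sym (s≈t zero k)) (sym (s≈t (suc k) zero))) (cancel k))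
    , PairsCancel-resp n (λ j k → s≈t (suc j) (suc k)) rest

  -- Deleting columns j and punchIn j k leaves the same columns in either order, with opposite signs.
  laplace-pairs-cancel : ∀ n (v : Row (suc (suc n))) (d : (Fin n → Fin (suc (suc n))) → Carrier) →
    (∀ {f f′} → (∀ l → f l ≡ f′ l) → d f ≈ d f′) →
    PairsCancel (suc n) λ j k →
      (- 1#) ^ toℕ j * (v j * ((- 1#) ^ toℕ k * (v (punchIn j k) * d (punchIn j ∘ punchIn k))))
  laplace-pairs-cancel n v d d-cong = cancel , rest n v d d-cong
    where
    cancel : ∀ k →
      1# * (v zero * ((- 1#) ^ toℕ k * (v (suc k) * d (suc ∘ punchIn k)))) +
      (- 1# * (- 1#) ^ toℕ k) * (v (suc k) * (1# * (v zero * d (punchIn (suc k) ∘ suc)))) ≈ 0#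
    cancel k = begin
      1# * (a * (s * (b * x))) + (- 1# * s) * (b * (1# * (a * x)))
        ≈⟨ +-cong (*-identityˡ _) (*-cong (-1*x≈-x s) (*-congˡ (*-identityˡ _))) ⟩
      a * (s * (b * x)) + - s * (b * (a * x))
        ≈⟨ +-cong (x∙yz≈y∙xz _ _ _) (trans (*-congˡ (x∙yz≈y∙xz _ _ _)) (sym (-‿distribˡ-* _ _))) ⟩
      s * (a * (b * x)) + - (s * (a * (b * x)))
        ≈⟨ -‿inverseʳ _ ⟩
      0# ∎
      where
      a = v zero
      b = v (suc k)
      s = (- 1#) ^ toℕ k
      x = d (suc ∘ punchIn k)

    rest : ∀ n (v : Row (suc (suc n))) (d : (Fin n → Fin (suc (suc n))) → Carrier) →
      (∀ {f f′} → (∀ l → f l ≡ f′ l) → d f ≈ d f′) →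
      PairsCancel n λ j k → (- 1#) ^ toℕ (suc j) * (v (suc j) * ((- 1#) ^ toℕ (suc k) *
        (v (suc (punchIn j k)) * d (punchIn (suc j) ∘ punchIn (suc k)))))
    rest zero    v d d-cong = tt
    rest (suc n) v d d-cong = PairsCancel-resp (suc n)
      (λ j k → trans (signs ((- 1#) ^ toℕ j) (v (suc j)) ((- 1#) ^ toℕ k) (v (suc (punchIn j k))) _)
        (*-congˡ (*-congˡ (*-congˡ (*-congˡ (d-cong {lift (punchIn j ∘ punchIn k)} {punchIn (suc j) ∘ punchIn (suc k)}
          λ { zero → ≡.refl ; (suc l) → ≡.refl }))))))
      (laplace-pairs-cancel n (tail v) (d ∘ lift)
        λ f≡f′ → d-cong λ { zero → ≡.refl ; (suc l) → ≡.cong suc (f≡f′ l) })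
      where
      lift : (Fin n → Fin (suc (suc n))) → Fin (suc n) → Fin (suc (suc (suc n)))
      lift f zero    = zero
      lift f (suc l) = suc (f l)

      signs : ∀ a x b y z → a * (x * (b * (y * z))) ≈ (- 1# * a) * (x * ((- 1# * b) * (y * z)))
      signs a x b y z = sym (begin
        (- 1# * a) * (x * ((- 1# * b) * (y * z)))
          ≈⟨ *-cong (-1*x≈-x a) (*-congˡ (trans (*-congʳ (-1*x≈-x b)) (sym (-‿distribˡ-* _ _)))) ⟩
        - a * (x * - (b * (y * z)))       ≈⟨ *-congˡ (-‿distribʳ-* _ _) ⟨
        - a * - (x * (b * (y * z)))       ≈⟨ -‿distribʳ-* _ _ ⟨
        - (- a * (x * (b * (y * z))))     ≈⟨ -‿cong (-‿distribˡ-* _ _) ⟨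
        - - (a * (x * (b * (y * z))))     ≈⟨ -‿involutive _ ⟩
        a * (x * (b * (y * z)))           ∎)

  opaque
    unfolding det

    -- Expanding along both equal rows gives a sum over ordered pairs of columns, in which the two
    -- orders of a pair cancel.
    det-adjacent : ∀ n → AdjacentlyAlternating n (det {suc n})
    det-adjacent zero = tt
    det-adjacent (suc n) v X = begin
      sum (λ j → sgn j * (v j * sum (λ k → t j k)))
        ≈⟨ sum-cong-≋ (λ j → trans (*-congˡ (*-distribˡ-sum (v j) (t j)))
                                   (*-distribˡ-sum (sgn j) (λ k → v j * t j k))) ⟩
      sum (λ j → sum (λ k → sgn j * (v j * t j k)))
        ≈⟨ ∑-pairs-cancel (suc n) (λ j k → sgn j * (v j * t j k)) (laplace-pairs-cancel n v (λ f → det λ i l → X i (f l))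
             λ f≡f′ → det-cong λ i l → reflexive (≡.cong (X i) (f≡f′ l))) ⟩
      0# ∎
      where
      sgn : ∀ {n} → Fin n → Carrier
      sgn j = (- 1#) ^ toℕ j
      t : Fin (suc (suc n)) → Fin (suc n) → Carrier
      t j k = sgn k * (v (punchIn j k) * det λ i l → X i (punchIn j (punchIn k l)))

    det-alternating : ∀ n → Alternating n (det {n})
    det-alternating zero    = tt
    det-alternating (suc n) =
        (λ X → record
          { cong = λ u≋v → sum-cong-≋ λ j → *-congˡ {x = sgn j} (*-congʳ {x = minor X j} (u≋v j))
          ; add  = λ u v → trans
              (sum-cong-≋ λ j → trans (*-congˡ {x = sgn j} (distribʳ (minor X j) (u j) (v j))) (distribˡ _ _ _))
              (∑-distrib-+ (λ j → sgn j * (u j * minor X j)) (λ j → sgn j * (v j * minor X j)))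
          ; scal = λ r v → trans
              (sum-cong-≋ λ j → trans (*-congˡ {x = sgn j} (*-assoc r (v j) (minor X j))) (x∙yz≈y∙xz _ _ _))
              (sym (*-distribˡ-sum r (λ j → sgn j * (v j * minor X j))))
          })
      , det-adjacent n
      , λ v → Alternating-resp n (λ X → sum-cong-≋ λ j → *-assoc (sgn j) (v j) (minor X j))
          (Alternating-combination n (λ j → sgn j * v j) λ j →
            Alternating-∘ n det-cong (record
              { cong = λ u≋v l → u≋v (punchIn j l) ; add = λ _ _ _ → refl ; scal = λ _ _ _ → refl })
            (det-alternating n))
      where
      sgn : Fin (suc n) → Carrier
      sgn j = (- 1#) ^ toℕ j
      minor : Matrix n (suc n) → Fin (suc n) → Carrier
      minor X j = det λ i l → X i (punchIn j l)

  -- The left side is an alternating form in the rows of `M`, so `alternating-unique` reduces it to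
  -- its value at `δ`, which is `det N`.
  det-* : (M N : Matrix n n) → det (M ⊗ N) ≈ det M * det N
  det-* {n} M N = trans
    (alternating-unique n (λ X≈Y → det-cong λ i j → sum-cong-≋ λ l → *-congʳ (X≈Y i l))
      (Alternating-∘ n det-cong (record
        { cong = λ u≋v j → sum-cong-≋ {n} λ l → *-congʳ (u≋v l)
        ; add  = λ u v j → trans (sum-cong-≋ {n} λ l → distribʳ (N l j) (u l) (v l))
                             (∑-distrib-+ (λ l → u l * N l j) (λ l → v l * N l j))
        ; scal = λ r v j → trans (sum-cong-≋ {n} λ l → *-assoc r (v l) (N l j)) (sym (*-distribˡ-sum r (λ l → v l * N l j)))
        }) (det-alternating n)) M)
    (*-congˡ (det-cong λ i j → ∑-δˡ (λ l → N l j) i))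

  ∑-++ : ∀ m (f : Row (m ℕ.+ n)) → sum f ≈ sum (λ i → f (i ↑ˡ n)) + sum (λ j → f (m ↑ʳ j))
  ∑-++ zero    f = sym (+-identityˡ _)
  ∑-++ (suc m) f = trans (+-congˡ (∑-++ m (f ∘ suc))) (sym (+-assoc _ _ _))

  ∑-combine : ∀ m (f : Row (m ℕ.* n)) → sum f ≈ sum λ i → sum λ j → f (combine {m} i j)
  ∑-combine         zero    f = refl
  ∑-combine {n = n} (suc m) f = trans (∑-++ n f) (+-congˡ (∑-combine m (λ j → f (n ↑ʳ j))))

  -- The enumeration `g` is arbitrary; passing from it to the one by pairs is a permutation of the
  -- summands.
  ∑-enumerate : ∀ {a} {A : Set a} (g : Fin k ↔ A) (e : Fin m → Fin n → A) (row : A → Fin m) (col : A → Fin n) →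
    (∀ h → e (row h) (col h) ≡ h) → (∀ i j → row (e i j) ≡ i) → (∀ i j → col (e i j) ≡ j) →
    ∀ (f : A → Carrier) → sum (f ∘ Inverse.to g) ≈ sum λ i → sum λ j → f (e i j)
  ∑-enumerate {k} {m} {n} g e row col e-η row-e col-e f = begin
    sum (f ∘ g.to)                                      ≈⟨ sum-permute (f ∘ g.to) π ⟩
    sum (λ i → f (g.to (g.from (enumerate i))))         ≈⟨ sum-cong-≋ {m ℕ.* n} (λ i →
                                                             reflexive (≡.cong f (g.strictlyInverseˡ (enumerate i)))) ⟩
    sum (f ∘ enumerate)                                 ≈⟨ ∑-combine {n = n} m (f ∘ enumerate) ⟩
    sum (λ i → sum λ j → f (enumerate (combine {m} {n} i j))) ≈⟨ sum-cong-≋ {m} (λ i → sum-cong-≋ {n} λ j → reflexive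
                                                             (≡.cong (λ (i , j) → f (e i j)) (remQuot-combine i j))) ⟩
    sum (λ i → sum λ j → f (e i j))                     ∎
    where
    module g = Inverse g

    enumerate : Fin (m ℕ.* n) → _
    enumerate x = e (proj₁ (remQuot {m} n x)) (proj₂ (remQuot {m} n x))

    position : _ → Fin (m ℕ.* n)
    position h = combine (row h) (col h)

    π : Permutation (m ℕ.* n) k
    π = permutation (g.from ∘ enumerate) (position ∘ g.to)
      (λ i → ≡.trans (≡.cong g.from (≡.trans
        (≡.cong (λ (i , j) → e i j) (remQuot-combine (row (g.to i)) (col (g.to i)))) (e-η (g.to i))))
        (g.strictlyInverseʳ i))
      (λ x → ≡.trans (≡.cong position (g.strictlyInverseˡ (enumerate x)))
        (≡.trans (≡.cong₂ combine (row-e _ _) (col-e _ _)) (combine-remQuot {m} n x)))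

  -- Block matrices and diagonalisation up to a scalar

  punchIn-↑ˡ-↑ˡ : ∀ (j : Fin (suc m)) (k : Fin m) → punchIn (j ↑ˡ n) (k ↑ˡ n) ≡ punchIn j k ↑ˡ n
  punchIn-↑ˡ-↑ˡ zero    k       = ≡.refl
  punchIn-↑ˡ-↑ˡ (suc j) zero    = ≡.refl
  punchIn-↑ˡ-↑ˡ (suc j) (suc k) = ≡.cong suc (punchIn-↑ˡ-↑ˡ j k)

  punchIn-↑ˡ-↑ʳ : ∀ (j : Fin (suc m)) (k : Fin n) → punchIn (j ↑ˡ n) (m ↑ʳ k) ≡ suc m ↑ʳ k
  punchIn-↑ˡ-↑ʳ         zero    k = ≡.refl
  punchIn-↑ˡ-↑ʳ {suc m} (suc j) k = ≡.cong suc (punchIn-↑ˡ-↑ʳ j k)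

  opaque
    unfolding det

    -- In the expansion along the first row only the first block of columns contributes, and
    -- deleting one of these columns preserves the block shape.
    det-block : ∀ m (M : Matrix (m ℕ.+ n) (m ℕ.+ n)) → (∀ i j → M (i ↑ˡ n) (m ↑ʳ j) ≈ 0#) →
                det M ≈ det (λ i j → M (i ↑ˡ n) (j ↑ˡ n)) * det (λ i j → M (m ↑ʳ i) (m ↑ʳ j))
    det-block zero    M M≈0 = sym (*-identityˡ _)
    det-block {n} (suc m) M M≈0 = begin
      det M
        ≈⟨ ∑-++ (suc m) term ⟩
      sum (λ j → term (j ↑ˡ n)) + sum (λ j → term (suc m ↑ʳ j))
        ≈⟨ +-cong (sum-cong-≋ {suc m} left)
                  (∑-zero {n} λ j → trans (*-congˡ (trans (*-congʳ (M≈0 zero j)) (zeroˡ _))) (zeroʳ _)) ⟩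
      sum (λ j → (- 1#) ^ toℕ j * (M zero (j ↑ˡ n) * minor j) * corner) + 0#
        ≈⟨ +-identityʳ _ ⟩
      sum (λ j → (- 1#) ^ toℕ j * (M zero (j ↑ˡ n) * minor j) * corner)
        ≈⟨ *-distribʳ-sum corner (λ j → (- 1#) ^ toℕ j * (M zero (j ↑ˡ n) * minor j)) ⟨
      det (λ i j → M (i ↑ˡ n) (j ↑ˡ n)) * corner ∎
      where
      term : Row (suc m ℕ.+ n)
      term j = (- 1#) ^ toℕ j * (M zero j * det λ i k → M (suc i) (punchIn j k))

      minor : Row (suc m)
      minor j = det λ i k → M (suc i ↑ˡ n) (punchIn j k ↑ˡ n)

      corner : Carrier
      corner = det λ i j → M (suc m ↑ʳ i) (suc m ↑ʳ j)

      left : ∀ j → term (j ↑ˡ n) ≈ (- 1#) ^ toℕ j * (M zero (j ↑ˡ n) * minor j) * corner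
      left j = begin
        (- 1#) ^ toℕ (j ↑ˡ n) * (M zero (j ↑ˡ n) * det (λ i k → M (suc i) (punchIn (j ↑ˡ n) k)))
          ≈⟨ *-cong (reflexive (≡.cong ((- 1#) ^_) (toℕ-↑ˡ j n))) (*-congˡ (trans
               (det-block m (λ i k → M (suc i) (punchIn (j ↑ˡ n) k)) λ i k →
                 trans (reflexive (≡.cong (M (suc i ↑ˡ n)) (punchIn-↑ˡ-↑ʳ j k))) (M≈0 (suc i) k))
               (*-cong (det-cong λ i k → reflexive (≡.cong (M (suc i ↑ˡ n)) (punchIn-↑ˡ-↑ˡ j k)))
                       (det-cong λ i k → reflexive (≡.cong (M (suc m ↑ʳ i)) (punchIn-↑ˡ-↑ʳ j k)))))) ⟩
        (- 1#) ^ toℕ j * (M zero (j ↑ˡ n) * (minor j * corner))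
          ≈⟨ *-congˡ (*-assoc _ _ _) ⟨
        (- 1#) ^ toℕ j * (M zero (j ↑ˡ n) * minor j * corner)
          ≈⟨ *-assoc _ _ _ ⟨
        (- 1#) ^ toℕ j * (M zero (j ↑ˡ n) * minor j) * corner ∎

    det-1×1 : (M : Matrix 1 1) → det M ≈ M zero zero
    det-1×1 M = trans (+-identityʳ _) (trans (*-identityˡ _) (*-identityʳ _))

    det-scalar : ∀ n x → det {n} (λ i j → x * δ i j) ≈ x ^ n
    det-scalar zero    x = refl
    det-scalar (suc n) x = trans (det-block {n} 1 (λ i j → x * δ i j) λ { zero j → zeroʳ x })
      (*-cong (trans (det-1×1 λ i j → x * δ (i ↑ˡ n) (j ↑ˡ n)) (*-identityʳ x)) (det-scalar n x))

    det-δ : ∀ n → det (δ {n}) ≈ 1#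
    det-δ zero    = refl
    det-δ (suc n) = trans (det-block {n} 1 δ λ { zero j → refl })
      (trans (*-cong (det-1×1 λ i j → δ (i ↑ˡ n) (j ↑ˡ n)) (det-δ n)) (*-identityˡ 1#))

    det-block-diagonal : ∀ m {n} (T : Fin m → Matrix n n) (M : Matrix (m ℕ.* n) (m ℕ.* n)) →
      (∀ t k t′ l → M (combine t k) (combine t′ l) ≈ δ t t′ * T t k l) →
      det M ≈ foldr _*_ 1# (λ t → det (T t))
    det-block-diagonal zero    T M eq = refl
    det-block-diagonal (suc m) {n} T M eq = trans
      (det-block n M λ i j →
        trans (reflexive (≡.cong (λ x → M (i ↑ˡ (m ℕ.* n)) (n ↑ʳ x)) (≡.sym (combine-remQuot {m} n j))))
          (trans (eq zero i (suc (proj₁ (remQuot {m} n j))) (proj₂ (remQuot {m} n j))) (zeroˡ _)))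
      (*-cong (det-cong λ i j → trans (eq zero i zero j) (*-identityˡ _))
              (det-block-diagonal m (T ∘ suc) (λ i j → M (n ↑ʳ i) (n ↑ʳ j)) λ t k t′ l → eq (suc t) k (suc t′) l))

  δ-refl : (i : Fin n) → δ i i ≈ 1#
  δ-refl zero    = refl
  δ-refl (suc i) = δ-refl i

  δ-≢ : {i j : Fin n} → i ≢ j → δ i j ≈ 0#
  δ-≢ {i = zero}  {zero}  i≢j = contradiction ≡.refl i≢j
  δ-≢ {i = zero}  {suc j} i≢j = refl
  δ-≢ {i = suc i} {zero}  i≢j = refl
  δ-≢ {i = suc i} {suc j} i≢j = δ-≢ (i≢j ∘ ≡.cong suc)

  ∑-remQuot : ∀ m {n} (f : Fin m → Fin n → Carrier) →
    sum (λ x → f (proj₁ (remQuot {m} n x)) (proj₂ (remQuot {m} n x))) ≈ sum λ i → sum λ j → f i j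
  ∑-remQuot m {n} f = trans
    (∑-combine {n = n} m (λ x → f (proj₁ (remQuot {m} n x)) (proj₂ (remQuot {m} n x))))
    (sum-cong-≋ {m} λ i → sum-cong-≋ {n} λ j → reflexive (≡.cong (λ (i , j) → f i j) (remQuot-combine i j)))

  ∑∑-δ : (F : Fin m → Fin n → Carrier) (k : Fin m) → sum (λ l → sum λ j → δ k l * F l j) ≈ sum (F k)
  ∑∑-δ {m} F k = trans (sum-cong-≋ {m} λ l → sym (*-distribˡ-sum (δ k l) (F l))) (∑-δˡ (sum ∘ F) k)

  δ-remQuot : ∀ m {n} (x y : Fin (m ℕ.* n)) →
    δ (proj₁ (remQuot {m} n x)) (proj₁ (remQuot {m} n y)) * δ (proj₂ (remQuot {m} n x)) (proj₂ (remQuot {m} n y))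
    ≈ δ x y
  δ-remQuot m {n} x y with x ≟ y
  ... | yes ≡.refl = trans (*-cong (δ-refl (proj₁ (remQuot {m} n x))) (δ-refl (proj₂ (remQuot {m} n x))))
                       (trans (*-identityˡ 1#) (sym (δ-refl x)))
  ... | no  x≢y with proj₁ (remQuot {m} n x) ≟ proj₁ (remQuot {m} n y)
  ...   | no  p≢q = trans (*-congʳ (δ-≢ p≢q)) (trans (zeroˡ _) (sym (δ-≢ x≢y)))
  ...   | yes p≡q = trans (*-congˡ (δ-≢ λ r≡s → x≢y (≡.trans (≡.sym (combine-remQuot {m} n x))
                      (≡.trans (≡.cong₂ combine p≡q r≡s) (combine-remQuot {m} n y)))))
                      (trans (zeroʳ _) (sym (δ-≢ x≢y)))

  product-constant : ∀ n (f : Row n) x → (∀ i → f i ≈ x) → foldr _*_ 1# f ≈ x ^ n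
  product-constant zero    f x eq = refl
  product-constant (suc n) f x eq = *-cong (eq zero) (product-constant n (f ∘ suc) x (eq ∘ suc))

  -- `U` may fail to be invertible: `V` shows that `det U` divides `x ^ n`, so the usual
  -- cancellation of `det U` holds after multiplication by `x ^ n`.
  intertwine : (U V M M′ : Matrix n n) (x : Carrier) →
    (∀ i j → (U ⊗ V) i j ≈ x * δ i j) → (U ⊗ M) ≈ᴹ (M′ ⊗ U) → x ^ n * det M ≈ x ^ n * det M′
  intertwine {n} U V M M′ x UV≈x UM≈M′U = begin
    x ^ n * det M               ≈⟨ *-congʳ det-UV ⟩
    det U * det V * det M       ≈⟨ swap-factors (det U) (det V) (det M) ⟩
    det U * det M * det V       ≈⟨ *-congʳ (trans (sym (det-* U M)) (trans (det-cong UM≈M′U) (det-* M′ U))) ⟩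
    det M′ * det U * det V      ≈⟨ *-assoc _ _ _ ⟩
    det M′ * (det U * det V)    ≈⟨ *-comm _ _ ⟩
    det U * det V * det M′      ≈⟨ *-congʳ det-UV ⟨
    x ^ n * det M′              ∎
    where
    det-UV : x ^ n ≈ det U * det V
    det-UV = trans (sym (det-scalar n x)) (trans (sym (det-cong UV≈x)) (det-* U V))

    swap-factors : ∀ a b c → a * b * c ≈ a * c * b
    swap-factors a b c = trans (*-assoc a b c) (trans (*-congˡ (*-comm b c)) (sym (*-assoc a c b)))

  -- A row of `U` belongs to a pair, a character and a basis element. The last hypothesis removes
  -- the power of `x` left by `intertwine`; in the application `x` is 9, which is not a unit of
  -- ℤ[ω].
  det-block-diagonalise : ∀ m n (U : Fin m → Fin n → Fin (m ℕ.* n) → Carrier)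
    (V : Fin (m ℕ.* n) → Fin m → Fin n → Carrier)
    (M : Matrix (m ℕ.* n) (m ℕ.* n)) (T : Fin m → Matrix n n) (x : Carrier) →
    (∀ t k t′ k′ → sum (λ i → U t k i * V i t′ k′) ≈ x * (δ t t′ * δ k k′)) →
    (∀ t k j → sum (λ i → U t k i * M i j) ≈ sum λ t′ → sum λ k′ → (δ t t′ * T t k k′) * U t′ k′ j) →
    (∀ {y z} → x ^ (m ℕ.* n) * y ≈ x ^ (m ℕ.* n) * z → y ≈ z) →
    det M ≈ foldr _*_ 1# (λ t → det (T t))
  det-block-diagonalise m n U V M T x UV UM cancel = trans
    (cancel (intertwine U′ V′ M blocks x
      (λ r r′ → trans (UV (row r) (column r) (row r′) (column r′)) (*-congˡ (δ-remQuot m r r′)))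
      (λ r j → trans (UM (row r) (column r) j)
        (sym (∑-remQuot m λ t k → (δ (row r) t * T (row r) (column r) k) * U t k j)))))
    (det-block-diagonal m T blocks λ t k t′ k′ → reflexive
      (≡.cong₂ (λ (t , k) (t′ , k′) → δ t t′ * T t k k′) (remQuot-combine t k) (remQuot-combine t′ k′)))
    where
    row : Fin (m ℕ.* n) → Fin m
    row r = proj₁ (remQuot {m} n r)

    column : Fin (m ℕ.* n) → Fin n
    column r = proj₂ (remQuot {m} n r)

    U′ V′ blocks : Matrix (m ℕ.* n) (m ℕ.* n)
    U′ r i = U (row r) (column r) i
    V′ i r = V i (row r) (column r)
    blocks r r′ = δ (row r) (row r′) * T (row r) (column r) (column r′)

  -- This is `intertwine` for the permutation matrix of `π`, with scalar one.
  det-permute : (π : Permutation′ n) (M : Matrix n n) → det (λ i j → M (π ⟨$⟩ʳ i) (π ⟨$⟩ʳ j)) ≈ det M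
  det-permute {n} π M = sym (begin
    det M            ≈⟨ *-identityˡ _ ⟨
    1# * det M       ≈⟨ *-congʳ (1^ n) ⟨
    1# ^ n * det M   ≈⟨ intertwine U V M M′ 1# UV UM ⟩
    1# ^ n * det M′  ≈⟨ *-congʳ (1^ n) ⟩
    1# * det M′      ≈⟨ *-identityˡ _ ⟩
    det M′           ∎)
    where
    M′ U V : Matrix n n
    M′ i j = M (π ⟨$⟩ʳ i) (π ⟨$⟩ʳ j)
    U i j = δ (π ⟨$⟩ʳ i) j
    V i j = δ i (π ⟨$⟩ʳ j)

    1^ : ∀ n → 1# ^ n ≈ 1#
    1^ zero    = refl
    1^ (suc n) = trans (*-identityˡ _) (1^ n)

    δ-injective : (f : Fin n → Fin n) (g : Fin n → Fin n) → (∀ i → g (f i) ≡ i) →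
                  ∀ i j → δ (f i) (f j) ≈ δ i j
    δ-injective f g gf i j with i ≟ j
    ... | yes ≡.refl = trans (δ-refl (f i)) (sym (δ-refl i))
    ... | no  i≢j    = trans (δ-≢ λ fi≡fj → i≢j (≡.trans (≡.sym (gf i)) (≡.trans (≡.cong g fi≡fj) (gf j))))
                             (sym (δ-≢ i≢j))

    UV : ∀ i j → (U ⊗ V) i j ≈ 1# * δ i j
    UV i j = trans (∑-δˡ (λ l → δ l (π ⟨$⟩ʳ j)) (π ⟨$⟩ʳ i))
      (trans (δ-injective (π ⟨$⟩ʳ_) (π ⟨$⟩ˡ_) (λ _ → inverseˡ π) i j) (sym (*-identityˡ _)))

    UM : (U ⊗ M) ≈ᴹ (M′ ⊗ U)
    UM i j = trans (∑-δˡ (λ l → M l j) (π ⟨$⟩ʳ i)) (sym (trans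
      (sym (∑-permute (λ l → M (π ⟨$⟩ʳ i) l * δ l j) π)) (∑-δʳ (M (π ⟨$⟩ʳ i)) j)))

  -- Zero columns and rank one perturbations

  opaque
    unfolding det

    -- As `det` expands along rows, this needs induction: the zero column survives in every minor
    -- except the one that deletes it, and there the coefficient is zero.
    det-zero-column : ∀ n (M : Matrix (suc n) (suc n)) → (∀ i → M i zero ≈ 0#) → det M ≈ 0#
    det-zero-column n M M≈0 = ∑-zero {suc n} (λ j → term n M M≈0 j)
      where
      term : ∀ n (M : Matrix (suc n) (suc n)) → (∀ i → M i zero ≈ 0#) → ∀ j →
             (- 1#) ^ toℕ j * (M zero j * det (λ i k → M (suc i) (punchIn j k))) ≈ 0#
      term n       M M≈0 zero    = trans (*-congˡ (trans (*-congʳ (M≈0 zero)) (zeroˡ _))) (zeroʳ _)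
      term (suc n) M M≈0 (suc j) = trans (*-congˡ (trans
        (*-congˡ (det-zero-column n (λ i k → M (suc i) (punchIn (suc j) k)) (M≈0 ∘ suc))) (zeroʳ _))) (zeroʳ _)

    det-unit-column : ∀ n (M : Matrix (suc n) (suc n)) → (∀ i → M (suc i) zero ≈ 0#) →
                      det M ≈ M zero zero * det (λ i j → M (suc i) (suc j))
    det-unit-column n M M≈0 = trans
      (+-cong (*-identityˡ _) (∑-zero {n} (term n M M≈0))) (+-identityʳ _)
      where
      term : ∀ n (M : Matrix (suc n) (suc n)) → (∀ i → M (suc i) zero ≈ 0#) → ∀ j →
             (- 1#) ^ toℕ (suc j) * (M zero (suc j) * det (λ i k → M (suc i) (punchIn (suc j) k))) ≈ 0#
      term (suc n) M M≈0 j = trans (*-congˡ (trans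
        (*-congˡ (det-zero-column n (λ i k → M (suc i) (punchIn (suc j) k)) M≈0)) (zeroʳ _))) (zeroʳ _)

  border : Row (suc n) → Row n → Matrix n n → Matrix (suc n) (suc n)
  border w v C = w ∷ λ i → - v i ∷ C i

  -- [1 w; -v C] [1 -w; 0 I] = [1 0; -v C + v w], so that det (C + v w) is linear in the row (1 w).
  det-rank-one : ∀ n (w v : Row n) (C : Matrix n n) →
                 det (λ i j → C i j + v i * w j) ≈ det (border (1# ∷ w) v C)
  det-rank-one n w v C = sym (begin
    det N                ≈⟨ *-identityʳ _ ⟨
    det N * 1#           ≈⟨ *-congˡ det-E ⟨
    det N * det E        ≈⟨ det-* N E ⟨
    det (N ⊗ E)          ≈⟨ det-block {n} 1 (N ⊗ E) (λ { zero j → top j }) ⟩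
    det (λ i j → (N ⊗ E) (i ↑ˡ n) (j ↑ˡ n)) * det (λ i j → (N ⊗ E) (suc i) (suc j))
      ≈⟨ *-cong (trans (det-1×1 λ i j → (N ⊗ E) (i ↑ˡ n) (j ↑ˡ n)) corner) (det-cong bottom) ⟩
    1# * det (λ i j → C i j + v i * w j) ≈⟨ *-identityˡ _ ⟩
    det (λ i j → C i j + v i * w j) ∎)
    where
    N E : Matrix (suc n) (suc n)
    N = border (1# ∷ w) v C
    E = (1# ∷ (-_ ∘ w)) ∷ λ i → 0# ∷ δ i

    det-E : det E ≈ 1#
    det-E = trans (det-unit-column n E λ _ → refl) (trans (*-identityˡ _) (det-δ n))

    corner : (N ⊗ E) zero zero ≈ 1#
    corner = trans (+-cong (*-identityˡ _) (∑-zero {n} λ i → zeroʳ (w i))) (+-identityʳ _)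

    top : ∀ j → (N ⊗ E) zero (suc j) ≈ 0#
    top j = trans (+-cong (*-identityˡ _) (∑-δʳ w j)) (-‿inverseˡ _)

    bottom : ∀ i j → (N ⊗ E) (suc i) (suc j) ≈ C i j + v i * w j
    bottom i j = trans (+-cong (trans (sym (-‿distribˡ-* _ _)) (trans (-‿cong (sym (-‿distribʳ-* _ _)))
      (-‿involutive _))) (∑-δʳ (C i) j)) (+-comm _ _)

  det-first-row : ∀ n (X : Matrix n (suc n)) → IsLinear (λ w → det (w ∷ X))
  det-first-row n X = proj₁ (det-alternating (suc n)) X

  δ-↑ˡ-↑ˡ : (i j : Fin m) → δ (i ↑ˡ n) (j ↑ˡ n) ≈ δ i j
  δ-↑ˡ-↑ˡ zero    zero    = refl
  δ-↑ˡ-↑ˡ zero    (suc j) = refl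
  δ-↑ˡ-↑ˡ (suc i) zero    = refl
  δ-↑ˡ-↑ˡ (suc i) (suc j) = δ-↑ˡ-↑ˡ i j

  δ-↑ˡ-↑ʳ : (i : Fin m) (j : Fin n) → δ (i ↑ˡ n) (m ↑ʳ j) ≈ 0#
  δ-↑ˡ-↑ʳ zero    j = refl
  δ-↑ˡ-↑ʳ (suc i) j = δ-↑ˡ-↑ʳ i j

  δ-↑ʳ-↑ʳ : ∀ m (i j : Fin n) → δ (m ↑ʳ i) (m ↑ʳ j) ≈ δ i j
  δ-↑ʳ-↑ʳ zero    i j = refl
  δ-↑ʳ-↑ʳ (suc m) i j = δ-↑ʳ-↑ʳ m i j

  -- [I I; 0 I] [X Y; Y X] [I -I; 0 I] = [X+Y 0; Y X-Y]
  module _ (n : ℕ) where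
    private
      quadrant : Carrier → Fin n ⊎ Fin n → Fin n ⊎ Fin n → Carrier
      quadrant x (inj₁ i) (inj₁ j) = δ i j
      quadrant x (inj₁ i) (inj₂ j) = x * δ i j
      quadrant x (inj₂ i) (inj₁ j) = 0#
      quadrant x (inj₂ i) (inj₂ j) = δ i j

      shear : Carrier → Matrix (n ℕ.+ n) (n ℕ.+ n)
      shear x i j = quadrant x (splitAt n i) (splitAt n j)

      TL : ∀ x i j → shear x (i ↑ˡ n) (j ↑ˡ n) ≈ δ i j
      TL x i j = reflexive (≡.cong₂ (quadrant x) (splitAt-↑ˡ n i n) (splitAt-↑ˡ n j n))

      TR : ∀ x i j → shear x (i ↑ˡ n) (n ↑ʳ j) ≈ x * δ i j
      TR x i j = reflexive (≡.cong₂ (quadrant x) (splitAt-↑ˡ n i n) (splitAt-↑ʳ n n j))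

      BL : ∀ x i j → shear x (n ↑ʳ i) (j ↑ˡ n) ≈ 0#
      BL x i j = reflexive (≡.cong₂ (quadrant x) (splitAt-↑ʳ n n i) (splitAt-↑ˡ n j n))

      BR : ∀ x i j → shear x (n ↑ʳ i) (n ↑ʳ j) ≈ δ i j
      BR x i j = reflexive (≡.cong₂ (quadrant x) (splitAt-↑ʳ n n i) (splitAt-↑ʳ n n j))

      module _ (M : Matrix (n ℕ.+ n) (n ℕ.+ n)) where
        rows-upper : ∀ i j → (shear 1# ⊗ M) (i ↑ˡ n) j ≈ M (i ↑ˡ n) j + M (n ↑ʳ i) j
        rows-upper i j = trans (∑-++ n (λ l → shear 1# (i ↑ˡ n) l * M l j)) (+-cong
          (trans (sum-cong-≋ {n} λ l → *-congʳ (TL 1# i l)) (∑-δˡ {n} (λ l → M (l ↑ˡ n) j) i))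
          (trans (sum-cong-≋ {n} λ l → *-congʳ (trans (TR 1# i l) (*-identityˡ _))) (∑-δˡ (λ l → M (n ↑ʳ l) j) i)))

        rows-lower : ∀ i j → (shear 1# ⊗ M) (n ↑ʳ i) j ≈ M (n ↑ʳ i) j
        rows-lower i j = trans (∑-++ n (λ l → shear 1# (n ↑ʳ i) l * M l j)) (trans (+-cong
          (∑-zero {n} λ l → trans (*-congʳ (BL 1# i l)) (zeroˡ _))
          (trans (sum-cong-≋ {n} λ l → *-congʳ (BR 1# i l)) (∑-δˡ (λ l → M (n ↑ʳ l) j) i))) (+-identityˡ _))

        columns-left : ∀ i j → (M ⊗ shear (- 1#)) i (j ↑ˡ n) ≈ M i (j ↑ˡ n)
        columns-left i j = trans (∑-++ n (λ l → M i l * shear (- 1#) l (j ↑ˡ n))) (trans (+-cong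
          (trans (sum-cong-≋ {n} λ l → *-congˡ (TL (- 1#) l j)) (∑-δʳ (λ l → M i (l ↑ˡ n)) j))
          (∑-zero {n} λ l → trans (*-congˡ (BL (- 1#) l j)) (zeroʳ _))) (+-identityʳ _))

        columns-right : ∀ i j → (M ⊗ shear (- 1#)) i (n ↑ʳ j) ≈ M i (n ↑ʳ j) - M i (j ↑ˡ n)
        columns-right i j = trans (∑-++ n (λ l → M i l * shear (- 1#) l (n ↑ʳ j))) (trans (+-comm _ _) (+-cong
          (trans (sum-cong-≋ {n} λ l → *-congˡ (BR (- 1#) l j)) (∑-δʳ (λ l → M i (n ↑ʳ l)) j))
          (trans (sum-cong-≋ {n} λ l → trans (*-congˡ (trans (TR (- 1#) l j) (-1*x≈-x _))) (sym (-‿distribʳ-* _ _)))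
            (trans (sum-neg (λ l → M i (l ↑ˡ n) * δ l j)) (-‿cong (∑-δʳ (λ l → M i (l ↑ˡ n)) j))))))
          where
          sum-neg : ∀ {n} (f : Row n) → sum (λ l → - f l) ≈ - sum f
          sum-neg f = trans (sum-cong-≋ λ l → sym (-1*x≈-x (f l)))
            (trans (sym (*-distribˡ-sum (- 1#) f)) (-1*x≈-x _))

      scaled : (X Y : Matrix n n) (M : Matrix (n ℕ.+ n) (n ℕ.+ n)) →
        (∀ i j → M (i ↑ˡ n) (j ↑ˡ n) ≈ X i j) → (∀ i j → M (i ↑ˡ n) (n ↑ʳ j) ≈ Y i j) →
        (∀ i j → M (n ↑ʳ i) (j ↑ˡ n) ≈ Y i j) → (∀ i j → M (n ↑ʳ i) (n ↑ʳ j) ≈ X i j) →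
        det (shear 1#) * det M * det (shear (- 1#)) ≈ det (λ i j → X i j + Y i j) * det (λ i j → X i j - Y i j)
      scaled X Y M tl tr bl br = begin
        det (shear 1#) * det M * det (shear (- 1#))
          ≈⟨ *-congʳ (det-* (shear 1#) M) ⟨
        det EM * det (shear (- 1#))
          ≈⟨ det-* EM (shear (- 1#)) ⟨
        det (EM ⊗ shear (- 1#))
          ≈⟨ det-block n (EM ⊗ shear (- 1#)) (λ i j → trans (columns-right EM (i ↑ˡ n) j)
               (trans (+-cong (rows-upper M i (n ↑ʳ j)) (-‿cong (rows-upper M i (j ↑ˡ n))))
               (trans (+-cong (+-cong (tr i j) (br i j)) (-‿cong (+-cong (tl i j) (bl i j))))
               (trans (+-congʳ (+-comm _ _)) (-‿inverseʳ _))))) ⟩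
        det (λ i j → (EM ⊗ shear (- 1#)) (i ↑ˡ n) (j ↑ˡ n)) * det (λ i j → (EM ⊗ shear (- 1#)) (n ↑ʳ i) (n ↑ʳ j))
          ≈⟨ *-cong
               (det-cong λ i j → trans (columns-left EM (i ↑ˡ n) j)
                 (trans (rows-upper M i (j ↑ˡ n)) (+-cong (tl i j) (bl i j))))
               (det-cong λ i j → trans (columns-right EM (n ↑ʳ i) j)
                 (+-cong (trans (rows-lower M i (n ↑ʳ j)) (br i j))
                         (-‿cong (trans (rows-lower M i (j ↑ˡ n)) (bl i j))))) ⟩
        det (λ i j → X i j + Y i j) * det (λ i j → X i j - Y i j) ∎
        where EM = shear 1# ⊗ M

      -- The case M = I.
      det-shears : det (shear 1#) * det (shear (- 1#)) ≈ 1#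
      det-shears = begin
        det (shear 1#) * det (shear (- 1#))
          ≈⟨ *-congʳ (trans (*-congˡ (det-δ (n ℕ.+ n))) (*-identityʳ _)) ⟨
        det (shear 1#) * det (δ {n ℕ.+ n}) * det (shear (- 1#))
          ≈⟨ scaled δ (λ _ _ → 0#) δ (δ-↑ˡ-↑ˡ {n} {n}) (δ-↑ˡ-↑ʳ {n} {n})
               (λ i j → trans (δ-sym (n ↑ʳ i) (j ↑ˡ n)) (δ-↑ˡ-↑ʳ j i)) (δ-↑ʳ-↑ʳ n) ⟩
        det (λ i j → δ {n} i j + 0#) * det (λ i j → δ {n} i j - 0#)
          ≈⟨ *-cong (trans (det-cong {n} λ i j → +-identityʳ (δ i j)) (det-δ n))
               (trans (det-cong {n} λ i j → trans (+-congˡ -0#≈0#) (+-identityʳ (δ i j))) (det-δ n)) ⟩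
        1# * 1#
          ≈⟨ *-identityˡ 1# ⟩
        1# ∎

    det-two-blocks : (X Y : Matrix n n) (M : Matrix (n ℕ.+ n) (n ℕ.+ n)) →
      (∀ i j → M (i ↑ˡ n) (j ↑ˡ n) ≈ X i j) → (∀ i j → M (i ↑ˡ n) (n ↑ʳ j) ≈ Y i j) →
      (∀ i j → M (n ↑ʳ i) (j ↑ˡ n) ≈ Y i j) → (∀ i j → M (n ↑ʳ i) (n ↑ʳ j) ≈ X i j) →
      det M ≈ det (λ i j → X i j + Y i j) * det (λ i j → X i j - Y i j)
    det-two-blocks X Y M tl tr bl br = begin
      det M                                         ≈⟨ *-identityˡ _ ⟨
      1# * det M                                    ≈⟨ *-congʳ det-shears ⟨
      det (shear 1#) * det (shear (- 1#)) * det M   ≈⟨ *-assoc _ _ _ ⟩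
      det (shear 1#) * (det (shear (- 1#)) * det M) ≈⟨ *-congˡ (*-comm _ _) ⟩
      det (shear 1#) * (det M * det (shear (- 1#))) ≈⟨ *-assoc _ _ _ ⟨
      det (shear 1#) * det M * det (shear (- 1#))   ≈⟨ scaled X Y M tl tr bl br ⟩
      det (λ i j → X i j + Y i j) * det (λ i j → X i j - Y i j) ∎

-- Determinants under ring homomorphisms

module _ {c₁ ℓ₁ c₂ ℓ₂} (R : CommutativeRing c₁ ℓ₁) (S : CommutativeRing c₂ ℓ₂)
         (⟦_⟧ : CommutativeRing.Carrier R → CommutativeRing.Carrier S)
         (hom : IsRingHomomorphism (CommutativeRing.rawRing R) (CommutativeRing.rawRing S) ⟦_⟧) where
  private
    module R = CommutativeRing R
    module S = CommutativeRing S
    module ∑R = Sum R.semiring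
    module ∑S = Sum S.semiring
    module ^R = Exp R.semiring
    module ^S = Exp S.semiring
  open IsRingHomomorphism hom
  open DeterminantTheory R using () renaming (det to detᴿ)
  open DeterminantTheory S using () renaming (det to detˢ)

  sum-homo : ∀ {n} (f : Fin n → R.Carrier) → ⟦ ∑R.sum f ⟧ S.≈ ∑S.sum (⟦_⟧ ∘ f)
  sum-homo {zero}  f = 0#-homo
  sum-homo {suc n} f = S.trans (+-homo _ _) (S.+-congˡ (sum-homo (f ∘ suc)))

  ^-homo : ∀ x n → ⟦ x ^R.^ n ⟧ S.≈ ⟦ x ⟧ ^S.^ n
  ^-homo x zero    = 1#-homo
  ^-homo x (suc n) = S.trans (*-homo _ _) (S.*-congˡ (^-homo x n))

  opaque
    unfolding detᴿ detˢ

    det-homo : ∀ {n} (M : Fin n → Fin n → R.Carrier) (N : Fin n → Fin n → S.Carrier) →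
               (∀ i j → ⟦ M i j ⟧ S.≈ N i j) → ⟦ detᴿ M ⟧ S.≈ detˢ N
    det-homo {zero}  M N M≈N = 1#-homo
    det-homo {suc n} M N M≈N = S.trans (sum-homo term) (∑S.sum-cong-≋ {suc n} λ j →
      S.trans (*-homo ((R.- R.1#) ^R.^ toℕ j) _) (S.*-cong
        (S.trans (^-homo (R.- R.1#) (toℕ j)) (^S.^-congˡ (toℕ j) (S.trans (-‿homo R.1#) (S.-‿cong 1#-homo))))
        (S.trans (*-homo (M zero j) _) (S.*-cong (M≈N zero j)
          (det-homo (λ i k → M (suc i) (punchIn j k)) (λ i k → N (suc i) (punchIn j k))
            λ i k → M≈N (suc i) (punchIn j k))))))
      where
      term : Fin (suc n) → R.Carrier
      term j = (R.- R.1#) ^R.^ toℕ j R.* (M zero j R.* detᴿ λ i k → M (suc i) (punchIn j k))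

open import Data.Bool.Base using (Bool; true; false; _xor_; _∧_)
open import Data.Empty using (⊥-elim-irr)
open import Data.Fin.Patterns using (0F; 1F; 2F; 3F; 4F; 5F; 6F; 7F; 8F)
open import Data.Integer.Base using (ℤ; +_; -[1+_]; _+_; _*_; _-_; -_; _^_; 0ℤ; 1ℤ)
open import Data.Integer.Divisibility using (_∣_)
open import Data.Integer.Divisibility.Signed using (divides; ∣ᵤ⇒∣; ∣⇒∣ᵤ; ∣-refl; ∣-trans; _∣?_;
  ∣m∣n⇒∣m+n; ∣m∣n⇒∣m-n; ∣m⇒∣m*n; ∣n⇒∣m*n; *-monoʳ-∣; *-monoˡ-∣) renaming (_∣_ to _∣ₛ_)
open import Data.Integer.DivMod using (_/_; _%_; a≡a%n+[a/n]*n; n%d<d)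
import Data.Integer.Properties as ℤ
open import Data.Integer.Tactic.RingSolver using (solve-∀)
open import Data.Vec.Base as Vec using (Vec; []; _∷_; lookup; tabulate)
open import Data.Vec.Properties using (lookup∘tabulate; lookup-map)
open import Relation.Nullary.Decidable using (from-yes; map′; _×-dec_; _⊎-dec_; ¬?; toWitnessFalse)
open import Relation.Unary using (Decidable)
open ≡ using (refl; sym; trans; cong; cong₂; subst; isEquivalence; module ≡-Reasoning)

-- Characters of 𝔽₉

-- ℤ[ω] with ω² = - 1 - ω, ⟪ x , y ⟫ standing for x + y ω.
record ℤ[ω] : Set where
  no-eta-equality
  pattern
  constructor ⟪_,_⟫
  field
    re im : ℤ

open ℤ[ω] using (re; im)

infixl 6 _+ᵉ_
infixl 7 _*ᵉ_

_+ᵉ_ _*ᵉ_ : ℤ[ω] → ℤ[ω] → ℤ[ω]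
⟪ a , b ⟫ +ᵉ ⟪ c , d ⟫ = ⟪ a + c , b + d ⟫
⟪ a , b ⟫ *ᵉ ⟪ c , d ⟫ = ⟪ a * c - b * d , a * d + b * c - b * d ⟫

-ᵉ_ : ℤ[ω] → ℤ[ω]
-ᵉ ⟪ a , b ⟫ = ⟪ - a , - b ⟫

ι : ℤ → ℤ[ω]
ι a = ⟪ a , 0ℤ ⟫

*ᵉ-comm : ∀ x y → x *ᵉ y ≡ y *ᵉ x
*ᵉ-comm ⟪ a , b ⟫ ⟪ c , d ⟫ = cong₂ ⟪_,_⟫ (re′ a b c d) (im′ a b c d)
  where
  re′ : ∀ a b c d → a * c - b * d ≡ c * a - d * b
  re′ = solve-∀
  im′ : ∀ a b c d → a * d + b * c - b * d ≡ c * b + d * a - d * b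
  im′ = solve-∀

*ᵉ-assoc : ∀ x y z → (x *ᵉ y) *ᵉ z ≡ x *ᵉ (y *ᵉ z)
*ᵉ-assoc ⟪ a , b ⟫ ⟪ c , d ⟫ ⟪ e , f ⟫ = cong₂ ⟪_,_⟫ (re′ a b c d e f) (im′ a b c d e f)
  where
  re′ : ∀ a b c d e f → (a * c - b * d) * e - (a * d + b * c - b * d) * f
                     ≡ a * (c * e - d * f) - b * (c * f + d * e - d * f)
  re′ = solve-∀
  im′ : ∀ a b c d e f →
    (a * c - b * d) * f + (a * d + b * c - b * d) * e - (a * d + b * c - b * d) * f
    ≡ a * (c * f + d * e - d * f) + b * (c * e - d * f) - b * (c * f + d * e - d * f)
  im′ = solve-∀

*ᵉ-distribˡ : ∀ x y z → x *ᵉ (y +ᵉ z) ≡ x *ᵉ y +ᵉ x *ᵉ z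
*ᵉ-distribˡ ⟪ a , b ⟫ ⟪ c , d ⟫ ⟪ e , f ⟫ = cong₂ ⟪_,_⟫ (re′ a b c d e f) (im′ a b c d e f)
  where
  re′ : ∀ a b c d e f → a * (c + e) - b * (d + f) ≡ a * c - b * d + (a * e - b * f)
  re′ = solve-∀
  im′ : ∀ a b c d e f → a * (d + f) + b * (c + e) - b * (d + f)
                     ≡ a * d + b * c - b * d + (a * f + b * e - b * f)
  im′ = solve-∀

*ᵉ-identityˡ : ∀ x → ι 1ℤ *ᵉ x ≡ x
*ᵉ-identityˡ ⟪ a , b ⟫ = cong₂ ⟪_,_⟫ (re′ a b) (im′ a b)
  where
  re′ : ∀ a b → 1ℤ * a - 0ℤ * b ≡ a
  re′ = solve-∀
  im′ : ∀ a b → 1ℤ * b + 0ℤ * a - 0ℤ * b ≡ b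
  im′ = solve-∀

ℤ[ω]-commutativeRing : CommutativeRing 0ℓ 0ℓ
ℤ[ω]-commutativeRing = record
  { Carrier = ℤ[ω] ; _≈_ = _≡_ ; _+_ = _+ᵉ_ ; _*_ = _*ᵉ_ ; -_ = -ᵉ_ ; 0# = ι 0ℤ ; 1# = ι 1ℤ
  ; isCommutativeRing = record
    { isRing = record
      { +-isAbelianGroup = record
        { isGroup = record
          { isMonoid = record
            { isSemigroup = record
              { isMagma = record { isEquivalence = isEquivalence ; ∙-cong = cong₂ _+ᵉ_ }
              ; assoc = λ { ⟪ a , b ⟫ ⟪ c , d ⟫ ⟪ e , f ⟫ → cong₂ ⟪_,_⟫ (ℤ.+-assoc a c e) (ℤ.+-assoc b d f) }
              }
            ; identity = (λ { ⟪ a , b ⟫ → cong₂ ⟪_,_⟫ (ℤ.+-identityˡ a) (ℤ.+-identityˡ b) })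
                       , (λ { ⟪ a , b ⟫ → cong₂ ⟪_,_⟫ (ℤ.+-identityʳ a) (ℤ.+-identityʳ b) })
            }
          ; inverse = (λ { ⟪ a , b ⟫ → cong₂ ⟪_,_⟫ (ℤ.+-inverseˡ a) (ℤ.+-inverseˡ b) })
                    , (λ { ⟪ a , b ⟫ → cong₂ ⟪_,_⟫ (ℤ.+-inverseʳ a) (ℤ.+-inverseʳ b) })
          ; ⁻¹-cong = cong -ᵉ_
          }
        ; comm = λ { ⟪ a , b ⟫ ⟪ c , d ⟫ → cong₂ ⟪_,_⟫ (ℤ.+-comm a c) (ℤ.+-comm b d) }
        }
      ; *-cong = cong₂ _*ᵉ_
      ; *-assoc = *ᵉ-assoc
      ; *-identity = *ᵉ-identityˡ , λ x → trans (*ᵉ-comm x (ι 1ℤ)) (*ᵉ-identityˡ x)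
      ; distrib = *ᵉ-distribˡ
                , λ x y z → trans (*ᵉ-comm (y +ᵉ z) x)
                    (trans (*ᵉ-distribˡ x y z) (cong₂ _+ᵉ_ (*ᵉ-comm x y) (*ᵉ-comm x z)))
      }
    ; *-comm = *ᵉ-comm
    }
  }

module ℤᴿ = CommutativeRing ℤ.+-*-commutativeRing
module ℤ[ω]ᴿ = CommutativeRing ℤ[ω]-commutativeRing

ι-* : ∀ a b → ι (a * b) ≡ ι a *ᵉ ι b
ι-* a b = cong₂ ⟪_,_⟫ (re′ a b) (im′ a b)
  where
  re′ : ∀ a b → a * b ≡ a * b - 0ℤ * 0ℤ
  re′ = solve-∀
  im′ : ∀ a b → 0ℤ ≡ a * 0ℤ + 0ℤ * b - 0ℤ * 0ℤ
  im′ = solve-∀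

ι-scale : ∀ a x → ι a *ᵉ x ≡ ⟪ a * re x , a * im x ⟫
ι-scale a ⟪ b , c ⟫ = cong₂ ⟪_,_⟫ (re′ a b c) (im′ a b c)
  where
  re′ : ∀ a b c → a * b - 0ℤ * c ≡ a * b
  re′ = solve-∀
  im′ : ∀ a b c → a * c + 0ℤ * b - 0ℤ * c ≡ a * c
  im′ = solve-∀

ι-homomorphism : IsRingHomomorphism ℤᴿ.rawRing ℤ[ω]ᴿ.rawRing ι
ι-homomorphism = record
  { isSemiringHomomorphism = record
    { isNearSemiringHomomorphism = record
      { +-isMonoidHomomorphism = record
        { isMagmaHomomorphism = record
          { isRelHomomorphism = record { cong = cong ι }
          ; homo = λ _ _ → refl
          }
        ; ε-homo = refl
        }
      ; *-homo = ι-*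
      }
    ; 1#-homo = refl
    }
  ; -‿homo = λ _ → refl
  }

∀F₉? : ∀ {p} {P : F₉ → Set p} → Decidable P → Dec (∀ x → P x)
∀F₉? P? = map′ (λ f (x , y) → f x y) (λ f x y → f (x , y)) (all? λ x → all? λ y → P? (x , y))

-- The powers of the primitive element 1 + i.
u : Fin 8 → F₉
u 0F = 1F , 0F
u 1F = 1F , 1F
u 2F = 0F , 2F
u 3F = 1F , 2F
u 4F = 2F , 0F
u 5F = 2F , 2F
u 6F = 0F , 1F
u 7F = 2F , 1F

-- Zero comes first, so that sums and products over the nine characters split by computation into
-- the trivial character and the eight characters of the `u k`.
element : Fin 9 → F₉
element zero    = F₉.0#
element (suc k) = u k

index : F₉ → Fin 9
index (0F , 0F) = 0F
index (1F , 0F) = 1F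
index (1F , 1F) = 2F
index (0F , 2F) = 3F
index (1F , 2F) = 4F
index (2F , 0F) = 5F
index (2F , 2F) = 6F
index (0F , 1F) = 7F
index (2F , 1F) = 8F

element-index : ∀ x → element (index x) ≡ x
element-index = from-yes (∀F₉? λ x → element (index x) F₉.≟ x)

index-element : ∀ i → index (element i) ≡ i
index-element = from-yes (all? λ i → index (element i) ≟ i)

module FieldSum {c ℓ} (R : CommutativeRing c ℓ) where
  private module R = CommutativeRing R
  open DeterminantTheory R using (∑-zero; ∑-δˡ; δ)
  open Sum R.semiring

  ∑₉ : (F₉ → R.Carrier) → R.Carrier
  ∑₉ f = sum λ i → f (element i)

  ∑₉-cong : ∀ {f g} → (∀ x → f x R.≈ g x) → ∑₉ f R.≈ ∑₉ g
  ∑₉-cong f≈g = sum-cong-≋ {9} λ i → f≈g (element i)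

  ∑₉-reindex : ∀ f (τ σ : F₉ → F₉) → (∀ x → τ (σ x) ≡ x) → (∀ x → σ (τ x) ≡ x) → ∑₉ f R.≈ ∑₉ (f ∘ τ)
  ∑₉-reindex f τ σ τσ στ = R.trans (sum-permute (f ∘ element) π)
    (sum-cong-≋ {9} λ i → R.reflexive (cong f (element-index (τ (element i)))))
    where
    conj : ∀ (τ σ : F₉ → F₉) → (∀ x → τ (σ x) ≡ x) →
           ∀ i → index (τ (element (index (σ (element i))))) ≡ i
    conj τ σ τσ i = trans (cong (index ∘ τ) (element-index _)) (trans (cong index (τσ _)) (index-element i))
    π : Permutation′ 9
    π = permutation (index ∘ τ ∘ element) (index ∘ σ ∘ element) (conj τ σ τσ) (conj σ τ στ)

  ∑₉-+ : ∀ f g → ∑₉ (λ x → f x R.+ g x) R.≈ ∑₉ f R.+ ∑₉ g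
  ∑₉-+ f g = ∑-distrib-+ (f ∘ element) (g ∘ element)

  ∑₉-*ˡ : ∀ a f → a R.* ∑₉ f R.≈ ∑₉ (λ x → a R.* f x)
  ∑₉-*ˡ a f = *-distribˡ-sum a (f ∘ element)

  ∑₉-*ʳ : ∀ a f → ∑₉ f R.* a R.≈ ∑₉ (λ x → f x R.* a)
  ∑₉-*ʳ a f = *-distribʳ-sum a (f ∘ element)

  ∑₉-comm : ∀ (f : F₉ → F₉ → R.Carrier) → ∑₉ (λ x → ∑₉ (f x)) R.≈ ∑₉ (λ y → ∑₉ λ x → f x y)
  ∑₉-comm f = ∑-comm (λ i j → f (element i) (element j))

  𝟙₀ : F₉ → R.Carrier
  𝟙₀ x = δ zero (index x)

  ∑₉-𝟙₀ : ∀ f → ∑₉ (λ x → 𝟙₀ x R.* f x) R.≈ f F₉.0#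
  ∑₉-𝟙₀ f = R.trans (sum-cong-≋ {9} λ i → R.*-congʳ {f (element i)} (R.reflexive (cong (δ zero) (index-element i))))
    (∑-δˡ (f ∘ element) zero)

infixl 6 _⊖_
_⊖_ : F₉ → F₉ → F₉
x ⊖ y = x F₉.+ F₉.- y

⊖-involutive : ∀ x y → x ⊖ (x ⊖ y) ≡ y
⊖-involutive = from-yes (∀F₉? λ x → ∀F₉? λ y → (x ⊖ (x ⊖ y)) F₉.≟ y)

+-⊖ : ∀ x y → (x F₉.+ y) ⊖ y ≡ x
+-⊖ = from-yes (∀F₉? λ x → ∀F₉? λ y → ((x F₉.+ y) ⊖ y) F₉.≟ x)

⊖-+ : ∀ x y → (x ⊖ y) F₉.+ y ≡ x
⊖-+ = from-yes (∀F₉? λ x → ∀F₉? λ y → ((x ⊖ y) F₉.+ y) F₉.≟ x)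

⊖-⊖ : ∀ x y z → x ⊖ (y F₉.+ z) ≡ (x ⊖ z) ⊖ y
⊖-⊖ = from-yes (∀F₉? λ x → ∀F₉? λ y → ∀F₉? λ z → (x ⊖ (y F₉.+ z)) F₉.≟ ((x ⊖ z) ⊖ y))

⊖-0 : ∀ x → x ⊖ F₉.0# ≡ x
⊖-0 = from-yes (∀F₉? λ x → (x ⊖ F₉.0#) F₉.≟ x)

-- The group ring of the additive group of 𝔽₉

module _ where
  open FieldSum ℤ.+-*-commutativeRing

  infixl 7 _⋆_

  -- Elements of the group ring of the additive group of 𝔽₉ are functions under convolution.
  _⋆_ : (F₉ → ℤ) → (F₉ → ℤ) → F₉ → ℤ
  (f ⋆ g) x = ∑₉ λ y → f y * g (x ⊖ y)

  ⋆-cong : ∀ {f f′ g g′ : F₉ → ℤ} → (∀ x → f x ≡ f′ x) → (∀ x → g x ≡ g′ x) → ∀ x → (f ⋆ g) x ≡ (f′ ⋆ g′) x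
  ⋆-cong f≡f′ g≡g′ x = ∑₉-cong λ y → cong₂ _*_ (f≡f′ y) (g≡g′ (x ⊖ y))

  ⋆-comm : ∀ f g x → (f ⋆ g) x ≡ (g ⋆ f) x
  ⋆-comm f g x = trans
    (∑₉-reindex (λ y → f y * g (x ⊖ y)) (x ⊖_) (x ⊖_) (⊖-involutive x) (⊖-involutive x))
    (∑₉-cong λ y → trans (cong (λ z → f (x ⊖ y) * g z) (⊖-involutive x y)) (ℤ.*-comm (f (x ⊖ y)) (g y)))

  ⋆-assoc : ∀ f g h x → ((f ⋆ g) ⋆ h) x ≡ (f ⋆ (g ⋆ h)) x
  ⋆-assoc f g h x = begin
    ∑₉ (λ y → ∑₉ (λ z → f z * g (y ⊖ z)) * h (x ⊖ y))
      ≡⟨ ∑₉-cong (λ y → trans (∑₉-*ʳ (h (x ⊖ y)) (λ z → f z * g (y ⊖ z)))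
           (∑₉-cong λ z → ℤ.*-assoc (f z) (g (y ⊖ z)) (h (x ⊖ y)))) ⟩
    ∑₉ (λ y → ∑₉ λ z → f z * (g (y ⊖ z) * h (x ⊖ y)))
      ≡⟨ ∑₉-comm (λ y z → f z * (g (y ⊖ z) * h (x ⊖ y))) ⟩
    ∑₉ (λ z → ∑₉ λ y → f z * (g (y ⊖ z) * h (x ⊖ y)))
      ≡⟨ ∑₉-cong (λ z → trans (sym (∑₉-*ˡ (f z) (λ y → g (y ⊖ z) * h (x ⊖ y)))) (cong (f z *_) (inner z))) ⟩
    ∑₉ (λ z → f z * ∑₉ λ y → g y * h ((x ⊖ z) ⊖ y)) ∎
    where
    open ≡-Reasoning
    inner : ∀ z → ∑₉ (λ y → g (y ⊖ z) * h (x ⊖ y)) ≡ ∑₉ (λ y → g y * h ((x ⊖ z) ⊖ y))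
    inner z = trans
      (∑₉-reindex (λ y → g (y ⊖ z) * h (x ⊖ y)) (F₉._+ z) (_⊖ z) (λ y → ⊖-+ y z) (λ y → +-⊖ y z))
      (∑₉-cong λ y → cong₂ (λ a b → g a * h b) (+-⊖ y z) (⊖-⊖ x y z))

  ⋆-identityˡ : ∀ f x → (𝟙₀ ⋆ f) x ≡ f x
  ⋆-identityˡ f x = trans (∑₉-𝟙₀ (λ y → f (x ⊖ y))) (cong f (⊖-0 x))

  ⋆-distribˡ : ∀ f g h x → (f ⋆ (λ y → g y + h y)) x ≡ (f ⋆ g) x + (f ⋆ h) x
  ⋆-distribˡ f g h x = trans
    (∑₉-cong λ y → ℤ.*-distribˡ-+ (f y) (g (x ⊖ y)) (h (x ⊖ y)))
    (∑₉-+ (λ y → f y * g (x ⊖ y)) (λ y → f y * h (x ⊖ y)))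

  ℤ[F₉]-commutativeRing : CommutativeRing 0ℓ 0ℓ
  ℤ[F₉]-commutativeRing = record
    { Carrier = F₉ → ℤ ; _≈_ = λ f g → ∀ x → f x ≡ g x
    ; _+_ = λ f g x → f x + g x ; _*_ = _⋆_ ; -_ = λ f x → - f x ; 0# = λ _ → 0ℤ ; 1# = 𝟙₀
    ; isCommutativeRing = record
      { isRing = record
        { +-isAbelianGroup = record
          { isGroup = record
            { isMonoid = record
              { isSemigroup = record
                { isMagma = record
                  { isEquivalence = record
                    { refl = λ _ → refl ; sym = λ p x → sym (p x) ; trans = λ p q x → trans (p x) (q x) }
                  ; ∙-cong = λ p q x → cong₂ _+_ (p x) (q x)
                  }
                ; assoc = λ f g h x → ℤ.+-assoc (f x) (g x) (h x)
                }
              ; identity = (λ f x → ℤ.+-identityˡ (f x)) , (λ f x → ℤ.+-identityʳ (f x))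
              }
            ; inverse = (λ f x → ℤ.+-inverseˡ (f x)) , (λ f x → ℤ.+-inverseʳ (f x))
            ; ⁻¹-cong = λ p x → cong -_ (p x)
            }
          ; comm = λ f g x → ℤ.+-comm (f x) (g x)
          }
        ; *-cong = ⋆-cong
        ; *-assoc = ⋆-assoc
        ; *-identity = ⋆-identityˡ , λ f x → trans (⋆-comm f 𝟙₀ x) (⋆-identityˡ f x)
        ; distrib = ⋆-distribˡ
                  , λ f g h x → trans (⋆-comm (λ y → g y + h y) f x)
                      (trans (⋆-distribˡ f g h x) (cong₂ _+_ (⋆-comm f g x) (⋆-comm f h x)))
        }
      ; *-comm = ⋆-comm
      }
    }

module ℤ[F₉]ᴿ = CommutativeRing ℤ[F₉]-commutativeRing

infix 4 _≟ᵉ_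
_≟ᵉ_ : (x y : ℤ[ω]) → Dec (x ≡ y)
⟪ a , b ⟫ ≟ᵉ ⟪ c , d ⟫ = map′ (λ (p , q) → cong₂ ⟪_,_⟫ p q) (λ p → cong re p , cong im p) (a ℤ.≟ c ×-dec b ℤ.≟ d)

-- The character x + y i ↦ ω ^ x; every character of 𝔽₉ is ψ (t x) for a unique t.
ψ : F₉ → ℤ[ω]
ψ (0F , _) = ι 1ℤ
ψ (1F , _) = ⟪ 0ℤ , 1ℤ ⟫
ψ (2F , _) = ⟪ - 1ℤ , - 1ℤ ⟫

ψ-+ : ∀ x y → ψ (x F₉.+ y) ≡ ψ x *ᵉ ψ y
ψ-+ = from-yes (∀F₉? λ x → ∀F₉? λ y → ψ (x F₉.+ y) ≟ᵉ ψ x *ᵉ ψ y)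

module ∑ω = FieldSum ℤ[ω]-commutativeRing
module ∑ℤ = FieldSum ℤ.+-*-commutativeRing

-- For nonzero `x` the first coordinate of `t x` takes each value in 𝔽₃ three times, and the cube
-- roots of unity sum to zero. The nine cases are evaluated.
ψ-orthogonality : ∀ x → ∑ω.∑₉ (λ t → ψ (t F₉.* x)) ≡ ∑ω.𝟙₀ x *ᵉ ι (+ 9)
ψ-orthogonality = from-yes (∀F₉? λ x → ∑ω.∑₉ (λ t → ψ (t F₉.* x)) ≟ᵉ ∑ω.𝟙₀ x *ᵉ ι (+ 9))

Ψ : F₉ → (F₉ → ℤ) → ℤ[ω]
Ψ t f = ∑ω.∑₉ λ x → ι (f x) *ᵉ ψ (t F₉.* x)

ι-∑ : ∀ f → ι (∑ℤ.∑₉ f) ≡ ∑ω.∑₉ (ι ∘ f)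
ι-∑ f = sum-homo ℤ.+-*-commutativeRing ℤ[ω]-commutativeRing ι ι-homomorphism (f ∘ element)

Ψ-* : ∀ t f g → Ψ t (f ⋆ g) ≡ Ψ t f *ᵉ Ψ t g
Ψ-* t f g = begin
  ∑₉ (λ x → ι ((f ⋆ g) x) *ᵉ χ x)
    ≡⟨ ∑₉-cong (λ x → trans (cong (_*ᵉ χ x) (ι-∑ (λ y → f y * g (x ⊖ y))))
         (∑₉-*ʳ (χ x) (λ y → ι (f y * g (x ⊖ y))))) ⟩
  ∑₉ (λ x → ∑₉ λ y → ι (f y * g (x ⊖ y)) *ᵉ χ x)
    ≡⟨ ∑₉-comm (λ x y → ι (f y * g (x ⊖ y)) *ᵉ χ x) ⟩
  ∑₉ (λ y → ∑₉ λ x → ι (f y * g (x ⊖ y)) *ᵉ χ x)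
    ≡⟨ ∑₉-cong (λ y → ∑₉-reindex (λ x → ι (f y * g (x ⊖ y)) *ᵉ χ x)
         (F₉._+ y) (_⊖ y) (λ x → ⊖-+ x y) (λ x → +-⊖ x y)) ⟩
  ∑₉ (λ y → ∑₉ λ x → ι (f y * g ((x F₉.+ y) ⊖ y)) *ᵉ χ (x F₉.+ y))
    ≡⟨ ∑₉-cong (λ y → trans (∑₉-cong (term y)) (sym (∑₉-*ˡ (ι (f y) *ᵉ χ y) (λ x → ι (g x) *ᵉ χ x)))) ⟩
  ∑₉ (λ y → (ι (f y) *ᵉ χ y) *ᵉ Ψ t g)
    ≡⟨ ∑₉-*ʳ (Ψ t g) (λ y → ι (f y) *ᵉ χ y) ⟨
  Ψ t f *ᵉ Ψ t g ∎
  where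
  open ≡-Reasoning
  open ∑ω
  open CommutativeSemigroupProperties ℤ[ω]ᴿ.*-commutativeSemigroup using (interchange)
  χ : F₉ → ℤ[ω]
  χ x = ψ (t F₉.* x)
  term : ∀ y x → ι (f y * g ((x F₉.+ y) ⊖ y)) *ᵉ χ (x F₉.+ y) ≡ (ι (f y) *ᵉ χ y) *ᵉ (ι (g x) *ᵉ χ x)
  term y x = begin
    ι (f y * g ((x F₉.+ y) ⊖ y)) *ᵉ χ (x F₉.+ y)
      ≡⟨ cong₂ (λ a b → ι (f y * g a) *ᵉ ψ b) (+-⊖ x y) (trans (F₉.*-distribˡ-+ t x y) (F₉.+-comm (t F₉.* x) (t F₉.* y))) ⟩
    ι (f y * g x) *ᵉ ψ (t F₉.* y F₉.+ t F₉.* x)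
      ≡⟨ cong₂ _*ᵉ_ (ι-* (f y) (g x)) (ψ-+ (t F₉.* y) (t F₉.* x)) ⟩
    (ι (f y) *ᵉ ι (g x)) *ᵉ (χ y *ᵉ χ x)
      ≡⟨ interchange (ι (f y)) (ι (g x)) (χ y) (χ x) ⟩
    (ι (f y) *ᵉ χ y) *ᵉ (ι (g x) *ᵉ χ x) ∎

Ψ-cong : ∀ t {f g : F₉ → ℤ} → (∀ x → f x ≡ g x) → Ψ t f ≡ Ψ t g
Ψ-cong t f≡g = ∑ω.∑₉-cong λ x → cong (λ a → ι a *ᵉ ψ (t F₉.* x)) (f≡g x)

Ψ-+ : ∀ t f g → Ψ t (λ x → f x + g x) ≡ Ψ t f +ᵉ Ψ t g
Ψ-+ t f g = trans (∑ω.∑₉-cong λ x → ℤ[ω]ᴿ.distribʳ (ψ (t F₉.* x)) (ι (f x)) (ι (g x)))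
  (∑ω.∑₉-+ (λ x → ι (f x) *ᵉ ψ (t F₉.* x)) (λ x → ι (g x) *ᵉ ψ (t F₉.* x)))

Ψ-homomorphism : ∀ t → IsRingHomomorphism ℤ[F₉]ᴿ.rawRing ℤ[ω]ᴿ.rawRing (Ψ t)
Ψ-homomorphism t = record
  { isSemiringHomomorphism = record
    { isNearSemiringHomomorphism = record
      { +-isMonoidHomomorphism = record
        { isMagmaHomomorphism = record
          { isRelHomomorphism = record { cong = Ψ-cong t }
          ; homo = Ψ-+ t
          }
        ; ε-homo = Ψ-0
        }
      ; *-homo = Ψ-* t
      }
    ; 1#-homo = from-yes (∀F₉? λ t → Ψ t ∑ℤ.𝟙₀ ≟ᵉ ι 1ℤ) t
    }
  ; -‿homo = λ f → +-inverseʳ-unique (Ψ t f) (Ψ t (λ x → - f x))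
      (trans (sym (Ψ-+ t f (λ x → - f x))) (trans (Ψ-cong t λ x → ℤ.+-inverseʳ (f x)) Ψ-0))
  }
  where
  open import Algebra.Properties.Ring ℤ[ω]ᴿ.ring using (+-inverseʳ-unique)
  Ψ-0 : Ψ t (λ _ → 0ℤ) ≡ ι 0ℤ
  Ψ-0 = from-yes (∀F₉? λ t → Ψ t (λ _ → 0ℤ) ≟ᵉ ι 0ℤ) t

-- After an exchange of sums, `ψ-orthogonality` isolates the coefficient at zero.
Ψ-inversion : ∀ f → ∑ω.∑₉ (λ t → Ψ t f) ≡ ι (f F₉.0#) *ᵉ ι (+ 9)
Ψ-inversion f = begin
  ∑₉ (λ t → ∑₉ λ x → ι (f x) *ᵉ ψ (t F₉.* x))
    ≡⟨ ∑₉-comm (λ t x → ι (f x) *ᵉ ψ (t F₉.* x)) ⟩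
  ∑₉ (λ x → ∑₉ λ t → ι (f x) *ᵉ ψ (t F₉.* x))
    ≡⟨ ∑₉-cong (λ x → trans (sym (∑₉-*ˡ (ι (f x)) (λ t → ψ (t F₉.* x)))) (term x)) ⟩
  ∑₉ (λ x → 𝟙₀ x *ᵉ (ι (f x) *ᵉ ι (+ 9)))
    ≡⟨ ∑₉-𝟙₀ (λ x → ι (f x) *ᵉ ι (+ 9)) ⟩
  ι (f F₉.0#) *ᵉ ι (+ 9) ∎
  where
  open ≡-Reasoning
  open ∑ω
  open CommutativeSemigroupProperties ℤ[ω]ᴿ.*-commutativeSemigroup using (x∙yz≈y∙xz)
  term : ∀ x → ι (f x) *ᵉ ∑₉ (λ t → ψ (t F₉.* x)) ≡ 𝟙₀ x *ᵉ (ι (f x) *ᵉ ι (+ 9))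
  term x = trans (cong (ι (f x) *ᵉ_) (ψ-orthogonality x)) (x∙yz≈y∙xz (ι (f x)) (𝟙₀ x) (ι (+ 9)))

-- Factorisation of the group determinant

log : F₉ → Fin 8
log x with index x
... | zero  = 0F
... | suc k = k

u-≢0 : ∀ k → u k ≢ F₉.0#
u-≢0 = from-yes (all? λ k → ¬? (u k F₉.≟ F₉.0#))

log-u : ∀ k → log (u k) ≡ k
log-u = from-yes (all? λ k → log (u k) ≟ k)

u-log : ∀ x → .(x ≢ F₉.0#) → u (log x) ≡ x
u-log x x≢0 with from-yes (∀F₉? λ x → (x F₉.≟ F₉.0#) ⊎-dec (u (log x) F₉.≟ x)) x
... | inj₁ x≡0 = ⊥-elim-irr (x≢0 x≡0)
... | inj₂ eq  = eq

cancel-inverse : ∀ x y → .(x ≢ F₉.0#) → x F₉.⁻¹ F₉.* (x F₉.* y) ≡ y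
cancel-inverse x y x≢0 =
  trans (sym (F₉.*-assoc (x F₉.⁻¹) x y)) (trans (cong (F₉._* y) (F₉.⁻¹-inverseˡ x x≢0)) (F₉.*-identityˡ y))

cancel-inverse′ : ∀ x y → .(x ≢ F₉.0#) → x F₉.* (x F₉.⁻¹ F₉.* y) ≡ y
cancel-inverse′ x y x≢0 =
  trans (sym (F₉.*-assoc x (x F₉.⁻¹) y)) (trans (cong (F₉._* y) (F₉.⁻¹-inverseʳ x x≢0)) (F₉.*-identityˡ y))

-- The product of the linear map u k and the translation by x.
elt : Fin 8 → F₉ → GA
elt k x = mat (u k) (u k F₉.* x) (u-≢0 k)

linear : GA → Fin 8
linear h = log (GA.a h)

translation : GA → F₉
translation h = GA.a h F₉.⁻¹ F₉.* GA.b h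

translation-elt : ∀ k x → translation (elt k x) ≡ x
translation-elt k x = cancel-inverse (u k) x (u-≢0 k)

elt-η : ∀ h → elt (linear h) (translation h) ≡ h
elt-η (mat a b a≢0) = GA-≡ (u-log a a≢0)
  (trans (cong (F₉._* (a F₉.⁻¹ F₉.* b)) (u-log a a≢0)) (cancel-inverse′ a b a≢0))

quotient : Fin 8 → Fin 8 → F₉ → GA
quotient k l x = elt k x ∙ inv (elt l F₉.0#)

-- The two translations meet in the middle, between a linear map and the inverse of another, so only
-- `x ⊖ y` matters: between two cosets the group matrix is a convolution matrix on 𝔽₉.
elt-quotient : ∀ k l x y → elt k x ∙ inv (elt l y) ≡ quotient k l (x ⊖ y)
elt-quotient k l x y = GA-≡ refl (trans
  (cong (λ z → u k F₉.* F₉.- z F₉.+ u k F₉.* x) (cancel-inverse (u l) y (u-≢0 l)))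
  (trans (check (u k) x y)
    (cong (λ z → u k F₉.* F₉.- z F₉.+ u k F₉.* (x ⊖ y)) (sym (cancel-inverse (u l) F₉.0# (u-≢0 l))))))
  where
  check : ∀ a x y → a F₉.* F₉.- y F₉.+ a F₉.* x ≡ a F₉.* F₉.- F₉.0# F₉.+ a F₉.* (x ⊖ y)
  check = from-yes (∀F₉? λ a → ∀F₉? λ x → ∀F₉? λ y →
    (a F₉.* F₉.- y F₉.+ a F₉.* x) F₉.≟ (a F₉.* F₉.- F₉.0# F₉.+ a F₉.* (x ⊖ y)))

infixl 7 _⊘_ _⊛_
_⊘_ _⊛_ : Fin 8 → Fin 8 → Fin 8
k ⊘ l = log (u k F₉.* u l F₉.⁻¹)
k ⊛ l = log (u k F₉.* u l)

⊘-⊛ : ∀ l k → (k ⊘ l) ⊛ l ≡ k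
⊘-⊛ = from-yes (all? λ l → all? λ k → (k ⊘ l) ⊛ l ≟ k)

⊛-⊘ : ∀ l k → (k ⊛ l) ⊘ l ≡ k
⊛-⊘ = from-yes (all? λ l → all? λ k → (k ⊛ l) ⊘ l ≟ k)

-- The linear maps commute, and placing `u m` inverse before and `u m` after the translation by `x`
-- gives the translation by `u m ⁻¹ x`.
quotient-⊘ : ∀ k l m x → quotient k l (u m F₉.⁻¹ F₉.* x) ≡ quotient (k ⊘ m) (l ⊘ m) x
quotient-⊘ k l m x = GA-≡
  (from-yes (all? λ k → all? λ l → all? λ m →
    (u k F₉.* u l F₉.⁻¹) F₉.≟ (u (k ⊘ m) F₉.* u (l ⊘ m) F₉.⁻¹)) k l m)
  (trans (check k l (u m F₉.⁻¹ F₉.* x)) (trans (check′ k m x) (sym (check (k ⊘ m) (l ⊘ m) x))))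
  where
  check : ∀ k l x → GA.b (quotient k l x) ≡ u k F₉.* x
  check = from-yes (all? λ k → all? λ l → ∀F₉? λ x → GA.b (quotient k l x) F₉.≟ (u k F₉.* x))
  check′ : ∀ k m x → u k F₉.* (u m F₉.⁻¹ F₉.* x) ≡ u (k ⊘ m) F₉.* x
  check′ = from-yes (all? λ k → all? λ m → ∀F₉? λ x → (u k F₉.* (u m F₉.⁻¹ F₉.* x)) F₉.≟ (u (k ⊘ m) F₉.* x))

-- Moving the translation to the right of the inverse of `u l` multiplies it by `u l`.
quotient-elt : ∀ k l x → quotient k l x ≡ elt (k ⊘ l) (u l F₉.* x)
quotient-elt k l x = GA-≡
  (from-yes (all? λ k → all? λ l → (u k F₉.* u l F₉.⁻¹) F₉.≟ (u (k ⊘ l))) k l)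
  (from-yes (all? λ k → all? λ l → ∀F₉? λ x →
    GA.b (quotient k l x) F₉.≟ (u (k ⊘ l) F₉.* (u l F₉.* x))) k l x)

module DetZ = DeterminantTheory ℤ.+-*-commutativeRing
module Detω = DeterminantTheory ℤ[ω]-commutativeRing
module DetF = DeterminantTheory ℤ[F₉]-commutativeRing

open Exp ℤ[ω]ᴿ.semiring using () renaming (_^_ to _^ᵉ_)
open Sum ℤ[ω]ᴿ.semiring
open Detω using (δ)

∑-group : ∀ {n} (g : Fin n ↔ GA) (f : GA → ℤ[ω]) →
          sum (f ∘ Inverse.to g) ≡ sum λ k → ∑ω.∑₉ λ x → f (elt k x)
∑-group g f = Detω.∑-enumerate g (λ k i → elt k (element i)) linear (index ∘ translation)
  (λ h → trans (cong (elt (linear h)) (element-index (translation h))) (elt-η h))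
  (λ k i → log-u k)
  (λ k i → trans (cong index (translation-elt k (element i))) (index-element i)) f

-- The entries of left multiplication by Σ α(h) h on ℤ[G], a free right module over ℤ[F₉]
-- with the linear maps as basis.
groupRingMatrix : (GA → ℤ) → Fin 8 → Fin 8 → F₉ → ℤ
groupRingMatrix α k l x = α (quotient k l x)

block : (GA → ℤ) → F₉ → Fin 8 → Fin 8 → ℤ[ω]
block α t k l = Ψ t (groupRingMatrix α k l)

groupMatrix : ∀ {n} → Fin n ↔ GA → (GA → ℤ) → Fin n → Fin n → ℤ[ω]
groupMatrix g α i j = ι (α (Inverse.to g i ∙ inv (Inverse.to g j)))

open CommutativeSemigroupProperties ℤ[ω]ᴿ.*-commutativeSemigroup using (x∙yz≈y∙xz)

-- The Fourier transform along the translations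

module Fourier where
  open ∑ω using (∑₉; ∑₉-cong; ∑₉-reindex; ∑₉-*ʳ; ∑₉-*ˡ; 𝟙₀)
  open ≡-Reasoning

  χ : Fin 9 → F₉ → ℤ[ω]
  χ t x = ψ (element t F₉.* x)

  χ⁻¹ : Fin 9 → F₉ → ℤ[ω]
  χ⁻¹ t x = ψ (F₉.- element t F₉.* x)

  -- The transform sums the coefficients over a coset of the translations against a character.
  transform : Fin 9 → Fin 8 → GA → ℤ[ω]
  transform t k h = δ k (linear h) *ᵉ χ t (translation h)

  inverse : GA → Fin 9 → Fin 8 → ℤ[ω]
  inverse h t k = δ k (linear h) *ᵉ χ⁻¹ t (translation h)

  transform-elt : ∀ t k l x → transform t k (elt l x) ≡ δ k l *ᵉ χ t x
  transform-elt t k l x = cong₂ (λ m y → δ k m *ᵉ χ t y) (log-u l) (translation-elt l x)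

  inverse-elt : ∀ t k l x → inverse (elt l x) t k ≡ δ k l *ᵉ χ⁻¹ t x
  inverse-elt t k l x = cong₂ (λ m y → δ k m *ᵉ χ⁻¹ t y) (log-u l) (translation-elt l x)

  χ-orthogonality : ∀ t t′ → ∑₉ (λ x → χ t x *ᵉ χ⁻¹ t′ x) ≡ ι (+ 9) *ᵉ δ t t′
  χ-orthogonality = from-yes (all? λ t → all? λ t′ → ∑₉ (λ x → χ t x *ᵉ χ⁻¹ t′ x) ≟ᵉ ι (+ 9) *ᵉ δ t t′)

  ∑-transform : ∀ {n} (g : Fin n ↔ GA) t k (f : GA → ℤ[ω]) →
    sum (λ i → transform t k (Inverse.to g i) *ᵉ f (Inverse.to g i)) ≡ ∑₉ λ x → χ t x *ᵉ f (elt k x)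
  ∑-transform g t k f = begin
    sum (λ i → transform t k (Inverse.to g i) *ᵉ f (Inverse.to g i))
      ≡⟨ ∑-group g (λ h → transform t k h *ᵉ f h) ⟩
    sum (λ l → ∑₉ λ x → transform t k (elt l x) *ᵉ f (elt l x))
      ≡⟨ sum-cong-≋ {8} (λ l → ∑₉-cong λ x → trans (cong (_*ᵉ f (elt l x)) (transform-elt t k l x))
           (*ᵉ-assoc (δ k l) (χ t x) (f (elt l x)))) ⟩
    sum (λ l → ∑₉ λ x → δ k l *ᵉ (χ t x *ᵉ f (elt l x)))
      ≡⟨ Detω.∑∑-δ (λ l i → χ t (element i) *ᵉ f (elt l (element i))) k ⟩
    ∑₉ (λ x → χ t x *ᵉ f (elt k x)) ∎

  transform-inverse : ∀ {n} (g : Fin n ↔ GA) t k t′ k′ →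
    sum (λ i → transform t k (Inverse.to g i) *ᵉ inverse (Inverse.to g i) t′ k′)
      ≡ ι (+ 9) *ᵉ (δ t t′ *ᵉ δ k k′)
  transform-inverse g t k t′ k′ = begin
    sum (λ i → transform t k (Inverse.to g i) *ᵉ inverse (Inverse.to g i) t′ k′)
      ≡⟨ ∑-transform g t k (λ h → inverse h t′ k′) ⟩
    ∑₉ (λ x → χ t x *ᵉ inverse (elt k x) t′ k′)
      ≡⟨ ∑₉-cong (λ x → trans (cong (χ t x *ᵉ_) (inverse-elt t′ k′ k x))
           (x∙yz≈y∙xz (χ t x) (δ k′ k) (χ⁻¹ t′ x))) ⟩
    ∑₉ (λ x → δ k′ k *ᵉ (χ t x *ᵉ χ⁻¹ t′ x))
      ≡⟨ ∑₉-*ˡ (δ k′ k) (λ x → χ t x *ᵉ χ⁻¹ t′ x) ⟨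
    δ k′ k *ᵉ ∑₉ (λ x → χ t x *ᵉ χ⁻¹ t′ x)
      ≡⟨ cong₂ _*ᵉ_ (Detω.δ-sym k′ k) (χ-orthogonality t t′) ⟩
    δ k k′ *ᵉ (ι (+ 9) *ᵉ δ t t′)
      ≡⟨ x∙yz≈y∙xz (δ k k′) (ι (+ 9)) (δ t t′) ⟩
    ι (+ 9) *ᵉ (δ k k′ *ᵉ δ t t′)
      ≡⟨ cong (ι (+ 9) *ᵉ_) (*ᵉ-comm (δ k k′) (δ t t′)) ⟩
    ι (+ 9) *ᵉ (δ t t′ *ᵉ δ k k′) ∎

  -- By `elt-quotient` the entries depend on `x ⊖ y` with `y` the translation part of `h`; shifting
  -- the sum by `y` splits off the factor `χ t y`.
  transform-groupMatrix : ∀ {n} (g : Fin n ↔ GA) (α : GA → ℤ) t k h →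
    sum (λ i → transform t k (Inverse.to g i) *ᵉ ι (α (Inverse.to g i ∙ inv h)))
      ≡ block α (element t) k (linear h) *ᵉ χ t (translation h)
  transform-groupMatrix g α t k h = begin
    sum (λ i → transform t k (Inverse.to g i) *ᵉ ι (α (Inverse.to g i ∙ inv h)))
      ≡⟨ ∑-transform g t k (λ h′ → ι (α (h′ ∙ inv h))) ⟩
    ∑₉ (λ x → χ t x *ᵉ ι (α (elt k x ∙ inv h)))
      ≡⟨ ∑₉-cong (λ x → cong (λ h′ → χ t x *ᵉ ι (α h′)) (trans
           (cong (λ h′ → elt k x ∙ inv h′) (sym (elt-η h))) (elt-quotient k l x y))) ⟩
    ∑₉ (λ x → χ t x *ᵉ ι (α (quotient k l (x ⊖ y))))
      ≡⟨ ∑₉-reindex (λ x → χ t x *ᵉ ι (α (quotient k l (x ⊖ y))))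
           (F₉._+ y) (_⊖ y) (λ x → ⊖-+ x y) (λ x → +-⊖ x y) ⟩
    ∑₉ (λ x → χ t (x F₉.+ y) *ᵉ ι (α (quotient k l ((x F₉.+ y) ⊖ y))))
      ≡⟨ ∑₉-cong (λ x → trans
           (cong₂ _*ᵉ_ (trans (cong ψ (F₉.*-distribˡ-+ (element t) x y)) (ψ-+ (element t F₉.* x) (element t F₉.* y)))
                       (cong (λ z → ι (α (quotient k l z))) (+-⊖ x y)))
           (rotate (χ t x) (χ t y) (ι (α (quotient k l x))))) ⟩
    ∑₉ (λ x → (ι (α (quotient k l x)) *ᵉ χ t x) *ᵉ χ t y)
      ≡⟨ ∑₉-*ʳ (χ t y) (λ x → ι (α (quotient k l x)) *ᵉ χ t x) ⟨
    block α (element t) k l *ᵉ χ t y ∎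
    where
    l = linear h
    y = translation h
    rotate : ∀ a b c → (a *ᵉ b) *ᵉ c ≡ (c *ᵉ a) *ᵉ b
    rotate a b c = trans (*ᵉ-comm (a *ᵉ b) c) (sym (*ᵉ-assoc c a b))

  blocks-transform : ∀ α t k h →
    sum (λ t′ → sum λ k′ → (δ t t′ *ᵉ block α (element t) k k′) *ᵉ transform t′ k′ h)
      ≡ block α (element t) k (linear h) *ᵉ χ t (translation h)
  blocks-transform α t k h = begin
    sum (λ t′ → sum λ k′ → (δ t t′ *ᵉ b k′) *ᵉ transform t′ k′ h)
      ≡⟨ sum-cong-≋ {9} (λ t′ → sum-cong-≋ {8} λ k′ → *ᵉ-assoc (δ t t′) (b k′) (transform t′ k′ h)) ⟩
    sum (λ t′ → sum λ k′ → δ t t′ *ᵉ (b k′ *ᵉ transform t′ k′ h))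
      ≡⟨ Detω.∑∑-δ (λ t′ k′ → b k′ *ᵉ transform t′ k′ h) t ⟩
    sum (λ k′ → b k′ *ᵉ (δ k′ l *ᵉ χ t y))
      ≡⟨ sum-cong-≋ {8} (λ k′ → trans (x∙yz≈y∙xz (b k′) (δ k′ l) (χ t y))
           (cong (_*ᵉ (b k′ *ᵉ χ t y)) (Detω.δ-sym k′ l))) ⟩
    sum (λ k′ → δ l k′ *ᵉ (b k′ *ᵉ χ t y))
      ≡⟨ Detω.∑-δˡ (λ k′ → b k′ *ᵉ χ t y) l ⟩
    b l *ᵉ χ t y ∎
    where
    l = linear h
    y = translation h
    b = block α (element t) k

cancel-9 : ∀ x y → ι (+ 9) *ᵉ x ≡ ι (+ 9) *ᵉ y → x ≡ y
cancel-9 x@(⟪ a , b ⟫) y@(⟪ c , d ⟫) eq = cong₂ ⟪_,_⟫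
  (ℤ.*-cancelˡ-≡ (+ 9) a c (cong re scaled)) (ℤ.*-cancelˡ-≡ (+ 9) b d (cong im scaled))
  where
  scaled : ⟪ + 9 * a , + 9 * b ⟫ ≡ ⟪ + 9 * c , + 9 * d ⟫
  scaled = trans (sym (ι-scale (+ 9) x)) (trans eq (ι-scale (+ 9) y))

cancel-^ : ∀ z → (∀ x y → z *ᵉ x ≡ z *ᵉ y → x ≡ y) → ∀ n x y → z ^ᵉ n *ᵉ x ≡ z ^ᵉ n *ᵉ y → x ≡ y
cancel-^ z cancel zero    x y eq = trans (sym (*ᵉ-identityˡ x)) (trans eq (*ᵉ-identityˡ y))
cancel-^ z cancel (suc n) x y eq = cancel-^ z cancel n x y (cancel (z ^ᵉ n *ᵉ x) (z ^ᵉ n *ᵉ y)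
  (trans (sym (*ᵉ-assoc z (z ^ᵉ n) x)) (trans eq (*ᵉ-assoc z (z ^ᵉ n) y))))

det-groupMatrix : ∀ (g : Fin (9 ℕ.* 8) ↔ GA) α →
  Detω.det (groupMatrix g α) ≡ Functional.foldr _*ᵉ_ (ι 1ℤ) (λ t → Detω.det (block α (element t)))
det-groupMatrix g α = scaled (ι (+ 9)) refl
  where
  open Fourier
  -- With ι (+ 9) in place of the variable, conversion checking evaluates its 72nd power.
  scaled : ∀ z → z ≡ ι (+ 9) →
    Detω.det (groupMatrix g α) ≡ Functional.foldr _*ᵉ_ (ι 1ℤ) (λ t → Detω.det (block α (element t)))
  scaled z z≡9 = Detω.det-block-diagonalise 9 8
    (λ t k i → transform t k (Inverse.to g i)) (λ i → inverse (Inverse.to g i))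
    (groupMatrix g α) (λ t → block α (element t)) z
    (λ t k t′ k′ → trans (transform-inverse g t k t′ k′) (cong (_*ᵉ (δ t t′ *ᵉ δ k k′)) (sym z≡9)))
    (λ t k j → trans (transform-groupMatrix g α t k (Inverse.to g j))
      (sym (blocks-transform α t k (Inverse.to g j))))
    (λ {x} {y} → cancel-^ z
      (λ x y eq → cancel-9 x y (trans (cong (_*ᵉ x) (sym z≡9)) (trans eq (cong (_*ᵉ y) z≡9)))) (9 ℕ.* 8) x y)

-- Values at the trivial and the nontrivial characters

circulant : (Fin 8 → ℤ) → Fin 8 → Fin 8 → ℤ
circulant s k l = s (k ⊘ l)

-- These are the coefficients of the image in ℤ[C₈], where `elt k x` goes to the linear map `u k`.
cosetSum : (GA → ℤ) → Fin 8 → ℤ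
cosetSum α k = ∑ℤ.∑₉ λ x → α (elt k x)

-- The trivial character forgets the translation part, and by `quotient-elt` the sum runs over the
-- coset of `k ⊘ l`, permuted by multiplication by `u l`.
block-0 : ∀ α k l → block α F₉.0# k l ≡ ι (circulant (cosetSum α) k l)
block-0 α k l = begin
  ∑ω.∑₉ (λ x → ι (α (quotient k l x)) *ᵉ ψ (F₉.0# F₉.* x))
    ≡⟨ ∑ω.∑₉-cong (λ x → trans (cong (λ z → ι (α (quotient k l x)) *ᵉ ψ z) (F₉.*-zeroˡ x))
         (ℤ[ω]ᴿ.*-identityʳ (ι (α (quotient k l x))))) ⟩
  ∑ω.∑₉ (λ x → ι (α (quotient k l x)))
    ≡⟨ ι-∑ (λ x → α (quotient k l x)) ⟨
  ι (∑ℤ.∑₉ λ x → α (quotient k l x))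
    ≡⟨ cong ι (∑ℤ.∑₉-cong λ x → cong α (quotient-elt k l x)) ⟩
  ι (∑ℤ.∑₉ λ x → α (elt (k ⊘ l) (u l F₉.* x)))
    ≡⟨ cong ι (∑ℤ.∑₉-reindex (λ x → α (elt (k ⊘ l) x)) (u l F₉.*_) (u l F₉.⁻¹ F₉.*_)
         (λ x → cancel-inverse′ (u l) x (u-≢0 l)) (λ x → cancel-inverse (u l) x (u-≢0 l))) ⟨
  ι (circulant (cosetSum α) k l) ∎
  where open ≡-Reasoning

-- Substituting `u m ⁻¹ x` for `x` turns the character of `u m` into that of one, and `quotient-⊘`
-- moves the change into the indices. Rows and columns are thus permuted alike.
block-u : ∀ α m k l → block α (u m) k l ≡ block α F₉.1# (k ⊘ m) (l ⊘ m)
block-u α m k l = begin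
  ∑ω.∑₉ (λ x → ι (α (quotient k l x)) *ᵉ ψ (u m F₉.* x))
    ≡⟨ ∑ω.∑₉-reindex (λ x → ι (α (quotient k l x)) *ᵉ ψ (u m F₉.* x)) (u m F₉.⁻¹ F₉.*_) (u m F₉.*_)
         (λ x → cancel-inverse (u m) x (u-≢0 m)) (λ x → cancel-inverse′ (u m) x (u-≢0 m)) ⟩
  ∑ω.∑₉ (λ x → ι (α (quotient k l (u m F₉.⁻¹ F₉.* x))) *ᵉ ψ (u m F₉.* (u m F₉.⁻¹ F₉.* x)))
    ≡⟨ ∑ω.∑₉-cong (λ x → cong₂ (λ h z → ι (α h) *ᵉ ψ z) (quotient-⊘ k l m x)
         (trans (cancel-inverse′ (u m) x (u-≢0 m)) (sym (F₉.*-identityˡ x)))) ⟩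
  block α F₉.1# (k ⊘ m) (l ⊘ m) ∎
  where open ≡-Reasoning

det-block-u : ∀ α m → Detω.det (block α (u m)) ≡ Detω.det (block α F₉.1#)
det-block-u α m = trans (Detω.det-cong (block-u α m)) (Detω.det-permute π (block α F₉.1#))
  where
  π : Permutation′ 8
  π = permutation (_⊘ m) (_⊛ m) (⊛-⊘ m) (⊘-⊛ m)

det-block-0 : ∀ α → Detω.det (block α F₉.0#) ≡ ι (DetZ.det (circulant (cosetSum α)))
det-block-0 α = sym (det-homo ℤ.+-*-commutativeRing ℤ[ω]-commutativeRing ι ι-homomorphism
  (circulant (cosetSum α)) (block α F₉.0#) λ k l → sym (block-0 α k l))

det-groupMatrix-power : ∀ (g : Fin (9 ℕ.* 8) ↔ GA) α →
  Detω.det (groupMatrix g α) ≡ ι (DetZ.det (circulant (cosetSum α))) *ᵉ Detω.det (block α F₉.1#) ^ᵉ 8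
det-groupMatrix-power g α = trans (det-groupMatrix g α) (cong₂ _*ᵉ_ (det-block-0 α)
  (Detω.product-constant 8 (λ m → Detω.det (block α (u m))) (Detω.det (block α F₉.1#)) (det-block-u α)))

ι-^ : ∀ a n → ι a ^ᵉ n ≡ ι (a ^ n)
ι-^ a zero    = refl
ι-^ a (suc n) = trans (cong (ι a *ᵉ_) (ι-^ a n)) (sym (ι-* a (a ^ n)))

-- `ι` carries the integer determinant to ℤ[ω], where the characters live; real parts bring the
-- factorisation back.
groupDeterminant-factors : ∀ (g : Fin (9 ℕ.* 8) ↔ GA) α b → Detω.det (block α F₉.1#) ≡ ι b →
  DetZ.det (λ i j → α (Inverse.to g i ∙ inv (Inverse.to g j))) ≡ DetZ.det (circulant (cosetSum α)) * b ^ 8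
groupDeterminant-factors g α b eq = cong re (begin
  ι (DetZ.det λ i j → α (Inverse.to g i ∙ inv (Inverse.to g j)))
    ≡⟨ det-homo ℤ.+-*-commutativeRing ℤ[ω]-commutativeRing ι ι-homomorphism
         (λ i j → α (Inverse.to g i ∙ inv (Inverse.to g j))) (groupMatrix g α)
         (λ _ _ → refl) ⟩
  Detω.det (groupMatrix g α)
    ≡⟨ det-groupMatrix-power g α ⟩
  ι A *ᵉ Detω.det (block α F₉.1#) ^ᵉ 8
    ≡⟨ cong (λ x → ι A *ᵉ x) (trans (cong (_^ᵉ 8) eq) (ι-^ b 8)) ⟩
  ι A *ᵉ ι (b ^ 8)
    ≡⟨ ι-* A (b ^ 8) ⟨
  ι (A * b ^ 8) ∎)
  where
  open ≡-Reasoning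
  A = DetZ.det (circulant (cosetSum α))

-- Fourier inversion at 0 for the determinant over the group ring ℤ[𝔽₉] shows that
-- A + 8 B is divisible by 9.
block-congruence : ∀ α → ∃[ b ] ∃[ q ]
  Detω.det (block α F₉.1#) ≡ ι b × DetZ.det (circulant (cosetSum α)) + + 8 * b ≡ q * + 9
block-congruence α = b , Δ F₉.0# , B≡ιb , real-part
  where
  open ≡-Reasoning
  A = DetZ.det (circulant (cosetSum α))
  B = Detω.det (block α F₉.1#)
  Δ = DetF.det (groupRingMatrix α)
  b = re B

  Ψ-Δ : ∀ t → Ψ t Δ ≡ Detω.det (block α t)
  Ψ-Δ t = det-homo ℤ[F₉]-commutativeRing ℤ[ω]-commutativeRing (Ψ t) (Ψ-homomorphism t) (groupRingMatrix α)
    (block α t) λ _ _ → refl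

  sum-constant : ∀ n x → sum {n} (λ _ → x) ≡ ⟪ + n * re x , + n * im x ⟫
  sum-constant zero    x = refl
  sum-constant (suc n) x@(⟪ a , c ⟫) = trans (cong (x +ᵉ_) (sum-constant n x))
    (cong₂ ⟪_,_⟫ (sym (ℤ.suc-* (+ n) a)) (sym (ℤ.suc-* (+ n) c)))

  equation : ι A +ᵉ ⟪ + 8 * b , + 8 * im B ⟫ ≡ ι (Δ F₉.0#) *ᵉ ι (+ 9)
  equation = begin
    ι A +ᵉ ⟪ + 8 * b , + 8 * im B ⟫
      ≡⟨ cong (ι A +ᵉ_) (sum-constant 8 B) ⟨
    ι A +ᵉ sum {8} (λ _ → B)
      ≡⟨ cong₂ _+ᵉ_ (trans (Ψ-Δ F₉.0#) (det-block-0 α))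
           (sum-cong-≋ {8} λ m → trans (Ψ-Δ (u m)) (det-block-u α m)) ⟨
    ∑ω.∑₉ (λ t → Ψ t Δ)
      ≡⟨ Ψ-inversion Δ ⟩
    ι (Δ F₉.0#) *ᵉ ι (+ 9) ∎

  real-part : A + + 8 * b ≡ Δ F₉.0# * + 9
  real-part = trans (cong re equation) (cong re (sym (ι-* (Δ F₉.0#) (+ 9))))

  -- Compare coefficients of `ω`: neither `ι A` nor the right-hand side of `equation` has one.
  imaginary-part : + 8 * im B ≡ + 8 * 0ℤ
  imaginary-part = trans (sym (ℤ.+-identityˡ _)) (trans (cong im equation) (cong im (sym (ι-* (Δ F₉.0#) (+ 9)))))

  ⟪⟫-η : ∀ x → x ≡ ⟪ re x , im x ⟫
  ⟪⟫-η ⟪ _ , _ ⟫ = refl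

  B≡ιb : B ≡ ι b
  B≡ιb = trans (⟪⟫-η B) (cong ⟪ b ,_⟫ (ℤ.*-cancelˡ-≡ (+ 8) (im B) 0ℤ imaginary-part))

-- Determinants of C₈

open DetZ using (det; det-cong; det-two-blocks)

opaque
  unfolding det

  det-2×2 : ∀ M → det {2} M ≡ M 0F 0F * M 1F 1F - M 0F 1F * M 1F 0F
  det-2×2 M = expand (M 0F 0F) (M 0F 1F) (M 1F 0F) (M 1F 1F)
    where
    expand : ∀ a b c d →
      1ℤ * (a * (1ℤ * (d * 1ℤ) + 0ℤ)) + (- 1ℤ * 1ℤ * (b * (1ℤ * (c * 1ℤ) + 0ℤ)) + 0ℤ) ≡ a * d - b * c
    expand = solve-∀

  det-3×3 : ∀ M → det {3} M ≡
      M 0F 0F * (M 1F 1F * M 2F 2F - M 1F 2F * M 2F 1F)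
    - M 0F 1F * (M 1F 0F * M 2F 2F - M 1F 2F * M 2F 0F)
    + M 0F 2F * (M 1F 0F * M 2F 1F - M 1F 1F * M 2F 0F)
  det-3×3 M = trans
    (expand (M 0F 0F) (M 0F 1F) (M 0F 2F) (det λ i k → M (suc i) (punchIn 0F k))
      (det λ i k → M (suc i) (punchIn 1F k)) (det λ i k → M (suc i) (punchIn 2F k)))
    (cong₂ _+_ (cong₂ _-_ (cong (M 0F 0F *_) (det-2×2 λ i k → M (suc i) (punchIn 0F k)))
                          (cong (M 0F 1F *_) (det-2×2 λ i k → M (suc i) (punchIn 1F k))))
               (cong (M 0F 2F *_) (det-2×2 λ i k → M (suc i) (punchIn 2F k))))
    where
    expand : ∀ a b c x y z →
      1ℤ * (a * x) + (- 1ℤ * 1ℤ * (b * y) + (- 1ℤ * (- 1ℤ * 1ℤ) * (c * z) + 0ℤ)) ≡ a * x - b * y + c * z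
    expand = solve-∀

  -- The minors stay unexpanded, so the solver meets an identity that is linear in each of them.
  det-4×4 : ∀ M → det {4} M ≡
      M 0F 0F * det (λ i k → M (suc i) (punchIn 0F k)) - M 0F 1F * det (λ i k → M (suc i) (punchIn 1F k))
    + M 0F 2F * det (λ i k → M (suc i) (punchIn 2F k)) - M 0F 3F * det (λ i k → M (suc i) (punchIn 3F k))
  det-4×4 M =
    expand (M 0F 0F) (M 0F 1F) (M 0F 2F) (M 0F 3F)
      (det λ i k → M (suc i) (punchIn 0F k)) (det λ i k → M (suc i) (punchIn 1F k))
      (det λ i k → M (suc i) (punchIn 2F k)) (det λ i k → M (suc i) (punchIn 3F k))
    where
    expand : ∀ a b c d x y z w →
      1ℤ * (a * x) + (- 1ℤ * 1ℤ * (b * y) + (- 1ℤ * (- 1ℤ * 1ℤ) * (c * z)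
        + (- 1ℤ * (- 1ℤ * (- 1ℤ * 1ℤ)) * (d * w) + 0ℤ))) ≡ a * x - b * y + c * z - d * w
    expand = solve-∀

-- The circulant (e = 1) and negacyclic (e = -1) matrices with first column a b c d.
twisted : ℤ → (a b c d : ℤ) → Fin 4 → Fin 4 → ℤ
twisted e a b c d 0F 0F = a
twisted e a b c d 0F 1F = e * d
twisted e a b c d 0F 2F = e * c
twisted e a b c d 0F 3F = e * b
twisted e a b c d 1F 0F = b
twisted e a b c d 1F 1F = a
twisted e a b c d 1F 2F = e * d
twisted e a b c d 1F 3F = e * c
twisted e a b c d 2F 0F = c
twisted e a b c d 2F 1F = b
twisted e a b c d 2F 2F = a
twisted e a b c d 2F 3F = e * d
twisted e a b c d 3F 0F = d
twisted e a b c d 3F 1F = c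
twisted e a b c d 3F 2F = b
twisted e a b c d 3F 3F = a

-- With e = ± 1 this is the norm of (a + c √e)² - √e (b + d √e)².
det-twisted : ∀ e a b c d → det (twisted e a b c d) ≡
  (a * a + e * (c * c) - e * (+ 2 * (b * d))) * (a * a + e * (c * c) - e * (+ 2 * (b * d)))
  - e * ((+ 2 * (a * c) - b * b - e * (d * d)) * (+ 2 * (a * c) - b * b - e * (d * d)))
det-twisted e a b c d = trans (det-4×4 M) (trans
  (cong₂ _-_ (cong₂ _+_ (cong₂ _-_
    (cong (M 0F 0F *_) (det-3×3 λ i k → M (suc i) (punchIn 0F k)))
    (cong (M 0F 1F *_) (det-3×3 λ i k → M (suc i) (punchIn 1F k))))
    (cong (M 0F 2F *_) (det-3×3 λ i k → M (suc i) (punchIn 2F k))))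
    (cong (M 0F 3F *_) (det-3×3 λ i k → M (suc i) (punchIn 3F k))))
  (identity e a b c d))
  where
  M = twisted e a b c d
  identity : ∀ e a b c d →
      a * (a * (a * a - e * d * b) - e * d * (b * a - e * d * c) + e * c * (b * b - a * c))
    - e * d * (b * (a * a - e * d * b) - e * d * (c * a - e * d * d) + e * c * (c * b - a * d))
    + e * c * (b * (b * a - e * d * c) - a * (c * a - e * d * d) + e * c * (c * c - b * d))
    - e * b * (b * (b * b - a * c) - a * (c * b - a * d) + e * d * (c * c - b * d))
    ≡ (a * a + e * (c * c) - e * (+ 2 * (b * d))) * (a * a + e * (c * c) - e * (+ 2 * (b * d)))
      - e * ((+ 2 * (a * c) - b * b - e * (d * d)) * (+ 2 * (a * c) - b * b - e * (d * d)))
  identity = solve-∀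

-- A shift by four exchanges the two halves of the index set, so `det-two-blocks` applies. It
-- realises the factorisation of x⁸ - 1 into x⁴ - 1, the circulant factor, and x⁴ + 1, the
-- negacyclic one.
det-circulant : ∀ s → det (circulant s) ≡
  det (twisted 1ℤ (s 0F + s 4F) (s 1F + s 5F) (s 2F + s 6F) (s 3F + s 7F)) *
  det (twisted (- 1ℤ) (s 0F - s 4F) (s 1F - s 5F) (s 2F - s 6F) (s 3F - s 7F))
det-circulant s = trans
  (det-two-blocks 4 X Y (circulant s) (λ _ _ → refl) (λ _ _ → refl)
    (λ i j → cong s (from-yes (all? λ i → all? λ j → ((4 ↑ʳ i) ⊘ (j ↑ˡ 4)) ≟ ((i ↑ˡ 4) ⊘ (4 ↑ʳ j))) i j))
    (λ i j → cong s (from-yes (all? λ i → all? λ j → ((4 ↑ʳ i) ⊘ (4 ↑ʳ j)) ≟ ((i ↑ˡ 4) ⊘ (j ↑ˡ 4))) i j)))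
  (cong₂ _*_ (det-cong plus) (det-cong minus))
  where
  X Y : Fin 4 → Fin 4 → ℤ
  X i j = circulant s (i ↑ˡ 4) (j ↑ˡ 4)
  Y i j = circulant s (i ↑ˡ 4) (4 ↑ʳ j)

  wrap⁺ : ∀ a b → b + a ≡ 1ℤ * (a + b)
  wrap⁺ = solve-∀

  wrap⁻ : ∀ a b → b - a ≡ - 1ℤ * (a - b)
  wrap⁻ = solve-∀

  plus : ∀ i j → X i j + Y i j ≡ twisted 1ℤ (s 0F + s 4F) (s 1F + s 5F) (s 2F + s 6F) (s 3F + s 7F) i j
  plus 0F 0F = refl
  plus 0F 1F = wrap⁺ (s 3F) (s 7F)
  plus 0F 2F = wrap⁺ (s 2F) (s 6F)
  plus 0F 3F = wrap⁺ (s 1F) (s 5F)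
  plus 1F 0F = refl
  plus 1F 1F = refl
  plus 1F 2F = wrap⁺ (s 3F) (s 7F)
  plus 1F 3F = wrap⁺ (s 2F) (s 6F)
  plus 2F 0F = refl
  plus 2F 1F = refl
  plus 2F 2F = refl
  plus 2F 3F = wrap⁺ (s 3F) (s 7F)
  plus 3F 0F = refl
  plus 3F 1F = refl
  plus 3F 2F = refl
  plus 3F 3F = refl

  minus : ∀ i j → X i j - Y i j ≡ twisted (- 1ℤ) (s 0F - s 4F) (s 1F - s 5F) (s 2F - s 6F) (s 3F - s 7F) i j
  minus 0F 0F = refl
  minus 0F 1F = wrap⁻ (s 3F) (s 7F)
  minus 0F 2F = wrap⁻ (s 2F) (s 6F)
  minus 0F 3F = wrap⁻ (s 1F) (s 5F)
  minus 1F 0F = refl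
  minus 1F 1F = refl
  minus 1F 2F = wrap⁻ (s 3F) (s 7F)
  minus 1F 3F = wrap⁻ (s 2F) (s 6F)
  minus 2F 0F = refl
  minus 2F 1F = refl
  minus 2F 2F = refl
  minus 2F 3F = wrap⁻ (s 3F) (s 7F)
  minus 3F 0F = refl
  minus 3F 1F = refl
  minus 3F 2F = refl
  minus 3F 3F = refl

-- Powers of two in the determinants of C₈

bit : Bool → ℤ
bit false = 0ℤ
bit true  = 1ℤ

-- With a Boolean index the parity of a polynomial expression is computed by `xor` and `∧`.
data Parity (b : Bool) (x : ℤ) : Set where
  residue : + 2 ∣ₛ x - bit b → Parity b x

parity : ∀ x → ∃[ b ] Parity b x
parity x with x % + 2 | a≡a%n+[a/n]*n x (+ 2) | n%d<d x (+ 2)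
... | 0 | eq | _ = false , residue (divides (x / + 2) (trans (cong (_- 0ℤ) eq) (even (x / + 2))))
  where
  even : ∀ q → 0ℤ + q * + 2 - 0ℤ ≡ q * + 2
  even = solve-∀
... | 1 | eq | _ = true , residue (divides (x / + 2) (trans (cong (_- 1ℤ) eq) (odd (x / + 2))))
  where
  odd : ∀ q → 1ℤ + q * + 2 - 1ℤ ≡ q * + 2
  odd = solve-∀
... | suc (suc _) | _ | s≤s (s≤s ())

Parity-+ : ∀ {b c x y} → Parity b x → Parity c y → Parity (b xor c) (x + y)
Parity-+ {b} {c} {x} {y} (residue p) (residue q) = residue
  (subst (+ 2 ∣ₛ_) (sym (identity x y (bit b) (bit c) (bit (b xor c)))) (∣m∣n⇒∣m+n (∣m∣n⇒∣m+n p q) (carry b c)))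
  where
  identity : ∀ x y b c d → x + y - d ≡ ((x - b) + (y - c)) + (b + c - d)
  identity = solve-∀
  carry : ∀ b c → + 2 ∣ₛ bit b + bit c - bit (b xor c)
  carry false false = divides 0ℤ refl
  carry false true  = divides 0ℤ refl
  carry true  false = divides 0ℤ refl
  carry true  true  = divides 1ℤ refl

Parity-* : ∀ {b c x y} → Parity b x → Parity c y → Parity (b ∧ c) (x * y)
Parity-* {b} {c} {x} {y} (residue p) (residue q) = residue (subst (+ 2 ∣ₛ_)
  (sym (trans (cong (λ d → x * y - d) (bit-∧ b c)) (identity x y (bit b) (bit c))))
  (∣m∣n⇒∣m+n (∣m⇒∣m*n y p) (∣n⇒∣m*n (bit b) q)))
  where
  identity : ∀ x y b c → x * y - b * c ≡ (x - b) * y + b * (y - c)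
  identity = solve-∀
  bit-∧ : ∀ b c → bit (b ∧ c) ≡ bit b * bit c
  bit-∧ false c     = refl
  bit-∧ true  false = refl
  bit-∧ true  true  = refl

Parity-even : ∀ {b x} y → Parity b x → Parity b (x + + 2 * y)
Parity-even {b} {x} y (residue p) = residue
  (subst (+ 2 ∣ₛ_) (identity x (bit b) y) (∣m∣n⇒∣m+n p (∣m⇒∣m*n y ∣-refl)))
  where
  identity : ∀ x b y → (x - b) + + 2 * y ≡ x + + 2 * y - b
  identity = solve-∀

even⇒2∣ : ∀ {x} → Parity false x → + 2 ∣ₛ x
even⇒2∣ (residue p) = subst (+ 2 ∣ₛ_) (ℤ.+-identityʳ _) p

even⇒4∣square : ∀ {x} → Parity false x → + 4 ∣ₛ x * x
even⇒4∣square {x} (residue (divides q eq)) = divides (q * q) (trans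
  (cong (λ y → y * y) (trans (sym (ℤ.+-identityʳ x)) eq)) (identity q))
  where
  identity : ∀ q → (q * + 2) * (q * + 2) ≡ q * q * + 4
  identity = solve-∀

-- For x = 2 q + 1 the difference is 4 q (q + 1), and one of two consecutive integers is even.
odd⇒8∣square-1 : ∀ {x} → Parity true x → + 8 ∣ₛ x * x - 1ℤ
odd⇒8∣square-1 {x} (residue (divides q eq)) = subst (+ 8 ∣ₛ_) (sym (trans (cong (λ y → y * y - 1ℤ) x≡) (identity q)))
  (*-monoʳ-∣ (+ 4) (consecutive (parity q)))
  where
  add-back : ∀ x → x ≡ (x - 1ℤ) + 1ℤ
  add-back = solve-∀
  x≡ : x ≡ q * + 2 + 1ℤ
  x≡ = trans (add-back x) (cong (_+ 1ℤ) eq)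
  identity : ∀ q → (q * + 2 + 1ℤ) * (q * + 2 + 1ℤ) - 1ℤ ≡ + 4 * (q * (q + 1ℤ))
  identity = solve-∀
  consecutive : (∃[ b ] Parity b q) → + 2 ∣ₛ q * (q + 1ℤ)
  consecutive (b , p) = even⇒2∣ (even b p)
    where
    even : ∀ b → Parity b q → Parity false (q * (q + 1ℤ))
    -- Both branches have the same proof; the case split makes `b ∧ (b xor true)` compute to
    -- `false`.
    even false p = Parity-* p (Parity-+ p (residue {true} (divides 0ℤ refl)))
    even true  p = Parity-* p (Parity-+ p (residue {true} (divides 0ℤ refl)))

¬even-odd : ∀ {x} → Parity true x → ¬ + 2 ∣ x
¬even-odd {x} (residue p) 2∣x = toWitnessFalse {a? = + 2 ∣? 1ℤ} _
  (subst (+ 2 ∣ₛ_) (identity x) (∣m∣n⇒∣m-n (∣ᵤ⇒∣ {+ 2} {x} 2∣x) p))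
  where
  identity : ∀ x → x - (x - 1ℤ) ≡ 1ℤ
  identity = solve-∀

∣-* : ∀ {a b x y} → a ∣ₛ x → b ∣ₛ y → a * b ∣ₛ x * y
∣-* {a} {b} {x} {y} p q = ∣-trans (*-monoʳ-∣ a q) (*-monoˡ-∣ y p)

module CirculantParity (s : Fin 8 → ℤ) where
  private
    -- Let f be the polynomial with coefficients `s`. Its even and odd coefficients sum to `p` and
    -- `q`, so `p * p - q * q` is f(1) f(-1). Further, x + y i is f(i), and m - n i is f(ζ₈) f(-ζ₈).
    -- All are written as even corrections of earlier terms, the form that `Parity-even` accepts.
    p = (s 0F + s 4F) + (s 2F + s 6F)
    q = (s 1F + s 5F) + (s 3F + s 7F)
    x = p + + 2 * - (s 2F + s 6F)
    y = q + + 2 * - (s 3F + s 7F)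
    p′ = p + + 2 * - (s 4F + s 6F)
    q′ = q + + 2 * - (s 5F + s 7F)
    m = p′ * (p′ + + 2 * - (s 2F - s 6F)) + + 2 * ((s 1F - s 5F) * (s 3F - s 7F))
    n = q′ * (q′ + + 2 * - (s 3F - s 7F)) + + 2 * - ((s 0F - s 4F) * (s 2F - s 6F))

    factors : det (circulant s) ≡ (p * p - q * q) * (x * x + y * y) * (m * m + n * n)
    factors = trans (det-circulant s) (cong₂ _*_
      (trans (det-twisted 1ℤ a₊ b₊ c₊ d₊) (circulant-identity a₊ b₊ c₊ d₊))
      (trans (det-twisted (- 1ℤ) (s 0F - s 4F) (s 1F - s 5F) (s 2F - s 6F) (s 3F - s 7F))
        (trans (negacyclic-identity (s 0F - s 4F) (s 1F - s 5F) (s 2F - s 6F) (s 3F - s 7F))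
          (cong₂ (λ v w →
              (v * (v + + 2 * - (s 2F - s 6F)) + + 2 * ((s 1F - s 5F) * (s 3F - s 7F))) *
              (v * (v + + 2 * - (s 2F - s 6F)) + + 2 * ((s 1F - s 5F) * (s 3F - s 7F))) +
              (w * (w + + 2 * - (s 3F - s 7F)) + + 2 * - ((s 0F - s 4F) * (s 2F - s 6F))) *
              (w * (w + + 2 * - (s 3F - s 7F)) + + 2 * - ((s 0F - s 4F) * (s 2F - s 6F))))
            (regroup (s 0F) (s 4F) (s 2F) (s 6F)) (regroup (s 1F) (s 5F) (s 3F) (s 7F))))))
      where
      a₊ = s 0F + s 4F
      b₊ = s 1F + s 5F
      c₊ = s 2F + s 6F
      d₊ = s 3F + s 7F
      regroup : ∀ a a′ c c′ → (a - a′) + (c - c′) ≡ (a + a′) + (c + c′) + + 2 * - (a′ + c′)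
      regroup = solve-∀
      circulant-identity : ∀ a b c d →
        (a * a + 1ℤ * (c * c) - 1ℤ * (+ 2 * (b * d))) * (a * a + 1ℤ * (c * c) - 1ℤ * (+ 2 * (b * d)))
        - 1ℤ * ((+ 2 * (a * c) - b * b - 1ℤ * (d * d)) * (+ 2 * (a * c) - b * b - 1ℤ * (d * d)))
        ≡ ((a + c) * (a + c) - (b + d) * (b + d)) *
          ((a + c + + 2 * - c) * (a + c + + 2 * - c) + (b + d + + 2 * - d) * (b + d + + 2 * - d))
      circulant-identity = solve-∀
      negacyclic-identity : ∀ a b c d →
        (a * a + - 1ℤ * (c * c) - - 1ℤ * (+ 2 * (b * d))) * (a * a + - 1ℤ * (c * c) - - 1ℤ * (+ 2 * (b * d)))
        - - 1ℤ * ((+ 2 * (a * c) - b * b - - 1ℤ * (d * d)) * (+ 2 * (a * c) - b * b - - 1ℤ * (d * d)))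
        ≡ ((a + c) * (a + c + + 2 * - c) + + 2 * (b * d)) * ((a + c) * (a + c + + 2 * - c) + + 2 * (b * d)) +
          ((b + d) * (b + d + + 2 * - d) + + 2 * - (a * c)) * ((b + d) * (b + d + + 2 * - d) + + 2 * - (a * c))
      negacyclic-identity = solve-∀

    4∣ : ∀ {x y} → Parity false x → Parity false y → + 4 ∣ₛ x * x + y * y
    4∣ u v = ∣m∣n⇒∣m+n (even⇒4∣square u) (even⇒4∣square v)

    2∣ : ∀ {x y} → Parity true x → Parity true y → + 2 ∣ₛ x * x + y * y
    2∣ u v = even⇒2∣ (Parity-+ (Parity-* u u) (Parity-* v v))

    squares : ∀ {b c x y} → Parity b x → Parity c y → Parity ((b ∧ b) xor (c ∧ c)) (x * x + y * y)
    squares u v = Parity-+ (Parity-* u u) (Parity-* v v)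

    -- p ≡ x ≡ p′ and q ≡ y ≡ q′ mod 2, so the parities of p and q decide those of all factors.
    module _ {b c} (pᵇ : Parity b p) (qᶜ : Parity c q) where
      xᵇ : Parity b x
      xᵇ = Parity-even (- (s 2F + s 6F)) pᵇ
      yᶜ : Parity c y
      yᶜ = Parity-even (- (s 3F + s 7F)) qᶜ
      p′ᵇ : Parity b p′
      p′ᵇ = Parity-even (- (s 4F + s 6F)) pᵇ
      q′ᶜ : Parity c q′
      q′ᶜ = Parity-even (- (s 5F + s 7F)) qᶜ
      mᵇ : Parity (b ∧ b) m
      mᵇ = Parity-even ((s 1F - s 5F) * (s 3F - s 7F))
        (Parity-* p′ᵇ (Parity-even (- (s 2F - s 6F)) p′ᵇ))
      nᶜ : Parity (c ∧ c) n
      nᶜ = Parity-even (- ((s 0F - s 4F) * (s 2F - s 6F)))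
        (Parity-* q′ᶜ (Parity-even (- (s 3F - s 7F)) q′ᶜ))

      difference : Parity ((b ∧ b) xor (c ∧ c)) (p * p - q * q)
      difference = subst (Parity _) (identity p q)
        (Parity-even (- (q * q)) (squares pᵇ qᶜ))
        where
        identity : ∀ p q → p * p + q * q + + 2 * - (q * q) ≡ p * p - q * q
        identity = solve-∀

  -- If `p` and `q` are even, each of the three factors is divisible by 4, in total 64. If both are
  -- odd, the first is divisible by 8, as a difference of odd squares, and the others by 2, in total
  -- 32. Otherwise every factor is odd.
  circulant-parity : ¬ + 2 ∣ det (circulant s) ⊎ (+ 2) ^ 5 ∣ det (circulant s)
  circulant-parity with parity p | parity q
  ... | false , u | false , v = inj₂ (∣⇒∣ᵤ (subst (+ 32 ∣ₛ_) (sym factors) (∣-trans (divides (+ 2) refl)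
    (∣-* (∣-* (∣m∣n⇒∣m-n (even⇒4∣square u) (even⇒4∣square v)) (4∣ (xᵇ u v) (yᶜ u v)))
      (4∣ (mᵇ u v) (nᶜ u v))))))
  ... | true  , u | true  , v = inj₂ (∣⇒∣ᵤ (subst (+ 32 ∣ₛ_) (sym factors)
    (∣-* (∣-* (subst (+ 8 ∣ₛ_) (identity p q) (∣m∣n⇒∣m-n (odd⇒8∣square-1 u) (odd⇒8∣square-1 v)))
      (2∣ (xᵇ u v) (yᶜ u v))) (2∣ (mᵇ u v) (nᶜ u v)))))
    where
    identity : ∀ p q → (p * p - 1ℤ) - (q * q - 1ℤ) ≡ p * p - q * q
    identity = solve-∀
  ... | true  , u | false , v = inj₁ (¬even-odd (subst (Parity true) (sym factors)
    (Parity-* (Parity-* (difference u v) (squares (xᵇ u v) (yᶜ u v)))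
      (squares (mᵇ u v) (nᶜ u v)))))
  ... | false , u | true  , v = inj₁ (¬even-odd (subst (Parity true) (sym factors)
    (Parity-* (Parity-* (difference u v) (squares (xᵇ u v) (yᶜ u v)))
      (squares (mᵇ u v) (nᶜ u v)))))

-- Realisation of the admissible pairs

-- A zero left factor discards `y` unevaluated, which is what prunes the expansion in `sparseDet`.
_⊡_ : ℤ[ω] → ℤ[ω] → ℤ[ω]
⟪ + 0 , + 0 ⟫ ⊡ y = ι 0ℤ
x             ⊡ y = x *ᵉ y

⊡-* : ∀ x y → x ⊡ y ≡ x *ᵉ y
⊡-* ⟪ + 0       , + 0       ⟫ y = sym (ℤ[ω]ᴿ.zeroˡ y)
⊡-* ⟪ + 0       , + suc _   ⟫ y = refl
⊡-* ⟪ + 0       , -[1+ _ ] ⟫ y = refl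
⊡-* ⟪ + suc _   , _         ⟫ y = refl
⊡-* ⟪ -[1+ _ ] , _         ⟫ y = refl

-- Laplace expansion skipping zero entries, for evaluating determinants of sparse matrices.
sparseDet : ∀ {n} → Vec (Vec ℤ[ω] n) n → ℤ[ω]
sparseDet []      = ι 1ℤ
sparseDet (r ∷ M) = sum λ j → (-ᵉ ι 1ℤ) ^ᵉ toℕ j *ᵉ
  (lookup r j ⊡ sparseDet (Vec.map (λ r′ → tabulate λ k → lookup r′ (punchIn j k)) M))

sparseDet-det : ∀ {n} (M : Vec (Vec ℤ[ω] n) n) →
  sparseDet M ≡ Determinant.det ℤ[ω]-commutativeRing (λ i j → lookup (lookup M i) j)
sparseDet-det []      = refl
sparseDet-det {suc n} (r ∷ M) = sum-cong-≋ {suc n} λ j → cong ((-ᵉ ι 1ℤ) ^ᵉ toℕ j *ᵉ_) (trans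
  (⊡-* (lookup r j) _)
  (cong (lookup r j *ᵉ_) (trans (sparseDet-det (Vec.map (delete j) M))
    (trans (sym (Detω.det-def _)) (trans (Detω.det-cong λ i k → trans
      (cong (λ r′ → lookup r′ k) (lookup-map i (delete j) M)) (lookup∘tabulate _ k)) (Detω.det-def _))))))
  where
  delete : Fin (suc n) → Vec ℤ[ω] (suc n) → Vec ℤ[ω] n
  delete j r′ = tabulate λ k → lookup r′ (punchIn j k)

tabulateMatrix : ∀ {n} → Detω.Matrix n n → Vec (Vec ℤ[ω] n) n
tabulateMatrix M = tabulate λ i → tabulate (M i)

det-sparse : ∀ {n} (M : Detω.Matrix n n) → Detω.det M ≡ sparseDet (tabulateMatrix M)
det-sparse M = trans (Detω.det-cong λ i j → sym (trans
  (cong (λ r → lookup r j) (lookup∘tabulate (λ i → tabulate (M i)) i)) (lookup∘tabulate (M i) j)))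
  (trans (Detω.det-def _) (sym (sparseDet-det (tabulateMatrix M))))

Ψ-scale : ∀ t a f → Ψ t (λ x → a * f x) ≡ ι a *ᵉ Ψ t f
Ψ-scale t a f = trans
  (∑ω.∑₉-cong λ x → trans (cong (_*ᵉ ψ (t F₉.* x)) (ι-* a (f x))) (*ᵉ-assoc (ι a) (ι (f x)) (ψ (t F₉.* x))))
  (sym (∑ω.∑₉-*ˡ (ι a) (λ x → ι (f x) *ᵉ ψ (t F₉.* x))))

-- Rank one perturbations of a circulant

module Perturbation (f : Fin 8 → ℤ) (n : F₉) where

  -- The coefficients of Σ f(h) h + (1 , 1) (Σ h) (p₀ + p₁ (1 , n)), where h runs over the linear maps.
  coefficients : ℤ → ℤ → GA → ℤ
  coefficients p₀ p₁ h = f (linear h) * ∑ℤ.𝟙₀ (GA.b h)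
    + (p₀ * ∑ℤ.𝟙₀ (GA.b h ⊖ F₉.1#) + p₁ * ∑ℤ.𝟙₀ (GA.b h ⊖ (F₉.1# F₉.+ GA.a h F₉.* n)))

  C : Detω.Matrix 8 8
  C k l = ι (f (k ⊘ l))

  v : F₉ → Detω.Row 8
  v t k = ψ (t F₉.* u k F₉.⁻¹)

  w : F₉ → Detω.Row 8
  w t l = ψ (t F₉.* (n F₉.* u l F₉.⁻¹))

  -- In `quotient k l x` the second entry is `u k` times `x`. The `p₀` term is supported at x =
  -- `u k ⁻¹`, the `p₁` term at x = `u k ⁻¹ + n * u l ⁻¹`, where the character splits as `v t k`
  -- times `w t l`. Both terms have the same left factor, hence rank one.
  block-coefficients : ∀ p₀ p₁ t k l →
    block (coefficients p₀ p₁) t k l ≡ C k l +ᵉ v t k *ᵉ (ι p₀ +ᵉ ι p₁ *ᵉ w t l)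
  block-coefficients p₀ p₁ t k l = begin
    Ψ t (λ x → coefficients p₀ p₁ (quotient k l x))
      ≡⟨ Ψ-+ t (λ x → f (k ⊘ l) * e₀ x) (λ x → p₀ * e₁ x + p₁ * e₂ x) ⟩
    Ψ t (λ x → f (k ⊘ l) * e₀ x) +ᵉ Ψ t (λ x → p₀ * e₁ x + p₁ * e₂ x)
      ≡⟨ cong₂ _+ᵉ_ (Ψ-scale t (f (k ⊘ l)) e₀)
           (trans (Ψ-+ t (λ x → p₀ * e₁ x) (λ x → p₁ * e₂ x)) (cong₂ _+ᵉ_ (Ψ-scale t p₀ e₁) (Ψ-scale t p₁ e₂))) ⟩
    C k l *ᵉ Ψ t e₀ +ᵉ (ι p₀ *ᵉ Ψ t e₁ +ᵉ ι p₁ *ᵉ Ψ t e₂)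
      ≡⟨ cong₂ _+ᵉ_ (trans (cong (C k l *ᵉ_) check₀) (ℤ[ω]ᴿ.*-identityʳ (C k l)))
           (cong₂ (λ y z → ι p₀ *ᵉ y +ᵉ ι p₁ *ᵉ z) check₁ check₂) ⟩
    C k l +ᵉ (ι p₀ *ᵉ v t k +ᵉ ι p₁ *ᵉ (v t k *ᵉ w t l))
      ≡⟨ cong (C k l +ᵉ_) (regroup (ι p₀) (ι p₁) (v t k) (w t l)) ⟩
    C k l +ᵉ v t k *ᵉ (ι p₀ +ᵉ ι p₁ *ᵉ w t l) ∎
    where
    open ≡-Reasoning
    e₀ e₁ e₂ : F₉ → ℤ
    e₀ x = ∑ℤ.𝟙₀ (GA.b (quotient k l x))
    e₁ x = ∑ℤ.𝟙₀ (GA.b (quotient k l x) ⊖ F₉.1#)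
    e₂ x = ∑ℤ.𝟙₀ (GA.b (quotient k l x) ⊖ (F₉.1# F₉.+ GA.a (quotient k l x) F₉.* n))

    select : ∀ t y (e : F₉ → ℤ) → (∀ x → e x ≡ ∑ℤ.𝟙₀ (x ⊖ y)) → Ψ t e ≡ ψ (t F₉.* y)
    select t y e eq = trans (Ψ-cong t eq) (from-yes (∀F₉? λ t → ∀F₉? λ y →
      Ψ t (λ x → ∑ℤ.𝟙₀ (x ⊖ y)) ≟ᵉ ψ (t F₉.* y)) t y)

    check₀ : Ψ t e₀ ≡ ι 1ℤ
    check₀ = trans (select t F₉.0# e₀ λ x → from-yes (all? λ k → all? λ l → ∀F₉? λ x →
      ∑ℤ.𝟙₀ (GA.b (quotient k l x)) ℤ.≟ ∑ℤ.𝟙₀ (x ⊖ F₉.0#)) k l x) (cong ψ (F₉.*-zeroʳ t))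

    check₁ : Ψ t e₁ ≡ v t k
    check₁ = select t (u k F₉.⁻¹) e₁ λ x → from-yes (all? λ k → all? λ l → ∀F₉? λ x →
      ∑ℤ.𝟙₀ (GA.b (quotient k l x) ⊖ F₉.1#) ℤ.≟ ∑ℤ.𝟙₀ (x ⊖ u k F₉.⁻¹)) k l x

    check₂ : Ψ t e₂ ≡ v t k *ᵉ w t l
    check₂ = trans
      (select t (u k F₉.⁻¹ F₉.+ n F₉.* u l F₉.⁻¹) e₂ λ x → from-yes (∀F₉? λ n → all? λ k → all? λ l → ∀F₉? λ x →
        ∑ℤ.𝟙₀ (GA.b (quotient k l x) ⊖ (F₉.1# F₉.+ GA.a (quotient k l x) F₉.* n))
          ℤ.≟ ∑ℤ.𝟙₀ (x ⊖ (u k F₉.⁻¹ F₉.+ n F₉.* u l F₉.⁻¹))) n k l x)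
      (trans (cong ψ (F₉.*-distribˡ-+ t (u k F₉.⁻¹) (n F₉.* u l F₉.⁻¹)))
        (ψ-+ (t F₉.* u k F₉.⁻¹) (t F₉.* (n F₉.* u l F₉.⁻¹))))

    regroup : ∀ a b v w → a *ᵉ v +ᵉ b *ᵉ (v *ᵉ w) ≡ v *ᵉ (a +ᵉ b *ᵉ w)
    regroup a b v w = trans (cong₂ _+ᵉ_ (*ᵉ-comm a v)
        (trans (sym (*ᵉ-assoc b v w)) (trans (cong (_*ᵉ w) (*ᵉ-comm b v)) (*ᵉ-assoc v b w))))
      (sym (*ᵉ-distribˡ v a (b *ᵉ w)))

  bordered : F₉ → Detω.Row 9 → ℤ[ω]
  bordered t r = Detω.det (Detω.border r (v t) C)

  -- With zero in the corner the bordered determinant is the row times the adjugate of `C` times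
  -- `v t`. The all-ones row is an eigenvector of that adjugate with value κ, so `row₁` gives κ
  -- times the sum of `v t`: 8 κ at the trivial character, - κ at a nontrivial one.
  row₀ row₁ : Detω.Row 9
  row₀ = ι 1ℤ Functional.∷ λ _ → ι 0ℤ
  row₁ = ι 0ℤ Functional.∷ λ _ → ι 1ℤ
  row₂ : F₉ → Detω.Row 9
  row₂ t = ι 0ℤ Functional.∷ w t

  -- By `det-rank-one` the parameters enter only the first row of the bordered matrix, in which
  -- `det` is linear. The three remaining determinants are free of `p₀` and `p₁`, so they can be
  -- evaluated for concrete `f` and `n`.
  det-block-coefficients : ∀ p₀ p₁ t → Detω.det (block (coefficients p₀ p₁) t) ≡
    bordered t row₀ +ᵉ (ι p₀ *ᵉ bordered t row₁ +ᵉ ι p₁ *ᵉ bordered t (row₂ t))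
  det-block-coefficients p₀ p₁ t = begin
    Detω.det (block (coefficients p₀ p₁) t)
      ≡⟨ Detω.det-cong (block-coefficients p₀ p₁ t) ⟩
    Detω.det (λ k l → C k l +ᵉ v t k *ᵉ (ι p₀ +ᵉ ι p₁ *ᵉ w t l))
      ≡⟨ Detω.det-rank-one 8 (λ l → ι p₀ +ᵉ ι p₁ *ᵉ w t l) (v t) C ⟩
    bordered t (ι 1ℤ Functional.∷ λ l → ι p₀ +ᵉ ι p₁ *ᵉ w t l)
      ≡⟨ L.cong split ⟩
    bordered t (row₀ Detω.⊕ ((ι p₀ Detω.⊙ row₁) Detω.⊕ (ι p₁ Detω.⊙ row₂ t)))
      ≡⟨ trans (L.add _ _) (cong (bordered t row₀ +ᵉ_) (trans (L.add _ _) (cong₂ _+ᵉ_ (L.scal _ _) (L.scal _ _)))) ⟩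
    bordered t row₀ +ᵉ (ι p₀ *ᵉ bordered t row₁ +ᵉ ι p₁ *ᵉ bordered t (row₂ t)) ∎
    where
    open ≡-Reasoning
    module L = Detω.IsLinear (Detω.det-first-row 8 (λ k → -ᵉ v t k Functional.∷ C k))
    split : ∀ j → (ι 1ℤ Functional.∷ λ l → ι p₀ +ᵉ ι p₁ *ᵉ w t l) j
                ≡ (row₀ Detω.⊕ ((ι p₀ Detω.⊙ row₁) Detω.⊕ (ι p₁ Detω.⊙ row₂ t))) j
    split zero    = sym (trans (cong₂ (λ x y → ι 1ℤ +ᵉ (x +ᵉ y)) (ℤ[ω]ᴿ.zeroʳ (ι p₀)) (ℤ[ω]ᴿ.zeroʳ (ι p₁))) refl)
    split (suc l) = sym (trans (ℤ[ω]ᴿ.+-identityˡ _) (cong (_+ᵉ ι p₁ *ᵉ w t l) (ℤ[ω]ᴿ.*-identityʳ (ι p₀))))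

  -- κ is the product of the values of Σ f(h) h at the nontrivial characters; d that at all of them.
  Evaluation : (d κ e : ℤ) → Set
  Evaluation d κ e =
      bordered F₉.0# row₀ ≡ ι d × bordered F₉.0# row₁ ≡ ι (+ 8 * κ) × bordered F₉.0# (row₂ F₉.0#) ≡ ι (+ 8 * κ)
    × bordered F₉.1# row₀ ≡ ι d × bordered F₉.1# row₁ ≡ ι (- κ)     × bordered F₉.1# (row₂ F₉.1#) ≡ ι (- κ + + 9 * e)

  evaluation? : ∀ d κ e → Dec (Evaluation d κ e)
  evaluation? d κ e =
          value? F₉.0# row₀ d ×-dec value? F₉.0# row₁ (+ 8 * κ) ×-dec value? F₉.0# (row₂ F₉.0#) (+ 8 * κ)
    ×-dec value? F₉.1# row₀ d ×-dec value? F₉.1# row₁ (- κ)     ×-dec value? F₉.1# (row₂ F₉.1#) (- κ + + 9 * e)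
    where
    value? : ∀ t r x → Dec (bordered t r ≡ ι x)
    value? t r x = map′ (trans (det-sparse M)) (trans (sym (det-sparse M))) (sparseDet (tabulateMatrix M) ≟ᵉ ι x)
      where M = Detω.border r (v t) C

-- A = d + 8 κ (p₀ + p₁) and B = d - κ (p₀ + p₁) + 9 e p₁, and e = ± 1 allows solving for p₀ and p₁.
realise : ∀ f n {d κ e} → Perturbation.Evaluation f n d κ e → e * e ≡ 1ℤ → ∀ S q → ∃[ α ]
  Detω.det (block α F₉.0#) ≡ ι (d + + 8 * κ * S) × Detω.det (block α F₉.1#) ≡ ι (d + + 8 * κ * S + + 9 * q)
realise f n {d} {κ} {e} (v₀₀ , v₀₁ , v₀₂ , v₁₀ , v₁₁ , v₁₂) e² S q =
    Perturbation.coefficients f n p₀ p₁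
  , trans (trans (det-block-coefficients p₀ p₁ F₉.0#) (value F₉.0# v₀₀ v₀₁ v₀₂)) (cong ι (trivial d κ S p₁))
  , trans (trans (det-block-coefficients p₀ p₁ F₉.1#) (value F₉.1# v₁₀ v₁₁ v₁₂))
      (cong ι (trans (nontrivial d κ S p₁ (+ 9 * e)) (trans
      (cong (λ x → d - κ * S + x) (trans (square q κ S e) (cong (λ x → + 9 * (x * (q + κ * S))) e²)))
      (final d κ S q))))
  where
  open Perturbation f n
  -- Equating d - κ S + 9 e p₁ with d + 8 κ S + 9 q leaves e p₁ = q + κ S, and `e` is its own
  -- inverse.
  p₁ = e * (q + κ * S)
  p₀ = S - p₁

  value : ∀ t {r₀ r₁ r₂ x y z} → bordered t r₀ ≡ ι x → bordered t r₁ ≡ ι y → bordered t r₂ ≡ ι z →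
    bordered t r₀ +ᵉ (ι p₀ *ᵉ bordered t r₁ +ᵉ ι p₁ *ᵉ bordered t r₂) ≡ ι (x + (p₀ * y + p₁ * z))
  value t {y = y} {z} x≡ y≡ z≡ = cong₂ _+ᵉ_ x≡ (cong₂ _+ᵉ_
    (trans (cong (ι p₀ *ᵉ_) y≡) (sym (ι-* p₀ y))) (trans (cong (ι p₁ *ᵉ_) z≡) (sym (ι-* p₁ z))))

  trivial : ∀ d κ S p → d + ((S - p) * (+ 8 * κ) + p * (+ 8 * κ)) ≡ d + + 8 * κ * S
  trivial = solve-∀

  nontrivial : ∀ d κ S p x → d + ((S - p) * - κ + p * (- κ + x)) ≡ d - κ * S + p * x
  nontrivial = solve-∀

  square : ∀ q κ S e → e * (q + κ * S) * (+ 9 * e) ≡ + 9 * (e * e * (q + κ * S))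
  square = solve-∀

  final : ∀ d κ S q → d - κ * S + + 9 * (1ℤ * (q + κ * S)) ≡ d + + 8 * κ * S + + 9 * q
  final = solve-∀

record Attained (A : ℤ) : Set where
  constructor attains
  field
    attain : ∀ q → ∃[ α ]
      Detω.det (block α F₉.0#) ≡ ι A × Detω.det (block α F₉.1#) ≡ ι (A + + 9 * q)

attained : ∀ f n {d κ e} → Perturbation.Evaluation f n d κ e → e * e ≡ 1ℤ → ∀ S {A} → A ≡ d + + 8 * κ * S → Attained A
attained f n ev e² S refl = attains (realise f n ev e² S)

-- With x a generator of C₈ the choices for Σ f(h) h are 1, - x, 1 + x + x², - x (1 + x + x²),
-- 1 - x and 1 + x + x² + x⁴, and n is chosen to make B vary by ± 9 with p₁.
attained-1 : ∀ S {A} → A ≡ + 1 + + 8 * + 1 * S → Attained A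
attained-1 = attained f (u 4F) {e = + 1} (from-yes (Perturbation.evaluation? f (u 4F) (+ 1) (+ 1) (+ 1))) refl
  where f = lookup (+ 1 ∷ + 0 ∷ + 0 ∷ + 0 ∷ + 0 ∷ + 0 ∷ + 0 ∷ + 0 ∷ [])

-- The factor x makes `d` negative, since a cycle of length eight is an odd permutation. The sign
-- leaves `d` alone but makes the value at the trivial character negative too, so that κ is 1;
-- `attained-5` uses the same device.
attained-7 : ∀ S {A} → A ≡ - + 1 + + 8 * + 1 * S → Attained A
attained-7 = attained f (u 3F) {e = + 1} (from-yes (Perturbation.evaluation? f (u 3F) (- + 1) (+ 1) (+ 1))) refl
  where f = lookup (+ 0 ∷ - + 1 ∷ + 0 ∷ + 0 ∷ + 0 ∷ + 0 ∷ + 0 ∷ + 0 ∷ [])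

attained-3 : ∀ S {A} → A ≡ + 3 + + 8 * + 1 * S → Attained A
attained-3 = attained f (u 0F) {e = - + 1} (from-yes (Perturbation.evaluation? f (u 0F) (+ 3) (+ 1) (- + 1))) refl
  where f = lookup (+ 1 ∷ + 1 ∷ + 1 ∷ + 0 ∷ + 0 ∷ + 0 ∷ + 0 ∷ + 0 ∷ [])

attained-5 : ∀ S {A} → A ≡ - + 3 + + 8 * + 1 * S → Attained A
attained-5 = attained f (u 0F) {e = - + 1} (from-yes (Perturbation.evaluation? f (u 0F) (- + 3) (+ 1) (- + 1))) refl
  where f = lookup (+ 0 ∷ - + 1 ∷ - + 1 ∷ - + 1 ∷ + 0 ∷ + 0 ∷ + 0 ∷ + 0 ∷ [])

-- 1 - x vanishes at the trivial character, so `d` is 0. The parts of κ from -1, from ± i and from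
-- the primitive eighth roots are 2 each, so A moves in steps of 64.
attained-64 : ∀ S {A} → A ≡ + 0 + + 8 * + 8 * S → Attained A
attained-64 = attained f (u 0F) {e = + 1} (from-yes (Perturbation.evaluation? f (u 0F) (+ 0) (+ 8) (+ 1))) refl
  where f = lookup (+ 1 ∷ - + 1 ∷ + 0 ∷ + 0 ∷ + 0 ∷ + 0 ∷ + 0 ∷ + 0 ∷ [])

-- The value at the trivial character is 4, and the three parts of κ are again 2 each, so `d` is 32.
-- This fills the gaps between the multiples of 64.
attained-32 : ∀ S {A} → A ≡ + 32 + + 8 * + 8 * S → Attained A
attained-32 = attained f (u 4F) {e = - + 1} (from-yes (Perturbation.evaluation? f (u 4F) (+ 32) (+ 8) (- + 1))) refl
  where f = lookup (+ 1 ∷ + 1 ∷ + 1 ∷ + 0 ∷ + 1 ∷ + 0 ∷ + 0 ∷ + 0 ∷ [])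

-- The residues 5 and 7 appear as -3 and -1, the values of `d` at which κ is 1.
data Residue (A : ℤ) : Set where
  residue-even : ∀ k → A ≡ k * + 2 → Residue A
  residue-1    : ∀ k → A ≡ + 1 + + 8 * + 1 * k → Residue A
  residue-3    : ∀ k → A ≡ + 3 + + 8 * + 1 * k → Residue A
  residue-5    : ∀ k → A ≡ - + 3 + + 8 * + 1 * k → Residue A
  residue-7    : ∀ k → A ≡ - + 1 + + 8 * + 1 * k → Residue A

residue? : ∀ A → Residue A
residue? A with A % + 8 | a≡a%n+[a/n]*n A (+ 8) | n%d<d A (+ 8)
... | 0 | eq | _ = residue-even (A / + 8 * + 4) (trans eq (identity (A / + 8)))
  where
  identity : ∀ k → + 0 + k * + 8 ≡ k * + 4 * + 2
  identity = solve-∀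
... | 1 | eq | _ = residue-1 (A / + 8) (trans eq (identity (A / + 8)))
  where
  identity : ∀ k → + 1 + k * + 8 ≡ + 1 + + 8 * + 1 * k
  identity = solve-∀
... | 2 | eq | _ = residue-even (+ 1 + A / + 8 * + 4) (trans eq (identity (A / + 8)))
  where
  identity : ∀ k → + 2 + k * + 8 ≡ (+ 1 + k * + 4) * + 2
  identity = solve-∀
... | 3 | eq | _ = residue-3 (A / + 8) (trans eq (identity (A / + 8)))
  where
  identity : ∀ k → + 3 + k * + 8 ≡ + 3 + + 8 * + 1 * k
  identity = solve-∀
... | 4 | eq | _ = residue-even (+ 2 + A / + 8 * + 4) (trans eq (identity (A / + 8)))
  where
  identity : ∀ k → + 4 + k * + 8 ≡ (+ 2 + k * + 4) * + 2
  identity = solve-∀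
-- As 5 = -3 + 8, the quotient goes up by one; the same holds for 7 = -1 + 8.
... | 5 | eq | _ = residue-5 (A / + 8 + + 1) (trans eq (identity (A / + 8)))
  where
  identity : ∀ k → + 5 + k * + 8 ≡ - + 3 + + 8 * + 1 * (k + + 1)
  identity = solve-∀
... | 6 | eq | _ = residue-even (+ 3 + A / + 8 * + 4) (trans eq (identity (A / + 8)))
  where
  identity : ∀ k → + 6 + k * + 8 ≡ (+ 3 + k * + 4) * + 2
  identity = solve-∀
... | 7 | eq | _ = residue-7 (A / + 8 + + 1) (trans eq (identity (A / + 8)))
  where
  identity : ∀ k → + 7 + k * + 8 ≡ - + 1 + + 8 * + 1 * (k + + 1)
  identity = solve-∀
... | suc (suc (suc (suc (suc (suc (suc (suc _))))))) | _ | s≤s (s≤s (s≤s (s≤s (s≤s (s≤s (s≤s (s≤s ())))))))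

odd-attained : ∀ A → ¬ + 2 ∣ A → Attained A
odd-attained A 2∤A with residue? A
... | residue-even k eq = contradiction (∣⇒∣ᵤ (divides k eq)) 2∤A
... | residue-1 k eq = attained-1 k eq
... | residue-3 k eq = attained-3 k eq
... | residue-5 k eq = attained-5 k eq
... | residue-7 k eq = attained-7 k eq

32∣-attained : ∀ A → (+ 2) ^ 5 ∣ A → Attained A
32∣-attained A 32∣A with ∣ᵤ⇒∣ {+ 32} {A} 32∣A
... | divides m A≡ with parity m
...   | false , residue (divides k m≡) = attained-64 k
      (trans A≡ (trans (cong (_* + 32) (trans (sym (ℤ.+-identityʳ m)) m≡)) (identity k)))
  where
  identity : ∀ k → k * + 2 * + 32 ≡ + 0 + + 8 * + 8 * k
  identity = solve-∀
...   | true  , residue (divides k m≡) = attained-32 k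
      (trans A≡ (trans (cong (_* + 32) (add-back m)) (trans (cong (λ x → (x + 1ℤ) * + 32) m≡) (identity k))))
  where
  add-back : ∀ m → m ≡ (m - 1ℤ) + 1ℤ
  add-back = solve-∀
  identity : ∀ k → (k * + 2 + 1ℤ) * + 32 ≡ + 32 + + 8 * + 8 * k
  identity = solve-∀

-- Integer group determinants for an arbitrary enumeration

module _ (g : Fin 72 ↔ GA) where
  open GroupDeterminant GA[1,9] g using (groupDeterminant)

  groupDeterminant-def : ∀ a →
    DetZ.det (λ i j → Func.to a (Inverse.to g i ∙ inv (Inverse.to g j))) ≡ groupDeterminant a
  groupDeterminant-def a = DetZ.det-def λ i j →
    Func.to a (Group._∙_ GA[1,9] (Inverse.to g i) (Group._⁻¹ GA[1,9] (Inverse.to g j)))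

  factors : ∀ a b → Detω.det (block (Func.to a) F₉.1#) ≡ ι b →
    groupDeterminant a ≡ DetZ.det (circulant (cosetSum (Func.to a))) * b ^ 8
  factors a b eq = trans (sym (groupDeterminant-def a)) (groupDeterminant-factors g (Func.to a) b eq)

theorem5 : (g : Fin 72 ↔ GA) (D : ℤ) →
    GroupDeterminant.IsIntegerGroupDeterminant GA[1,9] g D
    ⇔ (∃[ A ] ∃[ B ] D ≡ A * B ^ 8 × (¬ + 2 ∣ A ⊎ (+ 2) ^ 5 ∣ A) × + 9 ∣ B - A)
theorem5 g D = mk⇔ forward backward
  where
  open GroupDeterminant GA[1,9] g using (IsIntegerGroupDeterminant)

  forward : IsIntegerGroupDeterminant D →
    ∃[ A ] ∃[ B ] D ≡ A * B ^ 8 × (¬ + 2 ∣ A ⊎ (+ 2) ^ 5 ∣ A) × + 9 ∣ B - A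
  forward (a , D≡) =
    let B , q , det≡B , A+8B≡9q = block-congruence (Func.to a) in
      A , B
    , trans D≡ (factors g a B det≡B)
    , CirculantParity.circulant-parity (cosetSum (Func.to a))
    -- B - A is 9 B - (A + 8 B), and the inversion formula makes the bracket 9 q.
    , ∣⇒∣ᵤ (divides (B - q)
        (trans (regroup A B) (trans (cong (λ x → + 9 * B - x) A+8B≡9q) (collect B q))))
    where
    A = DetZ.det (circulant (cosetSum (Func.to a)))
    regroup : ∀ A B → B - A ≡ + 9 * B - (A + + 8 * B)
    regroup = solve-∀
    collect : ∀ B q → + 9 * B - q * + 9 ≡ (B - q) * + 9
    collect = solve-∀

  backward : (∃[ A ] ∃[ B ] D ≡ A * B ^ 8 × (¬ + 2 ∣ A ⊎ (+ 2) ^ 5 ∣ A) × + 9 ∣ B - A) →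
    IsIntegerGroupDeterminant D
  backward (A , B , D≡ , A-cond , 9∣B-A) =
    let divides q B-A≡9q = ∣ᵤ⇒∣ {+ 9} {B - A} 9∣B-A
        α , A≡ , B≡             = Attained.attain {A} ([ odd-attained A , 32∣-attained A ] A-cond) q
        a                       = record { to = α ; cong = cong α }
        A+9q≡B                  = trans (cong (λ x → A + x) (trans (ℤ.*-comm (+ 9) q) (sym B-A≡9q))) (add-back A B)
    in a , trans D≡ (sym (trans (factors g a B (trans B≡ (cong ι A+9q≡B)))
             (cong (_* B ^ 8) (cong re (trans (sym (det-block-0 α)) A≡)))))
    where
    add-back : ∀ A B → A + (B - A) ≡ B
    add-back = solve-∀
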